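{- \textsc{Imbalance} is fixed-parameter tractable parameterized by $k+\ell$: there is an algorithm that, given a graph $G$ on $n$ vertices (given explicitly), an $\ell$-bounded twin cover $S\subseteq V(G)$ of $G$ with $|S|=k$, and an integer $t$, decides whether $\mathcal{I}(G)\le t$ in time $f(k,\ell)\cdot n^{O(1)}$ for some computable function $f$.
   Context: All graphs are finite, simple and undirected. A layout of $G=(V,E)$ is a linear ordering $\sigma$ of $V$; for $v\in V$, $N_L(v,\sigma)$ (resp. $N_R(v,\sigma)$) is the set of neighbours of $v$ preceding (resp. following) $v$ in $\sigma$. The imbalance of $v$ is $\mathcal{I}(v,\sigma)=\big||N_L(v,\sigma)|-|N_R(v,\sigma)|\big|$, $\mathcal{I}(\sigma)=\sum_{v}\mathcal{I}(v,\sigma)$, and $\mathcal{I}(G)=\min_\sigma\mathcal{I}(\sigma)$ over all layouts. A twin cover of $G$ is a set $S\subseteq V$ such that every connected component $X$ of $G-S$ is a set of true twins in $G$ ($N[u]=N[v]$ for all $u,v\in X$; in particular each such component is a clique). A twin cover $S$ is $\ell$-bounded if every connected component of $G-S$ has at most $\ell$ vertices. -}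

module Defs where

open import Algebra.Properties.CommutativeMonoid.Sum using (sum)
open import Data.Bool.Base using (Bool; true; false)
open import Data.Fin.Base using (Fin; zero; suc; punchIn)
open import Data.Fin.Permutation as Perm using (Permutation; Permutation′; _⟨$⟩ʳ_)
open import Data.Fin.Properties using (_<?_)
open import Data.Fin.Subset using (Subset; _∈_; _∉_; _∩_; _∪_; ⁅_⁆; ∣_∣)
open import Data.Integer.Base using (ℤ; +_; -[1+_])
open import Data.List.Base as List using (List; allFin; cartesianProductWith)
open import Data.List.Extrema.Nat using (argmin; f[argmin]≤f[xs])
import Data.List.Membership.Propositional as List
open import Data.List.Membership.Propositional.Properties using (∈-allFin; ∈-cartesianProductWith⁺)
import Data.List.Relation.Unary.All as All
open import Data.List.Relation.Unary.Any using (here)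
open import Data.Nat.Base using (ℕ; zero; suc; _+_; _≤_; ∣_-_∣)
open import Data.Nat.Binary.Base as ℕᵇ using (ℕᵇ; 2[1+_]; 1+[2_])
import Data.Nat.Properties as ℕ
open import Data.Product.Base using (∃; _×_; _,_; proj₁)
open import Data.Vec.Base as Vec using (Vec; []; _∷_; tabulate; lookup)
open import Data.Vec.Properties using (tabulate-cong)
open import Function.Bundles using (_⇔_)
open import Relation.Binary.Construct.Closure.ReflexiveTransitive using (Star)
open import Relation.Binary.PropositionalEquality
  using (_≡_; refl; sym; trans; cong; cong₂; subst)
open import Relation.Nullary.Decidable using (⌊_⌋)

record Graph (n : ℕ) : Set where
  field
    N         : Fin n → Subset n
    loopless  : ∀ v → v ∉ N v
    symmetric : ∀ {u v} → u ∈ N v → v ∈ N u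

  N[_] : Fin n → Subset n
  N[ v ] = N v ∪ ⁅ v ⁆

open Graph public

-- A layout σ sends each vertex v to its position σ ⟨$⟩ʳ v.
Layout : ℕ → Set
Layout = Permutation′

before after : ∀ {n} → Layout n → Fin n → Subset n
before σ v = tabulate λ u → ⌊ σ ⟨$⟩ʳ u <? σ ⟨$⟩ʳ v ⌋
after  σ v = tabulate λ u → ⌊ σ ⟨$⟩ʳ v <? σ ⟨$⟩ʳ u ⌋

module _ {n : ℕ} (G : Graph n) where

  Nᴸ Nᴿ : Fin n → Layout n → Subset n
  Nᴸ v σ = N G v ∩ before σ v
  Nᴿ v σ = N G v ∩ after σ v

  vertexImbalance : Fin n → Layout n → ℕ
  vertexImbalance v σ = ∣ ∣ Nᴸ v σ ∣ - ∣ Nᴿ v σ ∣ ∣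

  layoutImbalance : Layout n → ℕ
  layoutImbalance σ = sum ℕ.+-0-commutativeMonoid λ v → vertexImbalance v σ

-- Every layout occurs in this list up to pointwise equality: position j is
-- chosen for vertex 0, and the other vertices are laid out around it.
layouts : ∀ n → List (Layout n)
layouts zero    = List.[ Perm.id ]
layouts (suc n) = cartesianProductWith (Perm.insert zero) (allFin (suc n)) (layouts n)

-- The first argument Perm.id of argmin is only the default of a search that
-- never runs over an empty list; it is itself a layout.
optimalLayout : ∀ {n} → Graph n → Layout n
optimalLayout {n} G = argmin (layoutImbalance G) Perm.id (layouts n)

imbalance : ∀ {n} → Graph n → ℕ
imbalance G = layoutImbalance G (optimalLayout G)

layouts-complete : ∀ {n} (σ : Layout n) → ∃ λ τ → (τ List.∈ layouts n) × (τ Perm.≈ σ)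
layouts-complete {zero}  σ = Perm.id , here refl , λ ()
layouts-complete {suc n} σ with layouts-complete (Perm.remove zero σ)
... | τ , τ∈ , τ≈ =
  Perm.insert zero j τ , ∈-cartesianProductWith⁺ (Perm.insert zero) (∈-allFin j) τ∈ , eq
  where
  j = σ ⟨$⟩ʳ zero
  eq : Perm.insert zero j τ Perm.≈ σ
  eq zero    = Perm.insert-remove zero σ zero
  eq (suc i) = trans
    (Perm.insert-punchIn zero j τ i)
    (trans (cong (punchIn j) (τ≈ i)) (sym (Perm.punchIn-permute σ zero i)))

layoutImbalance-cong : ∀ {n} (G : Graph n) {σ τ : Layout n} → σ Perm.≈ τ →
                       layoutImbalance G σ ≡ layoutImbalance G τ
layoutImbalance-cong G {σ} {τ} σ≈τ = sum-cong λ v → cong₂ ∣_-_∣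
  (cong (λ X → ∣ N G v ∩ X ∣)
    (tabulate-cong λ u → cong₂ (λ p q → ⌊ p <? q ⌋) (σ≈τ u) (σ≈τ v)))
  (cong (λ X → ∣ N G v ∩ X ∣)
    (tabulate-cong λ u → cong₂ (λ p q → ⌊ p <? q ⌋) (σ≈τ v) (σ≈τ u)))
  where
  open import Algebra.Properties.CommutativeMonoid.Sum ℕ.+-0-commutativeMonoid
    using () renaming (sum-cong-≗ to sum-cong)

imbalance-minimal : ∀ {n} (G : Graph n) σ → imbalance G ≤ layoutImbalance G σ
imbalance-minimal {n} G σ with layouts-complete σ
... | τ , τ∈ , τ≈σ = subst (imbalance G ≤_) (layoutImbalance-cong G {τ} {σ} τ≈σ)
  (All.lookup (f[argmin]≤f[xs] {f = layoutImbalance G} Perm.id (layouts n)) τ∈)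

module _ {n : ℕ} (G : Graph n) (S : Subset n) where

  -- u and v are adjacent in G - S
  Adjacent : Fin n → Fin n → Set
  Adjacent u v = u ∉ S × v ∉ S × v ∈ N G u

  Reachable : Fin n → Fin n → Set
  Reachable = Star Adjacent

  IsComponent : Subset n → Set
  IsComponent X = ∃ λ v → v ∉ S × (∀ u → u ∈ X ⇔ Reachable v u)

  IsTwinCover : Set
  IsTwinCover = ∀ X → IsComponent X → ∀ u v → u ∈ X → v ∈ X → N[_] G u ≡ N[_] G v

  IsBounded : ℕ → Set
  IsBounded ℓ = ∀ X → IsComponent X → ∣ X ∣ ≤ ℓ

-- Structured while-programs over binary trees at unit cost: Jones's WHILE
-- language (Computability and Complexity from a Programming Perspective) with
-- immutable, de Bruijn indexed variables. An operation allocates at most one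
-- cell and otherwise only moves pointers, so with shared subtrees t steps are
-- simulated by a Turing machine or RAM in time polynomial in t and the input
-- size, and conversely.

data Tree : Set where
  nil  : Tree
  cons : Tree → Tree → Tree

data Program (m : ℕ) : Set where
  var   : Fin m → Program m
  nil   : Program m
  cons  : Program m → Program m → Program m
  let′  : Program m → Program (suc m) → Program m
  -- case e p q: if e is nil then p, else q with head and tail as variables 0, 1
  case  : Program m → Program m → Program (suc (suc m)) → Program m
  -- while e c b: starting with the value of e as variable 0, replace that
  -- variable by the value of b until c evaluates to nil; return the variable
  while : Program m → Program (suc m) → Program (suc m) → Program m

-- ρ ⊢ p ⇓ v [ t ]: with input ρ the program p halts with output v in t steps.
-- Loop ρ c b u v t: the loop with test c and body b takes u to v in t steps.
mutual
  infix 4 _⊢_⇓_[_]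

  data _⊢_⇓_[_] {m : ℕ} (ρ : Vec Tree m) : Program m → Tree → ℕ → Set where
    var       : ∀ x → ρ ⊢ var x ⇓ lookup ρ x [ 1 ]
    nil       : ρ ⊢ nil ⇓ nil [ 1 ]
    cons      : ∀ {p q u v s t} →
                ρ ⊢ p ⇓ u [ s ] → ρ ⊢ q ⇓ v [ t ] →
                ρ ⊢ cons p q ⇓ cons u v [ 1 + s + t ]
    let′      : ∀ {p q u v s t} →
                ρ ⊢ p ⇓ u [ s ] → (u ∷ ρ) ⊢ q ⇓ v [ t ] →
                ρ ⊢ let′ p q ⇓ v [ 1 + s + t ]
    case-nil  : ∀ {e p q v s t} →
                ρ ⊢ e ⇓ nil [ s ] → ρ ⊢ p ⇓ v [ t ] →
                ρ ⊢ case e p q ⇓ v [ 1 + s + t ]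
    case-cons : ∀ {e p q x y v s t} →
                ρ ⊢ e ⇓ cons x y [ s ] → (x ∷ y ∷ ρ) ⊢ q ⇓ v [ t ] →
                ρ ⊢ case e p q ⇓ v [ 1 + s + t ]
    while     : ∀ {e c b u v s t} →
                ρ ⊢ e ⇓ u [ s ] → Loop ρ c b u v t →
                ρ ⊢ while e c b ⇓ v [ 1 + s + t ]

  data Loop {m : ℕ} (ρ : Vec Tree m) (c b : Program (suc m)) :
            Tree → Tree → ℕ → Set where
    stop : ∀ {u s} → (u ∷ ρ) ⊢ c ⇓ nil [ s ] → Loop ρ c b u u (1 + s)
    step : ∀ {u v w x y r s t} →
           (u ∷ ρ) ⊢ c ⇓ cons x y [ r ] → (u ∷ ρ) ⊢ b ⇓ v [ s ] →
           Loop ρ c b v w t → Loop ρ c b u w (1 + r + s + t)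

mutual
  ⇓-deterministic : ∀ {m} {ρ : Vec Tree m} {p u v s t} →
                    ρ ⊢ p ⇓ u [ s ] → ρ ⊢ p ⇓ v [ t ] → u ≡ v × s ≡ t
  ⇓-deterministic (var x) (var .x) = refl , refl
  ⇓-deterministic nil nil = refl , refl
  ⇓-deterministic (cons d₁ d₂) (cons e₁ e₂)
    with refl , refl ← ⇓-deterministic d₁ e₁
    with refl , refl ← ⇓-deterministic d₂ e₂ = refl , refl
  ⇓-deterministic (let′ d₁ d₂) (let′ e₁ e₂)
    with refl , refl ← ⇓-deterministic d₁ e₁
    with refl , refl ← ⇓-deterministic d₂ e₂ = refl , refl
  ⇓-deterministic (case-nil d₁ d₂) (case-nil e₁ e₂)
    with refl , refl ← ⇓-deterministic d₁ e₁
    with refl , refl ← ⇓-deterministic d₂ e₂ = refl , refl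
  ⇓-deterministic (case-nil d₁ _) (case-cons e₁ _)
    with () ← proj₁ (⇓-deterministic d₁ e₁)
  ⇓-deterministic (case-cons d₁ _) (case-nil e₁ _)
    with () ← proj₁ (⇓-deterministic d₁ e₁)
  ⇓-deterministic (case-cons d₁ d₂) (case-cons e₁ e₂)
    with refl , refl ← ⇓-deterministic d₁ e₁
    with refl , refl ← ⇓-deterministic d₂ e₂ = refl , refl
  ⇓-deterministic (while d₁ d₂) (while e₁ e₂)
    with refl , refl ← ⇓-deterministic d₁ e₁
    with refl , refl ← Loop-deterministic d₂ e₂ = refl , refl

  Loop-deterministic : ∀ {m} {ρ : Vec Tree m} {c b u v w s t} →
                       Loop ρ c b u v s → Loop ρ c b u w t → v ≡ w × s ≡ t
  Loop-deterministic (stop d) (stop e)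
    with refl , refl ← ⇓-deterministic d e = refl , refl
  Loop-deterministic (stop d) (step e _ _)
    with () ← proj₁ (⇓-deterministic d e)
  Loop-deterministic (step d _ _) (stop e)
    with () ← proj₁ (⇓-deterministic d e)
  Loop-deterministic (step d₁ d₂ d₃) (step e₁ e₂ e₃)
    with refl , refl ← ⇓-deterministic d₁ e₁
    with refl , refl ← ⇓-deterministic d₂ e₂
    with refl , refl ← Loop-deterministic d₃ e₃ = refl , refl

encodeBool : Bool → Tree
encodeBool false = nil
encodeBool true  = cons nil nil

encodeVec : ∀ {A : Set} {n} → (A → Tree) → Vec A n → Tree
encodeVec enc []       = nil
encodeVec enc (x ∷ xs) = cons (enc x) (encodeVec enc xs)

-- Natural numbers are written in binary (digits 1 and 2, lowest digit first).
encodeℕᵇ : ℕᵇ → Tree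
encodeℕᵇ ℕᵇ.zero  = nil
encodeℕᵇ 2[1+ b ] = cons (encodeBool true)  (encodeℕᵇ b)
encodeℕᵇ 1+[2 b ] = cons (encodeBool false) (encodeℕᵇ b)

encodeℕ : ℕ → Tree
encodeℕ n = encodeℕᵇ (ℕᵇ.fromℕ n)

encodeℤ : ℤ → Tree
encodeℤ (+ n)    = cons (encodeBool false) (encodeℕ n)
encodeℤ -[1+ n ] = cons (encodeBool true)  (encodeℕ n)

encodeSubset : ∀ {n} → Subset n → Tree
encodeSubset = encodeVec encodeBool

encodeGraph : ∀ {n} → Graph n → Tree
encodeGraph G = encodeVec encodeSubset (tabulate (N G))

Computable₂ : (ℕ → ℕ → ℕ) → Set
Computable₂ f = ∃ λ (p : Program 2) → ∀ a b → ∃ λ time →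
  encodeℕ a ∷ encodeℕ b ∷ [] ⊢ p ⇓ encodeℕ (f a b) [ time ]

{-# OPTIONS --safe #-}

-- A layout is, up to order, an injective labelling of the vertices, and the
-- imbalance of v is |2 L - deg v| for the number L of its neighbours with a
-- smaller label. Different components of G - S are not adjacent, so only the
-- order of each S ∪ X matters: (1 + k) (1 + ℓ) labels suffice, made injective
-- by the number of the vertex. For every labelling of S it remains to choose a
-- labelling (an option) of every component, minimising a sum of costs of the
-- options plus Σ |a_s + 2 Σ δ_s| over s ∈ S, where δ_s counts the neighbours
-- that an option puts before s.
--
-- This is solved by local search. If a better solution exists, one of them
-- differs from the current one in boundedly many components: the moves to a
-- better solution are merged, one vertex s at a time, into groups whose effects
-- on s have the same sign. Merging a group of lowest effect with one of highest
-- effect, as long as both kinds exist, narrows the range of the effects, so the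
-- groups stay bounded. Along one sign |a + 2 x| - |a| is superadditive in x,
-- hence some group is an improvement on its own. Such a group is found by
-- dynamic programming over the components, which keeps the cheapest partial
-- solution for every vector of effects in a box.
--
-- Running times are handled by combinators for programs that are polynomial in
-- a measure of the input; the measure budget k ℓ * (1 + n) of an instance is
-- large enough to count the options of a component and the vectors of the box.

module Submission where

-- A table of all vectors of left counts of the cover would have about n^k entries, which is too
-- many. Restricting the search to solutions near the current one leaves only vectors within a
-- radius that depends on k and ℓ. That an improvement always exists so near is what the merging has
-- to show, and its bound fixes the radius: the effect of a group is at most its size, so with sizes
-- at most x the effects on the next vertex lie in [-x, x]; each narrowing of this range by one may
-- double the sizes, and at most 2x narrowings give 4^x x. Signs already reached survive later
-- merges, because effects add. One such inflation per vertex of the cover yields a tower. Each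
-- round of the search lowers a natural number that is polynomial in the measure, so decreases by
-- one are fast enough. Two features of the input shape the program. It contains neither k nor ℓ, so
-- the cover and the largest component are measured instead. And t may be arbitrarily large, so its
-- digits are read only as far as those of the computed value.

open import Defs

-- Polynomial bounds, and programs that run within them

module PolynomialTime where

  open import Data.Bool.Base using (Bool; true; false; if_then_else_)
  open import Data.Fin.Base using (zero; suc)
  open import Data.Fin.Patterns using (0F; 1F; 2F; 3F; 6F)
  open import Data.List.Base as List using (List; []; _∷_; foldr; length; _ʳ++_)
  open import Data.List.Properties using (length-ʳ++)
  open import Data.Nat.Base using (ℕ; zero; suc; _+_; _*_; _^_; _≤_; z≤n; s≤s)
  open import Data.Nat.Properties
  open import Data.Product.Base using (_×_; _,_; proj₁; proj₂)
  open import Data.Unit.Base using (⊤)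
  open import Data.Vec.Base as Vec using (Vec; []; _∷_)
  open import Function.Base using (id)
  open import Relation.Binary.PropositionalEquality hiding ([_])

  encList : ∀ {A : Set} → (A → Tree) → List A → Tree
  encList e []       = nil
  encList e (x ∷ xs) = cons (e x) (encList e xs)

  μList : ∀ {A : Set} → (A → ℕ) → List A → ℕ
  μList m []       = 0
  μList m (x ∷ xs) = 1 + m x + μList m xs

  -- The measure m need not be the size of the encoding: it can be larger (to
  -- allow for exponential dependence on parameters), or ignore parts of the
  -- input that no loop may run over.
  infixl 8 _×ᵗ_
  data Ty : Set₁ where
    base  : (C : Set) (e : C → Tree) (m : C → ℕ) → Ty
    _×ᵗ_  : Ty → Ty → Ty
    Listᵗ : Ty → Ty

  ⟨_⟩ : Ty → Set
  ⟨ base C e m ⟩ = C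
  ⟨ A ×ᵗ B ⟩     = ⟨ A ⟩ × ⟨ B ⟩
  ⟨ Listᵗ A ⟩    = List ⟨ A ⟩

  enc : (A : Ty) → ⟨ A ⟩ → Tree
  enc (base C e m) = e
  enc (A ×ᵗ B)     = λ (a , b) → cons (enc A a) (enc B b)
  enc (Listᵗ A)    = encList (enc A)

  μ : (A : Ty) → ⟨ A ⟩ → ℕ
  μ (base C e m) = m
  μ (A ×ᵗ B)     = λ (a , b) → μ A a + μ B b
  μ (Listᵗ A)    = μList (μ A)

  -- A single exponent stands for a polynomial: the base is at least 2, so constants and sums of
  -- bounds are absorbed by raising the exponent.
  record O (A : Ty) (q : ⟨ A ⟩ → ℕ) : Set where
    constructor bound
    field
      exponent : ℕ
      bounds   : ∀ a → q a ≤ (2 + μ A a) ^ exponent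
  open O public

  n<2^n : ∀ n → n ≤ 2 ^ n
  n<2^n zero    = z≤n
  n<2^n (suc n) = begin
    1 + n           ≤⟨ +-mono-≤ (m^n>0 2 n) (n<2^n n) ⟩
    2 ^ n + 2 ^ n   ≡⟨ cong (2 ^ n +_) (+-identityʳ _) ⟨
    2 ^ suc n       ∎
    where open ≤-Reasoning

  module _ {A : Ty} where

    O-mono : ∀ {p q} → (∀ a → p a ≤ q a) → O A q → O A p
    O-mono p≤q (bound c b) = bound c λ a → ≤-trans (p≤q a) (b a)

    O-const : ∀ k → O A (λ _ → k)
    O-const k = bound k λ a → ≤-trans (n<2^n k) (^-monoˡ-≤ k (m≤m+n 2 (μ A a)))

    O-* : ∀ {p q} → O A p → O A q → O A (λ a → p a * q a)
    O-* (bound c b) (bound d e) = bound (c + d) λ a →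
      ≤-trans (*-mono-≤ (b a) (e a)) (≤-reflexive (sym (^-distribˡ-+-* (2 + μ A a) c d)))

    O-+ : ∀ {p q} → O A p → O A q → O A (λ a → p a + q a)
    O-+ {p} {q} (bound c b) (bound d e) = bound (1 + (c + d)) λ a → begin
      p a + q a                                     ≤⟨ +-mono-≤ (b a) (e a) ⟩
      (2 + μ A a) ^ c + (2 + μ A a) ^ d             ≤⟨ +-mono-≤ (^-monoʳ-≤ (2 + μ A a) (m≤m+n c d))
                                                                (^-monoʳ-≤ (2 + μ A a) (m≤n+m d c)) ⟩
      (2 + μ A a) ^ (c + d) + (2 + μ A a) ^ (c + d) ≡⟨ cong ((2 + μ A a) ^ (c + d) +_) (+-identityʳ _) ⟨
      2 * (2 + μ A a) ^ (c + d)                     ≤⟨ *-monoˡ-≤ ((2 + μ A a) ^ (c + d)) (m≤m+n 2 (μ A a)) ⟩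
      (2 + μ A a) ^ (1 + (c + d))                   ∎
      where open ≤-Reasoning

    O-^ : ∀ {p} d → O A p → O A (λ a → p a ^ d)
    O-^ zero    P = O-const 1
    O-^ (suc d) P = O-* P (O-^ d P)

    O-μ : O A (μ A)
    O-μ = bound 1 λ a → ≤-trans (m≤n+m (μ A a) 2) (≤-reflexive (sym (^-identityʳ _)))

  O-∘ : ∀ {A B q} {f : ⟨ A ⟩ → ⟨ B ⟩} → O A (λ a → μ B (f a)) → O B q → O A (λ a → q (f a))
  O-∘ {f = f} F (bound d e) = O-mono (λ a → e (f a)) (O-^ d (O-+ (O-const 2) F))

  -- The program exists for every length of the environment, with value and time independent of `ρ`;
  -- it can therefore be placed under any binders without a weakening lemma. The size bound is part
  -- of the record because the second of two composed programs is timed on the value of the first.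
  record PT (A B : Ty) (f : ⟨ A ⟩ → ⟨ B ⟩) : Set where
    constructor mkPT
    field
      prog   : ∀ {m} → Program (suc m)
      time   : ⟨ A ⟩ → ℕ
      run    : ∀ {m} (ρ : Vec Tree m) a → (enc A a ∷ ρ) ⊢ prog ⇓ enc B (f a) [ time a ]
      time-O : O A time
      size-O : O A (λ a → μ B (f a))
  open PT public

  -- Unary numbers are lists of `nil`, so they can drive loops. They are affordable here because
  -- every number in the procedure is polynomial in the measure.
  encℕ : ℕ → Tree
  encℕ zero    = nil
  encℕ (suc n) = cons nil (encℕ n)

  Unitᵗ Boolᵗ ℕᵗ : Ty
  Unitᵗ = base ⊤ (λ _ → nil) (λ _ → 0)
  Boolᵗ = base Bool encodeBool (λ _ → 0)
  ℕᵗ    = base ℕ encℕ id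

  -- Steps of a fold: an element x of the list l e with the value acc e zs of
  -- the fold on the elements zs after it, measured by the environment e alone.
  record Step (E A : Ty) (l : ⟨ E ⟩ → List ⟨ A ⟩) : Set where
    constructor mkStep
    field
      env   : ⟨ E ⟩
      ys    : List ⟨ A ⟩
      elem  : ⟨ A ⟩
      zs    : List ⟨ A ⟩
      split : l env ≡ ys ʳ++ (elem ∷ zs)
  open Step public

  Stepᵗ : (E A B : Ty) (l : ⟨ E ⟩ → List ⟨ A ⟩) (acc : ⟨ E ⟩ → List ⟨ A ⟩ → ⟨ B ⟩) → Ty
  Stepᵗ E A B l acc = base (Step E A l)
    (λ r → cons (enc E (env r)) (cons (enc A (elem r)) (enc B (acc (env r) (zs r)))))
    (λ r → μ E (env r))

  module _ {A B : Ty} where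

    ext : ∀ {f g} → (∀ a → f a ≡ g a) → PT A B f → PT A B g
    ext eq P = mkPT (prog P) (time P)
      (λ ρ a → subst (λ b → _ ⊢ prog P ⇓ enc B b [ time P a ]) (eq a) (run P ρ a))
      (time-O P)
      (O-mono (λ a → ≤-reflexive (cong (μ B) (sym (eq a)))) (size-O P))

    -- A function that leaves the tree as it is costs one step, however it changes the measure. This
    -- is the way to pass between types that view the same tree differently.
    recode : (f : ⟨ A ⟩ → ⟨ B ⟩) → (∀ a → enc A a ≡ enc B (f a)) → O A (λ a → μ B (f a)) → PT A B f
    recode f eq S = mkPT (var 0F) (λ _ → 1)
      (λ ρ a → subst (λ t → (enc A a ∷ ρ) ⊢ var 0F ⇓ t [ 1 ]) (eq a) (var 0F)) (O-const 1) S

    quoteTree : ∀ {m} → Tree → Program m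
    quoteTree nil        = nil
    quoteTree (cons s t) = cons (quoteTree s) (quoteTree t)

    quoteTime : Tree → ℕ
    quoteTime nil        = 1
    quoteTime (cons s t) = 1 + quoteTime s + quoteTime t

    quote-run : ∀ {m} (ρ : Vec Tree m) t → ρ ⊢ quoteTree t ⇓ t [ quoteTime t ]
    quote-run ρ nil        = nil
    quote-run ρ (cons s t) = cons (quote-run ρ s) (quote-run ρ t)

    const′ : (b : ⟨ B ⟩) → PT A B (λ _ → b)
    const′ b = mkPT (quoteTree (enc B b)) (λ _ → quoteTime (enc B b)) (λ ρ a → quote-run _ (enc B b))
      (O-const _) (O-const _)

  idᵖ : ∀ {A} → PT A A (λ a → a)
  idᵖ = recode (λ a → a) (λ _ → refl) O-μ

  infixl 5 _▸_
  _▸_ : ∀ {A B C f g} → PT A B f → PT B C g → PT A C (λ a → g (f a))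
  _▸_ {f = f} P Q = mkPT (let′ (prog P) (prog Q)) (λ a → 1 + time P a + time Q (f a))
    (λ ρ a → let′ (run P ρ a) (run Q _ (f a)))
    (O-+ (O-+ (O-const 1) (time-O P)) (O-∘ (size-O P) (time-O Q)))
    (O-∘ (size-O P) (size-O Q))

  infixr 4 _,ᵖ_
  _,ᵖ_ : ∀ {E A B f g} → PT E A f → PT E B g → PT E (A ×ᵗ B) (λ e → f e , g e)
  P ,ᵖ Q = mkPT (cons (prog P) (prog Q)) (λ a → 1 + time P a + time Q a)
    (λ ρ a → cons (run P ρ a) (run Q ρ a))
    (O-+ (O-+ (O-const 1) (time-O P)) (time-O Q))
    (O-+ (size-O P) (size-O Q))

  infixr 5 _∷ᵖ_
  _∷ᵖ_ : ∀ {E A f g} → PT E A f → PT E (Listᵗ A) g → PT E (Listᵗ A) (λ e → f e ∷ g e)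
  P ∷ᵖ Q = mkPT (cons (prog P) (prog Q)) (λ a → 1 + time P a + time Q a)
    (λ ρ a → cons (run P ρ a) (run Q ρ a))
    (O-+ (O-+ (O-const 1) (time-O P)) (time-O Q))
    (O-+ (O-+ (O-const 1) (size-O P)) (size-O Q))

  fstᵖ : ∀ {E A B f} → PT E (A ×ᵗ B) f → PT E A (λ e → proj₁ (f e))
  fstᵖ P = mkPT (case (prog P) nil (var 0F)) (λ a → 1 + time P a + 1)
    (λ ρ a → case-cons (run P ρ a) (var 0F))
    (O-+ (O-+ (O-const 1) (time-O P)) (O-const 1))
    (O-mono (λ a → m≤m+n _ _) (size-O P))

  sndᵖ : ∀ {E A B f} → PT E (A ×ᵗ B) f → PT E B (λ e → proj₂ (f e))
  sndᵖ {A = A} {f = f} P = mkPT (case (prog P) nil (var 1F)) (λ a → 1 + time P a + 1)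
    (λ ρ a → case-cons (run P ρ a) (var 1F))
    (O-+ (O-+ (O-const 1) (time-O P)) (O-const 1))
    (O-mono (λ a → m≤n+m _ (μ A (proj₁ (f a)))) (size-O P))

  ifᵖ : ∀ {E A} {c : ⟨ E ⟩ → Bool} {f g} → PT E Boolᵗ c → PT E A f → PT E A g →
        PT E A (λ e → if c e then f e else g e)
  ifᵖ {E} {A} {c} {f} {g} C P Q = mkPT
    -- In the branch for `true` the input is variable 2, below the head and tail bound by `case`; it
    -- is rebound as variable 0, where `prog P` expects it.
    (case (prog C) (prog Q) (let′ (var 2F) (prog P)))
    t
    r
    (O-mono t≤ (O-+ (O-+ (O-const 3) (time-O C)) (O-+ (time-O P) (time-O Q))))
    (O-mono s≤ (O-+ (size-O P) (size-O Q)))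
    where
    t : ⟨ E ⟩ → ℕ
    t e = 1 + time C e + (if c e then 1 + 1 + time P e else time Q e)
    r : ∀ {m} (ρ : Vec Tree m) a → (enc E a ∷ ρ) ⊢ case (prog C) (prog Q) (let′ (var 2F) (prog P))
        ⇓ enc A (if c a then f a else g a) [ t a ]
    r ρ a with c a | run C ρ a
    ... | true  | d = case-cons d (let′ (var 2F) (run P _ a))
    ... | false | d = case-nil d (run Q ρ a)
    t≤ : ∀ e → t e ≤ 3 + time C e + (time P e + time Q e)
    t≤ e with c e
    ... | true  = s≤s (≤-trans (≤-reflexive (trans (+-suc _ _) (cong suc (+-suc _ _))))
                    (+-monoʳ-≤ (2 + time C e) (m≤m+n (time P e) (time Q e))))
    ... | false = +-mono-≤ (s≤s (m≤n+m (time C e) 2)) (m≤n+m (time Q e) (time P e))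
    s≤ : ∀ e → μ A (if c e then f e else g e) ≤ μ A (f e) + μ A (g e)
    s≤ e with c e
    ... | true  = m≤m+n _ _
    ... | false = m≤n+m _ _

  -- The target `h` is described by two equations, so that any function defined by matching on the
  -- list can be put in its place, such as `tail` and `headOr`.
  caseListᵖ : ∀ {E A B} {l : ⟨ E ⟩ → List ⟨ A ⟩} {z : ⟨ E ⟩ → ⟨ B ⟩}
              {f : ⟨ E ⟩ × (⟨ A ⟩ × List ⟨ A ⟩) → ⟨ B ⟩} {h : ⟨ E ⟩ → ⟨ B ⟩} →
              PT E (Listᵗ A) l → PT E B z → PT (E ×ᵗ (A ×ᵗ Listᵗ A)) B f →
              (∀ e → l e ≡ [] → z e ≡ h e) → (∀ e x xs → l e ≡ x ∷ xs → f (e , x , xs) ≡ h e) →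
              PT E B h
  caseListᵖ {E} {A} {B} {l} {z} {f} {h} L Z F hz hf = mkPT p (λ e → t e (l e)) r
    (O-mono t≤ (O-+ (O-+ (O-const 7) (time-O L)) (O-+ (time-O Z) (O-^ (exponent (time-O F)) size))))
    (O-mono s≤ (O-+ (size-O Z) (O-^ (exponent (size-O F)) size)))
    where
    size : O E (λ e → 2 + (μ E e + μ (Listᵗ A) (l e)))
    size = O-+ (O-const 2) (O-+ O-μ (size-O L))
    p : ∀ {m} → Program (suc m)
    p = case (prog L) (prog Z) (let′ (cons (var 2F) (cons (var 0F) (var 1F))) (prog F))
    t : ⟨ E ⟩ → List ⟨ A ⟩ → ℕ
    t e []       = 1 + time L e + time Z e
    t e (x ∷ xs) = 1 + time L e + (6 + time F (e , x , xs))
    r : ∀ {m} (ρ : Vec Tree m) e → (enc E e ∷ ρ) ⊢ p ⇓ enc B (h e) [ t e (l e) ]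
    r ρ e with l e in eq | run L ρ e
    ... | []     | d = subst (λ b → _ ⊢ p ⇓ enc B b [ _ ]) (hz e eq) (case-nil d (run Z ρ e))
    ... | x ∷ xs | d = subst (λ b → _ ⊢ p ⇓ enc B b [ _ ]) (hf e x xs eq)
        (case-cons d (let′ (cons (var 2F) (cons (var 0F) (var 1F))) (run F _ (e , x , xs))))
    m≤ : ∀ e x xs → l e ≡ x ∷ xs → 2 + μ (E ×ᵗ (A ×ᵗ Listᵗ A)) (e , x , xs) ≤ 2 + (μ E e + μ (Listᵗ A) (l e))
    m≤ e x xs eq = s≤s (s≤s (+-monoʳ-≤ (μ E e) (≤-trans (n≤1+n _) (≤-reflexive (sym (cong (μ (Listᵗ A)) eq))))))
    t≤ : ∀ e → t e (l e) ≤ 7 + time L e + (time Z e + (2 + (μ E e + μ (Listᵗ A) (l e))) ^ exponent (time-O F))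
    t≤ e with l e in eq
    ... | []     = +-mono-≤ (s≤s (m≤n+m (time L e) 6)) (m≤m+n (time Z e) _)
    ... | x ∷ xs = begin
      1 + time L e + (6 + time F (e , x , xs))       ≡⟨ +-assoc (1 + time L e) 6 _ ⟨
      1 + time L e + 6 + time F (e , x , xs)         ≡⟨ cong (_+ time F (e , x , xs)) (+-comm (1 + time L e) 6) ⟩
      7 + time L e + time F (e , x , xs)             ≤⟨ +-monoʳ-≤ (7 + time L e) (≤-trans (bounds (time-O F) _) (≤-trans
                                                        (^-monoˡ-≤ (exponent (time-O F)) (subst (λ u → _ ≤ 2 + (μ E e + μ (Listᵗ A) u)) eq (m≤ e x xs eq)))
                                                        (m≤n+m _ (time Z e)))) ⟩
      7 + time L e + (time Z e + (2 + (μ E e + μ (Listᵗ A) (x ∷ xs))) ^ exponent (time-O F)) ∎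
      where open ≤-Reasoning
    s≤ : ∀ e → μ B (h e) ≤ μ B (z e) + (2 + (μ E e + μ (Listᵗ A) (l e))) ^ exponent (size-O F)
    s≤ e with l e in eq
    ... | []     = ≤-trans (≤-reflexive (cong (μ B) (sym (hz e eq)))) (m≤m+n _ _)
    ... | x ∷ xs = ≤-trans (≤-reflexive (cong (μ B) (sym (hf e x xs eq)))) (≤-trans
        (≤-trans (bounds (size-O F) _)
          (^-monoˡ-≤ (exponent (size-O F)) (subst (λ u → _ ≤ 2 + (μ E e + μ (Listᵗ A) u)) eq (m≤ e x xs eq))))
        (m≤n+m _ (μ B (z e))))

  length≤μList : ∀ {A : Set} (m : A → ℕ) xs → length xs ≤ μList m xs
  length≤μList m []       = z≤n
  length≤μList m (x ∷ xs) = s≤s (≤-trans (length≤μList m xs) (m≤n+m _ (m x)))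

  module _ {E A B : Ty} {l : ⟨ E ⟩ → List ⟨ A ⟩} {z : ⟨ E ⟩ → ⟨ B ⟩} {f : ⟨ E ⟩ → ⟨ A ⟩ → ⟨ B ⟩ → ⟨ B ⟩}
           (L : PT E (Listᵗ A) l) (Z : PT E B z)
           (F : PT (Stepᵗ E A B l (λ e → foldr (f e) (z e))) B
                   (λ r → f (env r) (elem r) (foldr (f (env r)) (z (env r)) (zs r))))
    where
    private
      test : ∀ {m} → Program (suc m)
      test = case (var 0F) nil (var 0F)

      revBody : ∀ {m} → Program (3 + m)
      revBody = case (var 0F) nil (case (var 0F) nil (cons (var 1F) (cons (var 0F) (var 3F))))

      loopBody : ∀ {m} → Program (4 + m)
      loopBody = case (var 0F) nil (case (var 0F) nil
        -- The two `case`s bind four variables. Above them lie the loop state, the reversed list and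
        -- a `nil`, which makes the environment variable 7; variable 3 is the accumulator.
        (cons (var 1F) (let′ (cons (var (suc 6F)) (cons (var 0F) (var 3F))) (prog F))))

      revProg : ∀ {m} → Program (2 + m)
      revProg = case (while (cons (let′ (var 1F) (prog L)) nil) test revBody) nil (var 1F)

      -- A loop consumes a list from the front but `foldr` from the back, so the list is reversed
      -- first.
      foldProg : ∀ {m} → Program (1 + m)
      foldProg = let′ nil (let′ revProg
        (case (while (cons (var 0F) (let′ (var 2F) (prog Z))) test loopBody) nil (var 1F)))

      eL : List ⟨ A ⟩ → Tree
      eL = encList (enc A)

      accOf : ⟨ E ⟩ → List ⟨ A ⟩ → ⟨ B ⟩
      accOf e = foldr (f e) (z e)

      revTime : List ⟨ A ⟩ → ℕ
      revTime []       = 4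
      revTime (x ∷ xs) = 13 + revTime xs

      rev-run : ∀ {m} (ρ : Vec Tree (2 + m)) xs acc →
        Loop ρ test revBody (cons (eL xs) (eL acc)) (cons nil (eL (xs ʳ++ acc))) (revTime xs)
      rev-run ρ []       acc = stop (case-cons (var 0F) (var 0F))
      rev-run ρ (x ∷ xs) acc = step (case-cons (var 0F) (var 0F))
        (case-cons (var 0F) (case-cons (var 0F) (cons (var 1F) (cons (var 0F) (var 3F)))))
        (rev-run ρ xs (x ∷ acc))

      loopTime : ∀ e ys zs → l e ≡ ys ʳ++ zs → ℕ
      loopTime e []       zs eq = 4
      loopTime e (x ∷ ys) zs eq = 1 + 3 + (12 + time F (mkStep e ys x zs eq)) + loopTime e ys (x ∷ zs) eq

      loop-run : ∀ {m} (ρ : Vec Tree m) t u e ys zs (eq : l e ≡ ys ʳ++ zs) →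
        Loop (t ∷ u ∷ enc E e ∷ ρ) test loopBody (cons (eL ys) (enc B (accOf e zs))) (cons nil (enc B (accOf e (ys ʳ++ zs)))) (loopTime e ys zs eq)
      loop-run ρ t u e []       zs eq = stop (case-cons (var 0F) (var 0F))
      loop-run ρ t u e (x ∷ ys) zs eq = step (case-cons (var 0F) (var 0F))
        (case-cons (var 0F) (case-cons (var 0F) (cons (var 1F)
          (let′ (cons (var (suc 6F)) (cons (var 0F) (var 3F))) (run F _ (mkStep e ys x zs eq))))))
        (loop-run ρ t u e ys (x ∷ zs) eq)

      revr : ∀ xs → (xs ʳ++ []) ʳ++ [] ≡ xs
      revr xs = go xs []
        where
        go : ∀ (xs ys : List ⟨ A ⟩) → (xs ʳ++ ys) ʳ++ [] ≡ ys ʳ++ xs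
        go []       ys = refl
        go (x ∷ xs) ys = go xs (x ∷ ys)

      foldTime : ⟨ E ⟩ → ℕ
      foldTime e = 8 + (time L e + 1 + revTime (l e) + 1
        + (6 + (time Z e + loopTime e (l e ʳ++ []) [] (sym (revr (l e))) + 1)))

      fold-run : ∀ {m} (ρ : Vec Tree m) e → (enc E e ∷ ρ) ⊢ foldProg ⇓ enc B (accOf e (l e)) [ foldTime e ]
      fold-run ρ e = let′ nil (let′
        (case-cons (while (cons (let′ (var 1F) (run L _ e)) nil) (rev-run (nil ∷ enc E e ∷ ρ) (l e) [])) (var 1F))
        (case-cons (while (cons (var 0F) (let′ (var 2F) (run Z _ e)))
          (subst (λ xs → Loop (eL (l e ʳ++ []) ∷ nil ∷ enc E e ∷ ρ) test loopBody (cons (eL (l e ʳ++ [])) (enc B (z e))) (cons nil (enc B (accOf e xs)))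
                    (loopTime e (l e ʳ++ []) [] (sym (revr (l e)))))
            (revr (l e)) (loop-run ρ (eL (l e ʳ++ [])) nil e (l e ʳ++ []) [] (sym (revr (l e)))))) (var 1F)))

      revTime≤ : ∀ xs → revTime xs ≤ 4 + length xs * 13
      revTime≤ []       = ≤-refl
      revTime≤ (x ∷ xs) = ≤-trans (+-monoʳ-≤ 13 (revTime≤ xs)) (≤-reflexive (lem (length xs * 13)))
        where
        lem : ∀ k → 13 + (4 + k) ≡ 4 + (13 + k)
        lem k = refl

      loopTime≤ : ∀ e ys zs eq → loopTime e ys zs eq ≤ 4 + length ys * (16 + (2 + μ E e) ^ exponent (time-O F))
      loopTime≤ e []       zs eq = ≤-refl
      loopTime≤ e (x ∷ ys) zs eq = begin
        16 + time F (mkStep e ys x zs eq) + loopTime e ys (x ∷ zs) eq ≤⟨ +-mono-≤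
          (+-monoʳ-≤ 16 (bounds (time-O F) (mkStep e ys x zs eq))) (loopTime≤ e ys (x ∷ zs) eq) ⟩
        S + (4 + length ys * S)                                       ≡⟨ +-assoc S 4 _ ⟨
        S + 4 + length ys * S                                         ≡⟨ cong (_+ length ys * S) (+-comm S 4) ⟩
        4 + S + length ys * S                                         ≡⟨ +-assoc 4 S _ ⟩
        4 + (S + length ys * S)                                       ∎
        where
        open ≤-Reasoning
        S = 16 + (2 + μ E e) ^ exponent (time-O F)

      len : O E (λ e → length (l e))
      len = O-mono (λ e → length≤μList (μ A) (l e)) (size-O L)

      len′ : ∀ (xs : List ⟨ A ⟩) → length (xs ʳ++ []) ≡ length xs
      len′ xs = trans (length-ʳ++ xs) (+-identityʳ _)

    -- Every step is bounded in terms of the environment alone, so the total time is at most the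
    -- length of the list times one polynomial. A bound in terms of the accumulator would be
    -- composed with itself once per element.
    foldrᵖ : PT E B (λ e → foldr (f e) (z e) (l e))
    foldrᵖ = mkPT foldProg foldTime fold-run
      (O-+ (O-const 8) (O-+ (O-+ (O-+ (O-+ (time-O L) (O-const 1)) revO) (O-const 1))
        (O-+ (O-const 6) (O-+ (O-+ (time-O Z) loopO) (O-const 1)))))
      (O-mono s≤ (O-+ (size-O Z) (O-^ (exponent (size-O F)) (O-+ (O-const 2) O-μ))))
      where
      revO : O E (λ e → revTime (l e))
      revO = O-mono (λ e → revTime≤ (l e)) (O-+ (O-const 4) (O-* len (O-const 13)))
      loopO : O E (λ e → loopTime e (l e ʳ++ []) [] (sym (revr (l e))))
      loopO = O-mono (λ e → ≤-trans (loopTime≤ e (l e ʳ++ []) [] (sym (revr (l e))))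
                              (+-monoʳ-≤ 4 (*-monoˡ-≤ _ (≤-reflexive (len′ (l e))))))
                (O-+ (O-const 4) (O-* len (O-+ (O-const 16) (O-^ (exponent (time-O F)) (O-+ (O-const 2) O-μ)))))
      s≤ : ∀ e → μ B (accOf e (l e)) ≤ μ B (z e) + (2 + μ E e) ^ exponent (size-O F)
      s≤ e with l e in eq
      ... | []      = m≤m+n _ _
      ... | x ∷ xs = ≤-trans (bounds (size-O F) (mkStep e [] x xs eq)) (m≤n+m _ (μ B (z e)))

-- Lists, unary arithmetic and counted loops in polynomial time

module Routines where

  open PolynomialTime
  open import Data.Bool.Base using (Bool; true; false; if_then_else_; _∧_; not)
  open import Data.List.Base as List using (List; []; _∷_; _++_; foldr; length; _ʳ++_; map; concat; replicate)
  open import Data.Nat.ListAction using (sum)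
  open import Data.List.Properties using (length-map; length-replicate)
  open import Data.Nat.Base using (ℕ; zero; suc; pred; _+_; _*_; _∸_; _^_; _≤_; _<_; z≤n; s≤s; ∣_-_∣)
  open import Data.Nat.Properties
  open import Data.Product.Base using (_×_; _,_; proj₁; proj₂)
  open import Data.Unit.Base using (tt)
  open import Function.Base using (id)
  open import Relation.Binary.PropositionalEquality hiding ([_])

  μList-++ : ∀ {A : Set} (m : A → ℕ) xs ys → μList m (xs ++ ys) ≡ μList m xs + μList m ys
  μList-++ m []       ys = refl
  μList-++ m (x ∷ xs) ys = trans (cong (1 + m x +_) (μList-++ m xs ys)) (sym (+-assoc (1 + m x) _ _))

  suffix-length : ∀ {A : Set} {l : List A} ys zs → l ≡ ys ʳ++ zs → length zs ≤ length l
  suffix-length []       zs refl = ≤-refl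
  suffix-length (y ∷ ys) zs eq   = ≤-trans (n≤1+n _) (suffix-length ys (y ∷ zs) eq)

  suffix-μ : ∀ {A : Set} {l : List A} (m : A → ℕ) ys zs → l ≡ ys ʳ++ zs → μList m zs ≤ μList m l
  suffix-μ m []       zs refl = ≤-refl
  suffix-μ m (y ∷ ys) zs eq   = ≤-trans (m≤n+m _ (1 + m y)) (suffix-μ m ys (y ∷ zs) eq)

  suffix-elem : ∀ {A : Set} {l : List A} (m : A → ℕ) ys x zs → l ≡ ys ʳ++ (x ∷ zs) → m x ≤ μList m l
  suffix-elem m ys x zs eq = ≤-trans (≤-trans (n≤1+n _) (m≤m+n (1 + m x) _)) (suffix-μ m ys (x ∷ zs) eq)

  O-env : ∀ {E A B l acc q} → O E q → O (Stepᵗ E A B l acc) (λ r → q (env r))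
  O-env (bound c b) = bound c λ r → b (env r)

  module _ {E A B : Ty} where

    -- The fold rule for steps that are polynomial in all their arguments; the
    -- accumulator has to be bounded by the environment.
    foldᵖ : ∀ {l : ⟨ E ⟩ → List ⟨ A ⟩} {z : ⟨ E ⟩ → ⟨ B ⟩} {f : ⟨ E ⟩ × (⟨ A ⟩ × ⟨ B ⟩) → ⟨ B ⟩} {q} →
            PT E (Listᵗ A) l → PT E B z → PT (E ×ᵗ (A ×ᵗ B)) B f → O E q →
            (∀ e ys zs → l e ≡ ys ʳ++ zs → μ B (foldr (λ x b → f (e , x , b)) (z e) zs) ≤ q e) →
            PT E B (λ e → foldr (λ x b → f (e , x , b)) (z e) (l e))
    foldᵖ {l} {z} {f} {q} L Z F Q acc≤ = foldrᵖ L Z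
      (recode (λ r → env r , elem r , foldr (λ x b → f (env r , x , b)) (z (env r)) (zs r)) (λ _ → refl)
         (O-mono (λ r → +-monoʳ-≤ (μ E (env r)) (+-mono-≤
                     (suffix-elem (μ A) (ys r) (elem r) (zs r) (split r))
                     (acc≤ (env r) (elem r ∷ ys r) (zs r) (split r))))
            (O-env {B = B} {acc = λ e → foldr (λ x b → f (e , x , b)) (z e)} (O-+ O-μ (O-+ (size-O L) Q))))
       ▸ F)


  private
    variable
      E A B C : Ty

  π₁ : PT (A ×ᵗ B) A proj₁
  π₁ = fstᵖ idᵖ

  π₂ : PT (A ×ᵗ B) B proj₂
  π₂ = sndᵖ idᵖ

  mapᵖ : ∀ {l : ⟨ E ⟩ → List ⟨ A ⟩} {f : ⟨ E ⟩ × ⟨ A ⟩ → ⟨ B ⟩} →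
         PT E (Listᵗ A) l → PT (E ×ᵗ A) B f → PT E (Listᵗ B) (λ e → map (λ x → f (e , x)) (l e))
  mapᵖ {E} {A} {B} {l} {f} L F = ext (λ e → eq e (l e))
    (foldᵖ {f = λ (e , x , b) → f (e , x) ∷ b} L (const′ [])
      (((π₁ ,ᵖ fstᵖ π₂) ▸ F) ∷ᵖ sndᵖ π₂)
      (O-* (O-mono (λ e → length≤μList (μ A) (l e)) (size-O L))
           (O-+ (O-const 1) (O-^ (exponent (size-O F)) (O-+ (O-const 2) (O-+ O-μ (size-O L))))))
      (λ e ys zs eq → ≤-trans (go e ys zs eq) (*-monoˡ-≤ _ (suffix-length ys zs eq))))
    where
    eq : ∀ e xs → foldr (λ x b → f (e , x) ∷ b) [] xs ≡ map (λ x → f (e , x)) xs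
    eq e []       = refl
    eq e (x ∷ xs) = cong (f (e , x) ∷_) (eq e xs)
    go : ∀ e ys zs → l e ≡ ys ʳ++ zs → μList (μ B) (foldr (λ x b → f (e , x) ∷ b) [] zs) ≤
         length zs * (1 + (2 + (μ E e + μList (μ A) (l e))) ^ exponent (size-O F))
    go e ys []       eq = z≤n
    go e ys (x ∷ zs) eq = +-mono-≤ (s≤s (≤-trans (bounds (size-O F) (e , x))
        (^-monoˡ-≤ (exponent (size-O F)) (s≤s (s≤s (+-monoʳ-≤ (μ E e) (suffix-elem (μ A) ys x zs eq)))))))
      (go e (x ∷ ys) zs eq)

  infixr 5 _++ᵖ_
  _++ᵖ_ : ∀ {f g} → PT E (Listᵗ A) f → PT E (Listᵗ A) g → PT E (Listᵗ A) (λ e → f e ++ g e)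
  _++ᵖ_ {E} {A} {f} {g} P Q = ext (λ e → eq (f e) (g e))
    (foldᵖ {f = λ (e , x , b) → x ∷ b} P Q (fstᵖ π₂ ∷ᵖ sndᵖ π₂) (O-+ (size-O P) (size-O Q))
      λ e ys zs s → ≤-trans (≤-reflexive (trans (cong (μList (μ A)) (eq zs (g e))) (μList-++ (μ A) zs (g e))))
                            (+-monoˡ-≤ _ (suffix-μ (μ A) ys zs s)))
    where
    eq : ∀ (xs ys : List ⟨ A ⟩) → foldr _∷_ ys xs ≡ xs ++ ys
    eq []       ys = refl
    eq (x ∷ xs) ys = cong (x ∷_) (eq xs ys)

  concatᵖ : ∀ {f} → PT E (Listᵗ (Listᵗ A)) f → PT E (Listᵗ A) (λ e → concat (f e))
  concatᵖ {A = A} P = foldᵖ P (const′ []) (fstᵖ π₂ ++ᵖ sndᵖ π₂) (size-O P)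
    λ e ys zs s → ≤-trans (go zs) (suffix-μ (μList (μ A)) ys zs s)
    where
    go : ∀ xss → μList (μ A) (concat xss) ≤ μList (μList (μ A)) xss
    go []         = z≤n
    go (xs ∷ xss) = ≤-trans (≤-reflexive (μList-++ (μ A) xs (concat xss))) (+-mono-≤ (n≤1+n _) (go xss))

  -- Written as the very fold that the program performs, so that `foldᵖ` applies directly.
  select : ∀ {A : Set} → (A → Bool) → List A → List A
  select p = foldr (λ x xs → if p x then x ∷ xs else xs) []

  selectᵖ : ∀ {l : ⟨ E ⟩ → List ⟨ A ⟩} {p : ⟨ E ⟩ × ⟨ A ⟩ → Bool} →
            PT E (Listᵗ A) l → PT (E ×ᵗ A) Boolᵗ p → PT E (Listᵗ A) (λ e → select (λ x → p (e , x)) (l e))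
  selectᵖ {A = A} {p = p} L P = foldᵖ L (const′ [])
    (ifᵖ ((π₁ ,ᵖ fstᵖ π₂) ▸ P) (fstᵖ π₂ ∷ᵖ sndᵖ π₂) (sndᵖ π₂)) (size-O L)
    λ e ys zs s → ≤-trans (go e zs) (suffix-μ (μ A) ys zs s)
    where
    go : ∀ e xs → μList (μ A) (select (λ x → p (e , x)) xs) ≤ μList (μ A) xs
    go e []       = z≤n
    go e (x ∷ xs) with p (e , x)
    ... | true  = +-monoʳ-≤ (1 + μ A x) (go e xs)
    ... | false = ≤-trans (go e xs) (m≤n+m _ (1 + μ A x))

  every : ∀ {A : Set} → (A → Bool) → List A → Bool
  every p = foldr (λ x b → if p x then b else false) true

  everyᵖ : ∀ {l : ⟨ E ⟩ → List ⟨ A ⟩} {p : ⟨ E ⟩ × ⟨ A ⟩ → Bool} →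
           PT E (Listᵗ A) l → PT (E ×ᵗ A) Boolᵗ p → PT E Boolᵗ (λ e → every (λ x → p (e , x)) (l e))
  everyᵖ L P = foldᵖ L (const′ true)
    (ifᵖ ((π₁ ,ᵖ fstᵖ π₂) ▸ P) (sndᵖ π₂) (const′ false)) (O-const 0) λ _ _ _ _ → z≤n

  sucᵖ : ∀ {f} → PT E ℕᵗ f → PT E ℕᵗ (λ e → suc (f e))
  sucᵖ P = mkPT (cons nil (prog P)) (λ a → 1 + 1 + time P a) (λ ρ a → cons nil (run P ρ a))
    (O-+ (O-const 2) (time-O P)) (O-+ (O-const 1) (size-O P))

  μ-replicate : ∀ n → μList (μ Unitᵗ) (replicate n tt) ≡ n
  μ-replicate zero    = refl
  μ-replicate (suc n) = cong suc (μ-replicate n)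

  unaryᵖ : ∀ {f} → PT E ℕᵗ f → PT E (Listᵗ Unitᵗ) (λ e → replicate (f e) tt)
  unaryᵖ {f = f} P = P ▸ recode (λ n → replicate n tt) enc≡ (O-mono (λ n → ≤-reflexive (μ-replicate n)) O-μ)
    where
    enc≡ : ∀ n → encℕ n ≡ encList (λ _ → nil) (replicate n tt)
    enc≡ zero    = refl
    enc≡ (suc n) = cong (cons nil) (enc≡ n)

  lengthᵖ : ∀ {f} → PT E (Listᵗ A) f → PT E ℕᵗ (λ e → length (f e))
  lengthᵖ {A = A} {f} P = foldᵖ P (const′ 0) (sucᵖ (sndᵖ π₂)) (size-O P)
    λ e ys zs s → ≤-trans (suffix-length ys zs s) (length≤μList (μ A) (f e))

  -- A unary number and a list of units have the same tree, so iteration is a fold and inherits its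
  -- rule.
  repeat : ∀ {A : Set} → (A → A) → A → ℕ → A
  repeat f z n = foldr (λ _ → f) z (replicate n tt)

  suffix-replicate : ∀ {n} ys zs → replicate n tt ≡ ys ʳ++ zs → zs ≡ replicate (length zs) tt
  suffix-replicate ys zs _ = go zs
    where
    go : ∀ zs → zs ≡ replicate (length zs) tt
    go []       = refl
    go (_ ∷ zs) = cong (tt ∷_) (go zs)

  repeatᵖ : ∀ {n : ⟨ E ⟩ → ℕ} {z : ⟨ E ⟩ → ⟨ B ⟩} {f : ⟨ E ⟩ × ⟨ B ⟩ → ⟨ B ⟩} {q} →
            PT E ℕᵗ n → PT E B z → PT (E ×ᵗ B) B f → O E q →
            (∀ e i → i ≤ n e → μ B (repeat (λ b → f (e , b)) (z e) i) ≤ q e) →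
            PT E B (λ e → repeat (λ b → f (e , b)) (z e) (n e))
  repeatᵖ {B = B} {n} {z} {f} {q} N Z F Q b≤ = foldᵖ (unaryᵖ N) Z ((π₁ ,ᵖ sndᵖ π₂) ▸ F) Q
    λ e ys zs s → subst (λ us → μ B (foldr (λ _ b → f (e , b)) (z e) us) ≤ q e) (sym (suffix-replicate ys zs s))
      (b≤ e (length zs) (≤-trans (suffix-length ys zs s) (≤-reflexive (length-replicate (n e)))))

  infixl 6 _+ᵖ_ _∸ᵖ_
  _+ᵖ_ : ∀ {f g} → PT E ℕᵗ f → PT E ℕᵗ g → PT E ℕᵗ (λ e → f e + g e)
  _+ᵖ_ {f = f} {g} P Q = ext (λ e → eq (f e) (g e))
    (repeatᵖ P Q (sucᵖ π₂) (O-+ (size-O P) (size-O Q))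
      λ e i i≤ → ≤-trans (≤-reflexive (eq i (g e))) (+-monoˡ-≤ (g e) i≤))
    where
    eq : ∀ m n → repeat suc n m ≡ m + n
    eq zero    n = refl
    eq (suc m) n = cong suc (eq m n)

  infixl 7 _*ᵖ_
  _*ᵖ_ : ∀ {f g} → PT E ℕᵗ f → PT E ℕᵗ g → PT E ℕᵗ (λ e → f e * g e)
  _*ᵖ_ {f = f} {g} P Q = ext (λ e → eq (f e) (g e))
    (repeatᵖ P (const′ 0) ((π₁ ▸ Q) +ᵖ π₂) (O-* (size-O P) (size-O Q))
      λ e i i≤ → ≤-trans (≤-reflexive (eq i (g e))) (*-monoˡ-≤ (g e) i≤))
    where
    eq : ∀ m n → repeat (n +_) 0 m ≡ m * n
    eq zero    n = refl
    eq (suc m) n = cong (n +_) (eq m n)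

  tail : ∀ {A : Set} → List A → List A
  tail []       = []
  tail (_ ∷ xs) = xs

  μ-tail : ∀ {A : Set} (m : A → ℕ) xs → μList m (tail xs) ≤ μList m xs
  μ-tail m []       = z≤n
  μ-tail m (x ∷ xs) = m≤n+m _ (1 + m x)

  tailᵖ : ∀ {f} → PT E (Listᵗ A) f → PT E (Listᵗ A) (λ e → tail (f e))
  tailᵖ P = caseListᵖ P (const′ []) (sndᵖ π₂) (λ e eq → cong tail (sym eq)) (λ e x xs eq → cong tail (sym eq))

  headOr : ∀ {A : Set} → A → List A → A
  headOr d []      = d
  headOr d (x ∷ _) = x

  headOrᵖ : ∀ {d f} → PT E A d → PT E (Listᵗ A) f → PT E A (λ e → headOr (d e) (f e))
  headOrᵖ {d = d} D P = caseListᵖ P D (fstᵖ π₂) (λ e eq → cong (headOr (d e)) (sym eq))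
    (λ e x xs eq → cong (headOr (d e)) (sym eq))

  dropᵖ : ∀ {n f} → PT E ℕᵗ n → PT E (Listᵗ A) f → PT E (Listᵗ A) (λ e → repeat tail (f e) (n e))
  dropᵖ {A = A} {f = f} N P = repeatᵖ N P (tailᵖ π₂) (size-O P) λ e i _ → go (f e) i
    where
    go : ∀ xs i → μList (μ A) (repeat tail xs i) ≤ μList (μ A) xs
    go xs zero    = ≤-refl
    go xs (suc i) = ≤-trans (μ-tail (μ A) (repeat tail xs i)) (go xs i)

  nth : ∀ {A : Set} → A → List A → ℕ → A
  nth d xs i = headOr d (repeat tail xs i)

  nthᵖ : ∀ {d f n} → PT E A d → PT E (Listᵗ A) f → PT E ℕᵗ n → PT E A (λ e → nth (d e) (f e) (n e))
  nthᵖ D P N = headOrᵖ D (dropᵖ N P)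

  predᵖ : ∀ {f} → PT E ℕᵗ f → PT E ℕᵗ (λ e → pred (f e))
  predᵖ {f = f} P = ext (λ e → eq (f e)) (lengthᵖ (tailᵖ (unaryᵖ P)))
    where
    eq : ∀ n → length (tail (replicate n tt)) ≡ pred n
    eq zero    = refl
    eq (suc n) = length-replicate n

  _∸ᵖ_ : ∀ {f g} → PT E ℕᵗ f → PT E ℕᵗ g → PT E ℕᵗ (λ e → f e ∸ g e)
  _∸ᵖ_ {f = f} {g} P Q = ext (λ e → eq (f e) (g e))
    (repeatᵖ Q P (predᵖ π₂) (size-O P) λ e i _ → ≤-trans (≤-reflexive (eq (f e) i)) (m∸n≤m (f e) i))
    where
    eq : ∀ m n → repeat pred m n ≡ m ∸ n
    eq m zero    = refl
    eq m (suc n) = trans (cong pred (eq m n)) (pred[m∸n]≡m∸[1+n] m n)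

  distᵖ : ∀ {f g} → PT E ℕᵗ f → PT E ℕᵗ g → PT E ℕᵗ (λ e → ∣ f e - g e ∣)
  distᵖ {f = f} {g} P Q = ext (λ e → eq (f e) (g e)) ((P ∸ᵖ Q) +ᵖ (Q ∸ᵖ P))
    where
    eq : ∀ m n → (m ∸ n) + (n ∸ m) ≡ ∣ m - n ∣
    eq zero    zero    = refl
    eq zero    (suc n) = refl
    eq (suc m) zero    = +-identityʳ _
    eq (suc m) (suc n) = eq m n

  isZero : ℕ → Bool
  isZero zero    = true
  isZero (suc _) = false

  isZeroᵖ : ∀ {f} → PT E ℕᵗ f → PT E Boolᵗ (λ e → isZero (f e))
  isZeroᵖ {f = f} P = caseListᵖ (unaryᵖ P) (const′ true) (const′ false)
    (λ e → eq₀ (f e)) (λ e _ _ → eq₁ (f e))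
    where
    eq₀ : ∀ n → replicate n tt ≡ [] → true ≡ isZero n
    eq₀ zero _ = refl
    eq₁ : ∀ n {x xs} → replicate n tt ≡ x ∷ xs → false ≡ isZero n
    eq₁ (suc n) _ = refl

  infix 4 _≤ᵖ_ _≡ᵖ_ _≤?ᵇ_ _≡?ᵇ_
  _≤?ᵇ_ _≡?ᵇ_ : ℕ → ℕ → Bool
  m ≤?ᵇ n = isZero (m ∸ n)
  m ≡?ᵇ n = isZero ∣ m - n ∣

  ≤?ᵇ-sound : ∀ {m n} → (m ≤?ᵇ n) ≡ true → m ≤ n
  ≤?ᵇ-sound {m} {n} eq with m ∸ n in d
  ≤?ᵇ-sound {m} {n} eq | zero = m∸n≡0⇒m≤n d

  ≤?ᵇ-complete : ∀ {m n} → m ≤ n → (m ≤?ᵇ n) ≡ true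
  ≤?ᵇ-complete {m} {n} m≤n = cong isZero (m≤n⇒m∸n≡0 m≤n)

  ≤?ᵇ-false : ∀ {m n} → (m ≤?ᵇ n) ≡ false → n < m
  ≤?ᵇ-false {m} {n} eq = ≰⇒> λ m≤n → case-false (trans (sym (≤?ᵇ-complete m≤n)) eq)
    where
    case-false : ∀ {X : Set} → true ≡ false → X
    case-false ()

  ≡?ᵇ-sound : ∀ {m n} → (m ≡?ᵇ n) ≡ true → m ≡ n
  ≡?ᵇ-sound {m} {n} eq with ∣ m - n ∣ in d
  ≡?ᵇ-sound {m} {n} eq | zero = ∣m-n∣≡0⇒m≡n d

  ≡?ᵇ-complete : ∀ {m n} → m ≡ n → (m ≡?ᵇ n) ≡ true
  ≡?ᵇ-complete {m} refl = cong isZero (∣n-n∣≡0 m)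

  _≤ᵖ_ : ∀ {f g} → PT E ℕᵗ f → PT E ℕᵗ g → PT E Boolᵗ (λ e → f e ≤?ᵇ g e)
  P ≤ᵖ Q = isZeroᵖ (P ∸ᵖ Q)

  _≡ᵖ_ : ∀ {f g} → PT E ℕᵗ f → PT E ℕᵗ g → PT E Boolᵗ (λ e → f e ≡?ᵇ g e)
  P ≡ᵖ Q = isZeroᵖ (distᵖ P Q)

  notᵖ : ∀ {f} → PT E Boolᵗ f → PT E Boolᵗ (λ e → not (f e))
  notᵖ {f = f} P = ext (λ e → eq (f e)) (ifᵖ P (const′ false) (const′ true))
    where
    eq : ∀ b → (if b then false else true) ≡ not b
    eq true  = refl
    eq false = refl

  infixr 6 _∧ᵖ_
  _∧ᵖ_ : ∀ {f g} → PT E Boolᵗ f → PT E Boolᵗ g → PT E Boolᵗ (λ e → f e ∧ g e)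
  _∧ᵖ_ {f = f} {g} P Q = ext (λ e → eq (f e) (g e)) (ifᵖ P Q (const′ false))
    where
    eq : ∀ b c → (if b then c else false) ≡ b ∧ c
    eq true  c = refl
    eq false c = refl

  sumᵖ : ∀ {f} → PT E (Listᵗ ℕᵗ) f → PT E ℕᵗ (λ e → sum (f e))
  sumᵖ P = foldᵖ P (const′ 0) (fstᵖ π₂ +ᵖ sndᵖ π₂) (size-O P)
    λ e ys zs s → ≤-trans (go zs) (suffix-μ id ys zs s)
    where
    go : ∀ xs → sum xs ≤ μList id xs
    go []       = z≤n
    go (x ∷ xs) = +-mono-≤ (n≤1+n x) (go xs)

  range : ℕ → List ℕ
  range = repeat (λ xs → 0 ∷ map suc xs) []

  rangeᵖ : ∀ {f} → PT E ℕᵗ f → PT E (Listᵗ ℕᵗ) (λ e → range (f e))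
  rangeᵖ {f = f} P = repeatᵖ P (const′ []) (const′ 0 ∷ᵖ mapᵖ π₂ (sucᵖ π₂)) (O-* (size-O P) (size-O P))
    λ e i i≤ → ≤-trans (go i) (*-mono-≤ i≤ i≤)
    where
    shift : ∀ xs → μList id (map suc xs) ≡ length xs + μList id xs
    shift []       = refl
    shift (x ∷ xs) = cong suc (trans (cong (suc x +_) (shift xs)) (trans (sym (+-assoc (suc x) _ _))
      (trans (cong (_+ μList id xs) (+-comm (suc x) (length xs))) (+-assoc (length xs) (suc x) _))))
    len : ∀ n → length (range n) ≡ n
    len zero    = refl
    len (suc n) = cong suc (trans (length-map suc (range n)) (len n))
    go : ∀ n → μList id (range n) ≤ n * n
    go zero    = z≤n
    go (suc n) = s≤s (begin
      μList id (map suc (range n))       ≡⟨ shift (range n) ⟩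
      length (range n) + μList id (range n) ≤⟨ +-mono-≤ (≤-reflexive (len n)) (go n) ⟩
      n + n * n                          ≡⟨ *-suc n n ⟨
      n * suc n                          ≤⟨ m≤n+m _ n ⟩
      n + n * suc n                      ∎)
      where open ≤-Reasoning

-- The objective, the dynamic program over the components, and the local search

module LocalSearch where

  open PolynomialTime
  open Routines
  open import Data.Bool.Base using (Bool; true; false; if_then_else_; _∧_)
  open import Data.List.Base as List using (List; []; _∷_; _++_; foldr; length; map; concat)
  open import Data.List.Membership.Propositional using (_∈_)
  open import Data.List.Properties using (length-++)
  open import Data.List.Relation.Unary.All as All using (All; []; _∷_)
  import Data.List.Relation.Unary.All.Properties as All
  open import Data.List.Relation.Unary.Any using (here; there)
  open import Data.Nat.Base using (ℕ; zero; suc; _+_; _*_; _≤_; z≤n; s≤s; ∣_-_∣)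
  open import Data.Nat.ListAction using (sum)
  open import Data.Nat.Properties
  open import Data.Product.Base using (_×_; _,_; proj₁; proj₂)
  open import Function.Base using (id)
  open import Relation.Binary.PropositionalEquality hiding ([_])

  Rowᵗ Graphᵗ Keyᵗ Asgᵗ Itemᵗ Solᵗ : Ty
  Rowᵗ   = Listᵗ Boolᵗ
  Graphᵗ = Listᵗ Rowᵗ
  Keyᵗ   = ℕᵗ ×ᵗ ℕᵗ
  Asgᵗ   = Listᵗ Keyᵗ
  Itemᵗ  = Listᵗ Asgᵗ
  Solᵗ   = Listᵗ (Itemᵗ ×ᵗ Asgᵗ)

  -- A key is a vertex with its label. An assignment labels the cover or one component, an item
  -- lists the options of one component, and a solution pairs every item with the option chosen for
  -- it.
  Key Asg Item Sol : Set
  Key  = ℕ × ℕ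
  Asg  = List Key
  Item = List Asg
  Sol  = List (Item × Asg)

  edge : List (List Bool) → ℕ → ℕ → Bool
  edge g v u = nth false (nth [] g v) u

  deg : List (List Bool) → ℕ → ℕ
  deg g v = length (select id (nth [] g v))

  left : List (List Bool) → Asg → Key → ℕ
  left g B (v , κ) = sum (map (λ (u , κ′) → if edge g v u ∧ (suc κ′ ≤?ᵇ κ) then 1 else 0) B)

  dev : List (List Bool) → Asg → Key → ℕ
  dev g B p = ∣ 2 * left g B p - deg g (proj₁ p) ∣

  -- The vertices of `A` are judged by their left neighbours in `B` but by their degree in the whole
  -- graph, so `B` has to contain all their neighbours. It is used with a component against itself
  -- and the cover, and with the cover against everything.
  imb : List (List Bool) → Asg → Asg → ℕ
  imb g A B = sum (map (dev g B) A)

  asg : Sol → Asg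
  asg s = concat (map proj₂ s)

  argmin : ∀ {A : Set} → (A → ℕ) → A → List A → A
  argmin key = foldr (λ x b → if key x ≤?ᵇ key b then x else b)

  take1 : ∀ {A : Set} → List A → List A
  take1 []      = []
  take1 (x ∷ _) = x ∷ []

  -- A list of at most one element: if `xs` is empty there is nothing to choose, and otherwise its
  -- first element serves as the default of `argmin`.
  best : ∀ {A : Set} → (A → ℕ) → List A → List A
  best key xs = map (λ x → argmin key x xs) (take1 xs)

  extend : Item → List Sol → List Sol
  extend it T = concat (map (λ ψ → map ((it , ψ) ∷_) T) it)

  module Solver (g : List (List Bool)) (φ : Asg) (box : List Asg) (R : ℕ) where

    lin obj : Sol → ℕ
    lin s = sum (map (λ p → imb g (proj₂ p) (proj₂ p ++ φ)) s)
    obj s = lin s + imb g φ (φ ++ asg s)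

    -- s differs from c by the vector v, whose entries are shifted by R to be natural.
    match : Sol → Sol → Asg → Bool
    match c s v = every (λ b → every (λ p →
      if proj₁ b ≡?ᵇ proj₁ p then proj₂ b + left g (asg c) p ≡?ᵇ R + left g (asg s) p else true) φ) v

    prune : Sol → List Sol → List Sol
    prune c T = concat (map (λ v → best lin (select (λ s → match c s v) T)) box)

    -- The suffix `c` of the current solution is carried along with the table, because partial
    -- solutions are compared with it on the components treated so far.
    dp-step : Item × Asg → List Sol × Sol → List Sol × Sol
    dp-step i (T , c) = prune (i ∷ c) (extend (proj₁ i) T) , (i ∷ c)

    dp : Sol → List Sol × Sol
    dp = foldr dp-step ([] ∷ [] , [])

    improve : Sol → Sol
    improve c = argmin obj c (proj₁ (dp c))

    start : List Item → Sol
    start = map (λ it → it , headOr [] it)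

    -- The objective drops by at least one in every round that does not start at an optimum, so its
    -- initial value is a sufficient number of rounds.
    final : List Item → Sol
    final items = repeat improve (start items) (obj (start items))

    solve : List Item → ℕ
    solve items = obj (final items)

  -- Only the right-hand solution has to choose from the items, so `Fits c c` expresses that the
  -- choices of `c` are options themselves.
  data Fits : Sol → Sol → Set where
    []  : Fits [] []
    _∷_ : ∀ {it x ψ c s} → ψ ∈ it → Fits c s → Fits ((it , x) ∷ c) ((it , ψ) ∷ s)

  module _ {A : Set} {P : A → Set} where

    All-select : ∀ p {xs} → All P xs → All P (select p xs)
    All-select p []               = []
    All-select p {x ∷ _} (px ∷ ps) with p x
    ... | true  = px ∷ All-select p ps
    ... | false = All-select p ps

    All-argmin : ∀ key d xs → P d → All P xs → P (argmin key d xs)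
    All-argmin key d []       pd [] = pd
    All-argmin key d (x ∷ xs) pd (px ∷ ps) with key x ≤?ᵇ key (argmin key d xs)
    ... | true  = px
    ... | false = All-argmin key d xs pd ps

    All-best : ∀ key {xs} → All P xs → All P (best key xs)
    All-best key []        = []
    All-best key {x ∷ xs} (px ∷ ps) = All-argmin key x (x ∷ xs) px (px ∷ ps) ∷ []

  module _ (g : List (List Bool)) (φ : Asg) (box : List Asg) (R : ℕ) where
    open Solver g φ box R

    dp-second : ∀ c → proj₂ (dp c) ≡ c
    dp-second []      = refl
    dp-second (i ∷ c) = cong (i ∷_) (dp-second c)

    All-prune : ∀ {P : Sol → Set} {c T} → All P T → All P (prune c T)
    All-prune {P} {c} {T} ps = All.concat⁺ (All.map⁺ (All.universal (λ v → All-best lin (All-select (λ s → match c s v) ps)) box))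

    dp-fits : ∀ c → All (Fits c) (proj₁ (dp c))
    dp-fits []            = [] ∷ []
    dp-fits ((it , x) ∷ c) = All-prune {c = (it , x) ∷ proj₂ (dp c)} (All.concat⁺ (All.map⁺ (All.map
      (λ ψ∈ → All.map⁺ (All.map (ψ∈ ∷_) (dp-fits c))) (All.tabulate id))))

    length-best : ∀ {A : Set} (key : A → ℕ) xs → length (best key xs) ≤ 1
    length-best key []      = z≤n
    length-best key (x ∷ _) = s≤s z≤n

    length-prune : ∀ c T → length (prune c T) ≤ length box
    length-prune c T = go box
      where
      go : ∀ vs → length (concat (map (λ v → best lin (select (λ s → match c s v) T)) vs)) ≤ length vs
      go []       = z≤n
      go (v ∷ vs) = ≤-trans (≤-reflexive (length-++ (best lin (select (λ s → match c s v) T))))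
        (+-mono-≤ (length-best lin (select (λ s → match c s v) T)) (go vs))

    -- After each component pruning leaves at most one solution per vector of the box, so the table
    -- does not grow with the number of components. The additional 1 covers the initial table.
    length-dp : ∀ c → length (proj₁ (dp c)) ≤ 1 + length box
    length-dp []      = s≤s z≤n
    length-dp (i ∷ c) = ≤-trans (length-prune (i ∷ proj₂ (dp c)) (extend (proj₁ i) (proj₁ (dp c)))) (n≤1+n _)

  Fits-trans : ∀ {a b c} → Fits a b → Fits b c → Fits a c
  Fits-trans []      []      = []
  Fits-trans (_ ∷ f) (y ∷ h) = y ∷ Fits-trans f h

  module _ (g : List (List Bool)) (φ : Asg) (box : List Asg) (R : ℕ) where
    open Solver g φ box R

    improve-fits : ∀ {P : Sol → Set} c → P c → (∀ {s} → Fits c s → P s) → P (improve c)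
    improve-fits {P} c pc f = All-argmin {P = P} obj c (proj₁ (dp c)) pc (All.map f (dp-fits g φ box R c))

    -- The iterates never leave the solutions that fit the first one. The second half of the
    -- conclusion is what makes the induction work, through `Fits-trans`.
    repeat-fits : ∀ (P : Sol → Set) x → P x → (∀ {s} → Fits x s → P s) → ∀ i →
                  P (repeat improve x i) × (∀ {s} → Fits (repeat improve x i) s → P s)
    repeat-fits P x px f zero    = px , f
    repeat-fits P x px f (suc i) with repeat-fits P x px f i
    ... | py , h = improve-fits {λ y → P y × (∀ {s} → Fits y s → P s)} (repeat improve x i) (py , h)
      λ k → h k , λ m → h (Fits-trans k m)

  ∈-μ : ∀ {A : Set} (m : A → ℕ) {x xs} → x ∈ xs → m x ≤ μList m xs
  ∈-μ m {x} (here refl) = ≤-trans (n≤1+n _) (m≤m+n (1 + m x) _)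
  ∈-μ m (there {y} x∈)  = ≤-trans (∈-μ m x∈) (m≤n+m _ (1 + m y))

  -- The option chosen by `s` is an entry of its item, and that item is already counted in the
  -- measure of `c`; this costs at most a factor of 2.
  Fits-μ : ∀ {c s} → Fits c s → μ Solᵗ s ≤ 2 * μ Solᵗ c
  Fits-μ []                                 = z≤n
  Fits-μ {(it , x) ∷ c} {(_ , ψ) ∷ s} (ψ∈ ∷ f) = begin
    1 + (i + μ Asgᵗ ψ) + μ Solᵗ s         ≤⟨ +-mono-≤ (s≤s (+-monoʳ-≤ i (∈-μ (μ Asgᵗ) ψ∈))) (Fits-μ f) ⟩
    1 + (i + i) + 2 * μ Solᵗ c            ≤⟨ +-monoˡ-≤ _ (+-monoʳ-≤ 1 (≤-trans (+-mono-≤ (m≤m+n i y) (m≤m+n i y))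
                                                 (≤-trans (n≤1+n _) (≤-reflexive (trans (sym (+-suc (i + y) (i + y))) (cong (i + y +_) (sym (+-identityʳ _)))))))) ⟩
    1 + (i + y + (suc (i + y) + 0)) + 2 * μ Solᵗ c ≡⟨⟩
    2 * (1 + (i + y)) + 2 * μ Solᵗ c      ≡⟨ *-distribˡ-+ 2 (1 + (i + y)) (μ Solᵗ c) ⟨
    2 * (1 + (i + y) + μ Solᵗ c)          ∎
    where
    open ≤-Reasoning
    i = μ Itemᵗ it
    y = μ Asgᵗ x

  All-μ : ∀ {A : Set} (m : A → ℕ) {k xs} → All (λ x → m x ≤ k) xs → μList m xs ≤ length xs * (1 + k)
  All-μ m []       = z≤n
  All-μ m (p ∷ ps) = +-mono-≤ (s≤s p) (All-μ m ps)

  private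
    variable
      E A B : Ty

  edgeᵖ : ∀ {g v u} → PT E Graphᵗ g → PT E ℕᵗ v → PT E ℕᵗ u → PT E Boolᵗ (λ e → edge (g e) (v e) (u e))
  edgeᵖ G V U = nthᵖ (const′ false) (nthᵖ (const′ []) G V) U

  degᵖ : ∀ {g v} → PT E Graphᵗ g → PT E ℕᵗ v → PT E ℕᵗ (λ e → deg (g e) (v e))
  degᵖ G V = lengthᵖ (selectᵖ (nthᵖ (const′ []) G V) π₂)

  leftᵖ : ∀ {g b p} → PT E Graphᵗ g → PT E Asgᵗ b → PT E Keyᵗ p → PT E ℕᵗ (λ e → left (g e) (b e) (p e))
  leftᵖ G B P = sumᵖ (mapᵖ B (ifᵖ
    (edgeᵖ (π₁ ▸ G) (π₁ ▸ fstᵖ P) (fstᵖ π₂) ∧ᵖ (sucᵖ (sndᵖ π₂) ≤ᵖ (π₁ ▸ sndᵖ P))) (const′ 1) (const′ 0)))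

  devᵖ : ∀ {g b p} → PT E Graphᵗ g → PT E Asgᵗ b → PT E Keyᵗ p → PT E ℕᵗ (λ e → dev (g e) (b e) (p e))
  devᵖ G B P = distᵖ (const′ 2 *ᵖ leftᵖ G B P) (degᵖ G (fstᵖ P))

  imbᵖ : ∀ {g a b} → PT E Graphᵗ g → PT E Asgᵗ a → PT E Asgᵗ b → PT E ℕᵗ (λ e → imb (g e) (a e) (b e))
  imbᵖ G A B = sumᵖ (mapᵖ A (devᵖ (π₁ ▸ G) (π₁ ▸ B) π₂))

  asgᵖ : ∀ {s} → PT E Solᵗ s → PT E Asgᵗ (λ e → asg (s e))
  asgᵖ S = concatᵖ (mapᵖ S (sndᵖ π₂))

  argminᵖ : ∀ {d l} {key : ⟨ E ⟩ × ⟨ A ⟩ → ℕ} → PT (E ×ᵗ A) ℕᵗ key → PT E A d → PT E (Listᵗ A) l →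
            PT E A (λ e → argmin (λ x → key (e , x)) (d e) (l e))
  argminᵖ {A = A} {d} {l} {key} K D L = foldᵖ L D
    (ifᵖ (((π₁ ,ᵖ fstᵖ π₂) ▸ K) ≤ᵖ ((π₁ ,ᵖ sndᵖ π₂) ▸ K)) (fstᵖ π₂) (sndᵖ π₂))
    (O-+ (size-O D) (size-O L))
    λ e ys zs s → All-argmin {P = λ x → μ A x ≤ μ A (d e) + μList (μ A) (l e)} (λ x → key (e , x)) (d e) zs (m≤m+n _ _)
      (All.tabulate λ x∈ → ≤-trans (∈-μ (μ A) x∈) (≤-trans (suffix-μ (μ A) ys zs s) (m≤n+m _ (μ A (d e)))))

  take1ᵖ : ∀ {l} → PT E (Listᵗ A) l → PT E (Listᵗ A) (λ e → take1 (l e))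
  take1ᵖ L = caseListᵖ L (const′ []) (fstᵖ π₂ ∷ᵖ const′ []) (λ e eq → cong take1 (sym eq)) (λ e x xs eq → cong take1 (sym eq))

  bestᵖ : ∀ {l} {key : ⟨ E ⟩ × ⟨ A ⟩ → ℕ} → PT (E ×ᵗ A) ℕᵗ key → PT E (Listᵗ A) l →
          PT E (Listᵗ A) (λ e → best (λ x → key (e , x)) (l e))
  bestᵖ K L = mapᵖ (take1ᵖ L) (argminᵖ ((fstᵖ π₁ ,ᵖ π₂) ▸ K) π₂ (π₁ ▸ L))

  extendᵖ : ∀ {it t} → PT E Itemᵗ it → PT E (Listᵗ Solᵗ) t → PT E (Listᵗ Solᵗ) (λ e → extend (it e) (t e))
  extendᵖ I T = concatᵖ (mapᵖ I (mapᵖ (π₁ ▸ T) (((fstᵖ π₁ ▸ I) ,ᵖ sndᵖ π₁) ∷ᵖ π₂)))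

  module _ {g φ box R} (G : PT E Graphᵗ g) (Φ : PT E Asgᵗ φ) (X : PT E (Listᵗ Asgᵗ) box) (RR : PT E ℕᵗ R) where
    private
      module S e = Solver (g e) (φ e) (box e) (R e)

    linᵖ : ∀ {s} → PT E Solᵗ s → PT E ℕᵗ (λ e → S.lin e (s e))
    linᵖ S = sumᵖ (mapᵖ S (imbᵖ (π₁ ▸ G) (sndᵖ π₂) (sndᵖ π₂ ++ᵖ (π₁ ▸ Φ))))

    objᵖ : ∀ {s} → PT E Solᵗ s → PT E ℕᵗ (λ e → S.obj e (s e))
    objᵖ S = linᵖ S +ᵖ imbᵖ G Φ (Φ ++ᵖ asgᵖ S)

    matchᵖ : ∀ {c s v} → PT E Solᵗ c → PT E Solᵗ s → PT E Asgᵗ v → PT E Boolᵗ (λ e → S.match e (c e) (s e) (v e))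
    matchᵖ C S V = everyᵖ V (everyᵖ (π₁ ▸ Φ)
      (ifᵖ (fstᵖ (sndᵖ π₁) ≡ᵖ fstᵖ π₂)
        ((sndᵖ (sndᵖ π₁) +ᵖ leftᵖ (fstᵖ π₁ ▸ G) (fstᵖ π₁ ▸ asgᵖ C) π₂) ≡ᵖ
         ((fstᵖ π₁ ▸ RR) +ᵖ leftᵖ (fstᵖ π₁ ▸ G) (fstᵖ π₁ ▸ asgᵖ S) π₂))
        (const′ true)))

  module _ {g φ box R} (G : PT E Graphᵗ g) (Φ : PT E Asgᵗ φ) (X : PT E (Listᵗ Asgᵗ) box) (RR : PT E ℕᵗ R) where
    private
      module S e = Solver (g e) (φ e) (box e) (R e)

    pruneᵖ : ∀ {c t} → PT E Solᵗ c → PT E (Listᵗ Solᵗ) t → PT E (Listᵗ Solᵗ) (λ e → S.prune e (c e) (t e))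
    pruneᵖ C T = concatᵖ (mapᵖ X (bestᵖ
      (linᵖ (fstᵖ π₁ ▸ G) (fstᵖ π₁ ▸ Φ) (fstᵖ π₁ ▸ X) (fstᵖ π₁ ▸ RR) π₂)
      (selectᵖ (π₁ ▸ T) (matchᵖ (fstᵖ π₁ ▸ G) (fstᵖ π₁ ▸ Φ) (fstᵖ π₁ ▸ X) (fstᵖ π₁ ▸ RR)
        (fstᵖ π₁ ▸ C) π₂ (sndᵖ π₁)))))

  module _ {g φ box R} (G : PT E Graphᵗ g) (Φ : PT E Asgᵗ φ) (X : PT E (Listᵗ Asgᵗ) box) (RR : PT E ℕᵗ R) where
    private
      module S e = Solver (g e) (φ e) (box e) (R e)

    dpᵖ : ∀ {c} → PT E Solᵗ c → PT E (Listᵗ Solᵗ ×ᵗ Solᵗ) (λ e → S.dp e (c e))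
    dpᵖ {c} C = foldᵖ C ((const′ [] ∷ᵖ const′ []) ,ᵖ const′ [])
      (pruneᵖ (π₁ ▸ G) (π₁ ▸ Φ) (π₁ ▸ X) (π₁ ▸ RR) (fstᵖ π₂ ∷ᵖ sndᵖ (sndᵖ π₂))
          (extendᵖ (fstᵖ (fstᵖ π₂)) (fstᵖ (sndᵖ π₂)))
        ,ᵖ (fstᵖ π₂ ∷ᵖ sndᵖ (sndᵖ π₂)))
      (O-+ (O-* (O-+ (O-const 1) (O-mono (λ e → length≤μList (μ Asgᵗ) (box e)) (size-O X)))
                (O-+ (O-const 1) (O-* (O-const 2) (size-O C)))) (size-O C))
      λ e ys zs s → +-mono-≤
        (≤-trans (All-μ (μ Solᵗ) {2 * μ Solᵗ (c e)} (All.map (λ f → ≤-trans (Fits-μ f) (*-monoʳ-≤ 2 (suffix-μ (μ (Itemᵗ ×ᵗ Asgᵗ)) ys zs s)))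
            (dp-fits (g e) (φ e) (box e) (R e) zs)))
          (*-monoˡ-≤ _ (length-dp (g e) (φ e) (box e) (R e) zs)))
        (≤-trans (≤-reflexive (cong (μ Solᵗ) (dp-second (g e) (φ e) (box e) (R e) zs))) (suffix-μ (μ (Itemᵗ ×ᵗ Asgᵗ)) ys zs s))

    improveᵖ : ∀ {c} → PT E Solᵗ c → PT E Solᵗ (λ e → S.improve e (c e))
    improveᵖ C = argminᵖ (objᵖ (π₁ ▸ G) (π₁ ▸ Φ) (π₁ ▸ X) (π₁ ▸ RR) π₂) C (fstᵖ (dpᵖ C))

  module _ {g φ box R} (G : PT E Graphᵗ g) (Φ : PT E Asgᵗ φ) (X : PT E (Listᵗ Asgᵗ) box) (RR : PT E ℕᵗ R) where
    private
      module S e = Solver (g e) (φ e) (box e) (R e)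

    startᵖ : ∀ {is} → PT E (Listᵗ Itemᵗ) is → PT E Solᵗ (λ e → S.start e (is e))
    startᵖ I = mapᵖ I (π₂ ,ᵖ headOrᵖ (const′ []) π₂)

    solveᵖ : ∀ {is} → PT E (Listᵗ Itemᵗ) is → PT E ℕᵗ (λ e → S.solve e (is e))
    solveᵖ {is} I = objᵖ G Φ X RR (repeatᵖ (objᵖ G Φ X RR (startᵖ I)) (startᵖ I)
      (improveᵖ (π₁ ▸ G) (π₁ ▸ Φ) (π₁ ▸ X) (π₁ ▸ RR) π₂)
      (O-* (O-const 2) (size-O (startᵖ I)))
      -- Every iterate is compared with the start and not with its predecessor, so the factor 2 of
      -- `Fits-μ` is paid only once.
      λ e i _ → proj₁ (repeat-fits (g e) (φ e) (box e) (R e) (λ s → μ Solᵗ s ≤ 2 * μ Solᵗ (S.start e (is e)))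
        (S.start e (is e)) (m≤m+n _ _) Fits-μ i))

-- The whole procedure, its constants and its running time

module Procedure where

  open PolynomialTime
  open Routines
  open LocalSearch
  open import Data.Bool.Base using (Bool; true; false; if_then_else_; _∧_; not)
  open import Data.List.Base as List using (List; []; _∷_; foldr; length; _ʳ++_; map; concat; replicate)
  open import Data.List.Properties using (length-map; length-++; length-replicate)
  open import Data.List.Relation.Unary.All as All using (All; []; _∷_)
  import Data.List.Relation.Unary.All.Properties as All
  open import Data.Nat.Base using (ℕ; zero; suc; _+_; _*_; _^_; _≤_; z≤n; s≤s)
  open import Data.Nat.Properties
  open import Data.Product.Base using (_,_; proj₁)
  open import Data.Unit.Base using (tt)
  open import Function.Base using (id)
  open import Relation.Binary.PropositionalEquality hiding ([_])

  -- inflate x = 4 ^ x * x: how much refining one coordinate with effects in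
  -- [- x, x] can increase the groups.
  inflate : ℕ → ℕ
  inflate x = repeat (4 *_) x x

  tower : ℕ → ℕ → ℕ
  tower i x = repeat inflate x i

  repeat-4* : ∀ x i → repeat (4 *_) x i ≡ 4 ^ i * x
  repeat-4* x zero    = sym (*-identityˡ x)
  repeat-4* x (suc i) = trans (cong (4 *_) (repeat-4* x i)) (sym (*-assoc 4 (4 ^ i) x))

  inflate≡ : ∀ x → inflate x ≡ 4 ^ x * x
  inflate≡ x = repeat-4* x x

  inflate-mono : ∀ {x y} → x ≤ y → inflate x ≤ inflate y
  inflate-mono {x} {y} x≤y = subst₂ _≤_ (sym (inflate≡ x)) (sym (inflate≡ y)) (*-mono-≤ (^-monoʳ-≤ 4 x≤y) x≤y)

  4^>0 : ∀ i → 1 ≤ 4 ^ i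
  4^>0 = m^n>0 4

  ≤-inflate : ∀ x → x ≤ inflate x
  ≤-inflate x = subst (x ≤_) (sym (inflate≡ x)) (≤-trans (≤-reflexive (sym (*-identityˡ x))) (*-monoˡ-≤ x (4^>0 x)))

  tower-mono : ∀ {i j x y} → i ≤ j → x ≤ y → tower i x ≤ tower j y
  tower-mono {j = zero}  z≤n x≤y = x≤y
  tower-mono {j = suc j} z≤n x≤y = ≤-trans (tower-mono {j = j} z≤n x≤y) (≤-inflate _)
  tower-mono (s≤s i≤j) x≤y = inflate-mono (tower-mono i≤j x≤y)

  2+2x≤4^x : ∀ x → 1 ≤ x → 2 + 2 * x ≤ 4 ^ x
  2+2x≤4^x (suc x) _ = go x
    where
    open ≤-Reasoning
    go : ∀ x → 2 + 2 * suc x ≤ 4 ^ suc x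
    go zero    = ≤-refl
    go (suc x) = begin
      2 + 2 * suc (suc x)       ≡⟨ cong (2 +_) (*-suc 2 (suc x)) ⟩
      2 + (2 + 2 * suc x)       ≤⟨ +-monoˡ-≤ (2 + 2 * suc x) (m≤m+n 2 (2 * suc x)) ⟩
      (2 + 2 * suc x) + (2 + 2 * suc x) ≤⟨ +-mono-≤ (go x) (go x) ⟩
      4 ^ suc x + 4 ^ suc x     ≤⟨ +-monoʳ-≤ (4 ^ suc x) (m≤m+n (4 ^ suc x) _) ⟩
      4 * 4 ^ suc x             ∎

  -- Two more levels of the tower dominate the number of vectors in a box of radius `x` over `b`
  -- coordinates: 2 + 2 x is at most 4^x, its power has exponent `x * b`, and this exponent is at
  -- most `inflate x`.
  power≤tower : ∀ b x → 1 ≤ b → b ≤ x → (2 + 2 * x) ^ b ≤ inflate (inflate x)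
  power≤tower b x 1≤b b≤x = begin
    (2 + 2 * x) ^ b           ≤⟨ ^-monoˡ-≤ b (2+2x≤4^x x 1≤x) ⟩
    (4 ^ x) ^ b               ≡⟨ ^-*-assoc 4 x b ⟩
    4 ^ (x * b)               ≤⟨ ^-monoʳ-≤ 4 (≤-trans (*-monoʳ-≤ x (≤-trans b≤x (≤-trans (m≤m+n x _) (≤-trans (m≤n+m (2 * x) 2) (2+2x≤4^x x 1≤x)))))
                                   (≤-reflexive (trans (*-comm x (4 ^ x)) (sym (inflate≡ x))))) ⟩
    4 ^ inflate x             ≡⟨ *-identityʳ _ ⟨
    4 ^ inflate x * 1         ≤⟨ *-monoʳ-≤ (4 ^ inflate x) (≤-trans 1≤x (≤-inflate x)) ⟩
    4 ^ inflate x * inflate x ≡⟨ inflate≡ (inflate x) ⟨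
    inflate (inflate x)       ∎
    where
    open ≤-Reasoning
    1≤x = ≤-trans 1≤b b≤x

  tuples : ∀ {A : Set} → List (List A) → List (List A)
  tuples = foldr (λ xs T → concat (map (λ x → map (x ∷_) T) xs)) ([] ∷ [])

  -- One more than each length is multiplied, so that the product increases with the list. The fold
  -- also builds the tuples of all suffixes, and the plain product would fail to bound them if some
  -- factor were 0.
  tuplesSize : ∀ {A : Set} → List (List A) → ℕ
  tuplesSize = foldr (λ xs p → (1 + length xs) * p) 1

  length-tuples : ∀ {A : Set} (xss : List (List A)) → length (tuples xss) ≤ tuplesSize xss
  length-tuples []         = s≤s z≤n
  length-tuples (xs ∷ xss) = ≤-trans (go xs) (m≤n+m _ (tuplesSize xss))
    where
    go : ∀ xs → length (concat (map (λ x → map (x ∷_) (tuples xss)) xs)) ≤ length xs * tuplesSize xss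
    go []       = z≤n
    go (x ∷ xs) = ≤-trans (≤-reflexive (length-++ (map (x ∷_) (tuples xss))))
      (+-mono-≤ (≤-trans (≤-reflexive (length-map (x ∷_) (tuples xss))) (length-tuples xss)) (go xs))

  tuples-μ : ∀ {A : Set} (m : A → ℕ) xss → All (λ t → μList m t ≤ μList (μList m) xss) (tuples xss)
  tuples-μ m []         = z≤n ∷ []
  tuples-μ m (xs ∷ xss) = All.concat⁺ (All.map⁺ (All.tabulate {xs = xs} λ {x} x∈ →
    All.map⁺ {f = x ∷_} (All.map (λ {t} t≤ → +-mono-≤ (s≤s (∈-μ m x∈)) t≤) (tuples-μ m xss))))

  suffix-tuplesSize : ∀ {A : Set} {l : List (List A)} ys zs → l ≡ ys ʳ++ zs → tuplesSize zs ≤ tuplesSize l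
  suffix-tuplesSize []       zs refl = ≤-refl
  suffix-tuplesSize (y ∷ ys) zs eq   = ≤-trans (m≤m+n _ _) (suffix-tuplesSize ys (y ∷ zs) eq)

  private
    variable
      E A B : Ty

  tuplesᵖ : ∀ {xss q} → PT E (Listᵗ (Listᵗ A)) xss → O E q → (∀ e → tuplesSize (xss e) ≤ q e) →
            PT E (Listᵗ (Listᵗ A)) (λ e → tuples (xss e))
  tuplesᵖ {A = A} X Q s≤q = foldᵖ X (const′ ([] ∷ []))
    (concatᵖ (mapᵖ (fstᵖ π₂) (mapᵖ (π₁ ▸ sndᵖ π₂) ((π₁ ▸ π₂) ∷ᵖ π₂))))
    (O-* Q (O-+ (O-const 1) (size-O X)))
    λ e ys zs s → ≤-trans (All-μ (μList (μ A)) (tuples-μ (μ A) zs))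
      (*-mono-≤ (≤-trans (length-tuples zs) (≤-trans (suffix-tuplesSize ys zs s) (s≤q e)))
                (s≤s (suffix-μ (μList (μ A)) ys zs s)))

  inflateᵖ : ∀ {x q} → PT E ℕᵗ x → O E q → (∀ e → inflate (x e) ≤ q e) → PT E ℕᵗ (λ e → inflate (x e))
  inflateᵖ {x = x} X Q x≤q = repeatᵖ X X (const′ 4 *ᵖ π₂) Q
    λ e i i≤x → ≤-trans (subst₂ _≤_ (sym (repeat-4* (x e) i)) (sym (inflate≡ (x e)))
      (*-monoˡ-≤ (x e) (^-monoʳ-≤ 4 i≤x))) (x≤q e)

  -- `inflate` is exponential in its argument, so the rule for iterating polynomial steps is out of
  -- reach. Each step is bounded instead by the environment, whose measure is assumed to allow for
  -- the final value of the tower.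
  towerᵖ : ∀ {i x q} → PT E ℕᵗ i → PT E ℕᵗ x → O E q → (∀ e → tower (i e) (x e) ≤ q e) →
           PT E ℕᵗ (λ e → tower (i e) (x e))
  towerᵖ {E} {i} {x} {q} I X Q x≤q = foldrᵖ (unaryᵖ I) X (inflateᵖ
      (recode {B = E ×ᵗ (Unitᵗ ×ᵗ ℕᵗ)} (λ r → env r , elem r , acc r) (λ _ → refl)
        (O-env′ (O-+ (O-μ {E}) Q) λ r → +-monoʳ-≤ (μ E (env r)) (≤-trans (≤-inflate (acc r)) (acc≤ r)))
        ▸ sndᵖ π₂)
      (O-env′ Q λ r → ≤-refl) acc≤)
    where
    acc : Step E Unitᵗ (λ e → replicate (i e) tt) → ℕ
    acc r = foldr (λ _ → inflate) (x (env r)) (zs r)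
    O-env′ : ∀ {p q} → O E q → (∀ r → p r ≤ q (env r)) →
             O (Stepᵗ E Unitᵗ ℕᵗ (λ e → replicate (i e) tt) (λ e → foldr (λ _ → inflate) (x e))) p
    O-env′ (bound c b) p≤q = bound c λ r → ≤-trans (p≤q r) (b (env r))
    acc≤ : ∀ r → inflate (acc r) ≤ q (env r)
    acc≤ r = ≤-trans (subst (λ us → foldr (λ _ → inflate) (x (env r)) us ≤ tower (i (env r)) (x (env r)))
                        (sym (suffix-replicate (ys r) (elem r ∷ zs r) (split r)))
                        (tower-mono {j = i (env r)} (≤-trans (suffix-length (ys r) (elem r ∷ zs r) (split r)) (≤-reflexive (length-replicate (i (env r))))) ≤-refl))
               (x≤q (env r))

  minimum : ∀ {A : Set} → (A → ℕ) → ℕ → List A → ℕ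
  minimum f = foldr (λ x m → if f x ≤?ᵇ m then f x else m)

  minimum≤ : ∀ {A : Set} (f : A → ℕ) d xs → minimum f d xs ≤ d
  minimum≤ f d []       = ≤-refl
  minimum≤ f d (x ∷ xs) with f x ≤?ᵇ minimum f d xs in eq
  ... | true  = ≤-trans (≤?ᵇ-sound eq) (minimum≤ f d xs)
  ... | false = minimum≤ f d xs

  module Main (g : List (List Bool)) (s : List Bool) where

    n : ℕ
    n = length g

    verts : List ℕ
    verts = range n

    inCover : ℕ → Bool
    inCover = nth false s

    near : ℕ → ℕ → Bool
    near v u = not (inCover u) ∧ (if edge g v u then true else (u ≡?ᵇ v))

    -- The vertices of a component are true twins, so they have the same closed neighbourhood
    -- outside the cover, and its first vertex names the component without any graph search. Outside
    -- the cover this list contains `v`, so the default matters for cover vertices only.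
    rep : ℕ → ℕ
    rep v = headOr v (select (near v) verts)

    comp : ℕ → List ℕ
    comp r = select (λ u → not (inCover u) ∧ (rep u ≡?ᵇ r)) verts

    cover : List ℕ
    cover = select inCover verts

    size : ℕ
    size = foldr (λ r m → if length (comp r) ≤?ᵇ m then m else length (comp r)) 0 verts

    -- The tower is as high as the cover is large, or higher, and starts at the size of a component
    -- or above; `labels` exceeds both quantities and is used for each. All is computed from the
    -- graph and the cover, since k and ℓ are not part of the input.
    labels radius : ℕ
    labels = suc (length cover) * suc size
    radius = tower labels labels

    keys : ℕ → List Key
    keys v = map (λ j → v , v + n * j) (range labels)

    offsets : ℕ → List Key
    offsets v = map (λ j → v , j) (range (1 + 2 * radius))

    -- Every vertex contributes an item. If it does not represent a component, `comp r` is empty and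
    -- the item consists of the empty assignment alone.
    items : List Item
    items = map (λ r → tuples (map keys (comp r))) verts

    covers box : List Asg
    covers = tuples (map keys cover)
    box    = tuples (map offsets cover)

    -- The default `n * n` is an upper bound for the imbalance of every layout, so it cannot push
    -- the minimum below the true value.
    value : ℕ
    value = minimum (λ φ → Solver.solve g φ box radius items) (n * n) covers

  size-bound : ∀ g s {ℓ} → (∀ r → length (Main.comp g s r) ≤ ℓ) → Main.size g s ≤ ℓ
  size-bound g s {ℓ} b = go (Main.verts g s)
    where
    go : ∀ rs → foldr (λ r m → if length (Main.comp g s r) ≤?ᵇ m then m else length (Main.comp g s r)) 0 rs ≤ ℓ
    go [] = z≤n
    go (r ∷ rs) with length (Main.comp g s r) ≤?ᵇ foldr (λ r m → if length (Main.comp g s r) ≤?ᵇ m then m else length (Main.comp g s r)) 0 rs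
    ... | true  = go rs
    ... | false = b r

  -- Two levels above the bound for the radius, as `power≤tower` requires for counting the box.
  budget : ℕ → ℕ → ℕ
  budget k ℓ = tower (2 + suc k * suc ℓ) (suc k * suc ℓ)

  -- Exactly what the time analysis requires of an input. The parameters `k` and `ℓ` do not occur in
  -- the encoding and act only through the measure; `limit` is an arbitrary tree, because its size
  -- is bounded by nothing else and no loop runs over it.
  record Instance : Set where
    field
      graph  : List (List Bool)
      cover  : List Bool
      limit  : Tree
      k ℓ    : ℕ
      graph≤ : μ Graphᵗ graph ≤ suc (length graph) * suc (length graph)
      cover≤ : μ Rowᵗ cover ≤ suc (length graph)
      k≤     : length (Main.cover graph cover) ≤ k
      ℓ≤     : ∀ r → length (Main.comp graph cover r) ≤ ℓ
  open Instance

  Treeᵗ Instanceᵗ : Ty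
  Treeᵗ     = base Tree id (λ _ → 0)
  Instanceᵗ = base Instance (λ i → cons (enc Graphᵗ (graph i)) (cons (enc Rowᵗ (cover i)) (limit i)))
    (λ i → budget (k i) (ℓ i) * suc (length (graph i)))

  module I (i : Instance) = Main (graph i) (cover i)

  tuplesSize-map : ∀ {A B : Set} (f : A → List B) m xs → (∀ x → length (f x) ≡ m) → tuplesSize (map f xs) ≡ suc m ^ length xs
  tuplesSize-map f m []       eq = refl
  tuplesSize-map f m (x ∷ xs) eq = cong₂ (λ a b → suc a * b) (eq x) (tuplesSize-map f m xs eq)

  length-range : ∀ n → length (range n) ≡ n
  length-range zero    = refl
  length-range (suc n) = cong suc (trans (length-map suc (range n)) (length-range n))

  bʰ : Instance → ℕ
  bʰ i = suc (k i) * suc (ℓ i)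

  labels≤ : ∀ i → I.labels i ≤ bʰ i
  labels≤ i = *-mono-≤ (s≤s (k≤ i)) (s≤s (size-bound (graph i) (cover i) (ℓ≤ i)))

  radius≤ : ∀ i → I.radius i ≤ tower (bʰ i) (bʰ i)
  radius≤ i = tower-mono (labels≤ i) (labels≤ i)

  power≤budget : ∀ i {x d} → x ≤ 2 + 2 * tower (bʰ i) (bʰ i) → d ≤ bʰ i → x ^ d ≤ budget (k i) (ℓ i)
  power≤budget i {x} {d} x≤ d≤ = begin
    x ^ d                                     ≤⟨ ^-monoˡ-≤ d x≤ ⟩
    (2 + 2 * tower (bʰ i) (bʰ i)) ^ d         ≤⟨ ^-monoʳ-≤ (2 + 2 * tower (bʰ i) (bʰ i)) d≤ ⟩
    (2 + 2 * tower (bʰ i) (bʰ i)) ^ bʰ i      ≤⟨ power≤tower (bʰ i) (tower (bʰ i) (bʰ i)) (s≤s z≤n)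
                                                   (tower-mono {j = bʰ i} z≤n ≤-refl) ⟩
    budget (k i) (ℓ i)                        ∎
    where open ≤-Reasoning

  budget>0 : ∀ k ℓ → 1 ≤ budget k ℓ
  budget>0 k ℓ = ≤-trans {1} {suc k * suc ℓ} (s≤s z≤n) (tower-mono {j = 2 + suc k * suc ℓ} z≤n ≤-refl)

  O-budget : O Instanceᵗ (λ i → budget (k i) (ℓ i))
  O-budget = O-mono (λ i → m≤m*n (budget (k i) (ℓ i)) (suc (length (graph i)))) O-μ

  O-n : O Instanceᵗ (λ i → suc (length (graph i)))
  O-n = O-mono (λ i → ≤-trans (≤-reflexive (sym (*-identityˡ _))) (*-monoˡ-≤ (suc (length (graph i))) (budget>0 (k i) (ℓ i)))) O-μ

  inputᵖ : PT Instanceᵗ (Graphᵗ ×ᵗ (Rowᵗ ×ᵗ Treeᵗ)) (λ i → graph i , cover i , limit i)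
  inputᵖ = recode _ (λ _ → refl) (O-mono (λ i → +-mono-≤ (graph≤ i) (≤-trans (≤-reflexive (+-identityʳ _)) (cover≤ i)))
    (O-+ (O-* O-n O-n) O-n))

  graphᵖ : PT Instanceᵗ Graphᵗ graph
  graphᵖ = inputᵖ ▸ π₁

  coverᵖ : PT Instanceᵗ Rowᵗ cover
  coverᵖ = inputᵖ ▸ fstᵖ π₂

  limitᵖ : PT Instanceᵗ Treeᵗ limit
  limitᵖ = inputᵖ ▸ sndᵖ π₂

  module _ {i : ⟨ E ⟩ → Instance} (P : PT E Instanceᵗ i) where

    vertsᵖ : PT E (Listᵗ ℕᵗ) (λ e → I.verts (i e))
    vertsᵖ = rangeᵖ (lengthᵖ (P ▸ graphᵖ))

    inCoverᵖ : ∀ {v} → PT E ℕᵗ v → PT E Boolᵗ (λ e → I.inCover (i e) (v e))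
    inCoverᵖ V = nthᵖ (const′ false) (P ▸ coverᵖ) V

    nearᵖ : ∀ {v u} → PT E ℕᵗ v → PT E ℕᵗ u → PT E Boolᵗ (λ e → I.near (i e) (v e) (u e))
    nearᵖ V U = notᵖ (inCoverᵖ U) ∧ᵖ ifᵖ (edgeᵖ (P ▸ graphᵖ) V U) (const′ true) (U ≡ᵖ V)

  repᵖ : ∀ {i v} → PT E Instanceᵗ i → PT E ℕᵗ v → PT E ℕᵗ (λ e → I.rep (i e) (v e))
  repᵖ P V = headOrᵖ V (selectᵖ (vertsᵖ P) (nearᵖ (π₁ ▸ P) (π₁ ▸ V) π₂))

  compᵖ : ∀ {i v} → PT E Instanceᵗ i → PT E ℕᵗ v → PT E (Listᵗ ℕᵗ) (λ e → I.comp (i e) (v e))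
  compᵖ P V = selectᵖ (vertsᵖ P) (notᵖ (inCoverᵖ (π₁ ▸ P) π₂) ∧ᵖ (repᵖ (π₁ ▸ P) π₂ ≡ᵖ (π₁ ▸ V)))

  coverListᵖ : PT Instanceᵗ (Listᵗ ℕᵗ) (λ i → I.cover i)
  coverListᵖ = selectᵖ (vertsᵖ idᵖ) (inCoverᵖ π₁ π₂)

  sizeᵖ : PT Instanceᵗ ℕᵗ (λ i → I.size i)
  sizeᵖ = foldᵖ (vertsᵖ idᵖ) (const′ 0)
    (ifᵖ (lengthᵖ (compᵖ π₁ (fstᵖ π₂)) ≤ᵖ sndᵖ π₂) (sndᵖ π₂) (lengthᵖ (compᵖ π₁ (fstᵖ π₂))))
    O-n λ e ys zs _ → go e zs
    where
    go : ∀ i rs → foldr (λ r m → if length (I.comp i r) ≤?ᵇ m then m else length (I.comp i r)) 0 rs ≤ suc (I.n i)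
    go i [] = z≤n
    go i (r ∷ rs) with length (I.comp i r) ≤?ᵇ foldr (λ r m → if length (I.comp i r) ≤?ᵇ m then m else length (I.comp i r)) 0 rs
    ... | true  = go i rs
    ... | false = ≤-trans (len (I.verts i)) (≤-trans (≤-reflexive (length-range (I.n i))) (n≤1+n _))
      where
      len : ∀ us → length (select (λ u → not (I.inCover i u) ∧ (I.rep i u ≡?ᵇ r)) us) ≤ length us
      len [] = z≤n
      len (u ∷ us) with not (I.inCover i u) ∧ (I.rep i u ≡?ᵇ r)
      ... | true  = s≤s (len us)
      ... | false = ≤-trans (len us) (n≤1+n _)

  labelsᵖ : PT Instanceᵗ ℕᵗ (λ i → I.labels i)
  labelsᵖ = sucᵖ (lengthᵖ coverListᵖ) *ᵖ sucᵖ sizeᵖ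

  radiusᵖ : PT Instanceᵗ ℕᵗ (λ i → I.radius i)
  radiusᵖ = towerᵖ labelsᵖ labelsᵖ O-budget λ i → ≤-trans (radius≤ i)
    (tower-mono {i = bʰ i} (m≤n+m _ 2) ≤-refl)

  keysᵖ : ∀ {i v} → PT E Instanceᵗ i → PT E ℕᵗ v → PT E (Listᵗ Keyᵗ) (λ e → I.keys (i e) (v e))
  keysᵖ P V = mapᵖ (rangeᵖ (P ▸ labelsᵖ)) ((π₁ ▸ V) ,ᵖ ((π₁ ▸ V) +ᵖ ((π₁ ▸ (P ▸ lengthᵖ graphᵖ)) *ᵖ π₂)))

  keysSize : ∀ i vs → length vs ≤ bʰ i → tuplesSize (map (I.keys i) vs) ≤ budget (k i) (ℓ i)
  keysSize i vs vs≤ = ≤-trans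
    (≤-reflexive (tuplesSize-map (I.keys i) (I.labels i) vs λ v → trans (length-map _ (range (I.labels i))) (length-range _)))
    (power≤budget i (≤-trans (s≤s (≤-trans (labels≤ i) (≤-trans (tower-mono {j = bʰ i} z≤n ≤-refl) (m≤m+n _ _)))) (n≤1+n _)) vs≤)

  k≤bʰ : ∀ i → k i ≤ bʰ i
  k≤bʰ i = ≤-trans (n≤1+n _) (m≤m*n (suc (k i)) (suc (ℓ i)))

  ℓ≤bʰ : ∀ i → ℓ i ≤ bʰ i
  ℓ≤bʰ i = ≤-trans (n≤1+n _) (m≤n*m (suc (ℓ i)) (suc (k i)))

  itemsᵖ : PT Instanceᵗ (Listᵗ Itemᵗ) (λ i → I.items i)
  itemsᵖ = mapᵖ (vertsᵖ idᵖ) (tuplesᵖ (mapᵖ (compᵖ π₁ π₂) (keysᵖ (π₁ ▸ π₁) π₂))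
    (O-∘ {Instanceᵗ ×ᵗ ℕᵗ} {Instanceᵗ} {f = proj₁} (size-O π₁) O-budget)
    λ (i , r) → keysSize i (I.comp i r) (≤-trans (ℓ≤ i r) (ℓ≤bʰ i)))

  coversᵖ : PT Instanceᵗ (Listᵗ Asgᵗ) (λ i → I.covers i)
  coversᵖ = tuplesᵖ (mapᵖ coverListᵖ (keysᵖ π₁ π₂)) O-budget λ i → keysSize i (I.cover i) (≤-trans (k≤ i) (k≤bʰ i))

  boxᵖ : PT Instanceᵗ (Listᵗ Asgᵗ) (λ i → I.box i)
  boxᵖ = tuplesᵖ (mapᵖ coverListᵖ (mapᵖ (rangeᵖ (sucᵖ (const′ 2 *ᵖ (π₁ ▸ radiusᵖ)))) ((π₁ ▸ π₂) ,ᵖ π₂))) O-budget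
    λ i → ≤-trans
      (≤-reflexive (tuplesSize-map (I.offsets i) (1 + 2 * I.radius i) (I.cover i)
        λ v → trans (length-map _ (range (1 + 2 * I.radius i))) (length-range _)))
      (power≤budget i (s≤s (s≤s (*-monoʳ-≤ 2 (radius≤ i)))) (≤-trans (k≤ i) (k≤bʰ i)))

  valueᵖ : PT Instanceᵗ ℕᵗ (λ i → I.value i)
  valueᵖ = foldᵖ coversᵖ (lengthᵖ graphᵖ *ᵖ lengthᵖ graphᵖ) (ifᵖ (solve ≤ᵖ sndᵖ π₂) solve (sndᵖ π₂))
    (O-* O-n O-n) λ i ys zs _ → ≤-trans
      (minimum≤ (λ φ → Solver.solve (graph i) φ (I.box i) (I.radius i) (I.items i)) (I.n i * I.n i) zs)
      (*-mono-≤ (n≤1+n (I.n i)) (n≤1+n (I.n i)))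
    where
    solve = solveᵖ (π₁ ▸ graphᵖ) (fstᵖ π₂) (π₁ ▸ boxᵖ) (π₁ ▸ radiusᵖ) (π₁ ▸ itemsᵖ)

-- Merging groups until their effects on every vertex have one sign

module Merging where

  open Routines
  open Procedure

  open import Data.Integer.Base as ℤ using (ℤ; +_; -[1+_]; 0ℤ; 1ℤ)
  import Data.Integer.Properties as ℤₚ
  open import Data.List.Base as List using (List; []; _∷_; _++_; length)
  open import Data.List.Relation.Unary.All as All using (All; []; _∷_)
  import Data.List.Relation.Unary.All.Properties as All
  open import Data.Nat.Base as ℕ using (ℕ; zero; suc; z≤n; s≤s)
  import Data.Nat.Properties as ℕ
  open import Data.Product.Base using (∃; ∃₂; _×_; _,_; proj₁; proj₂)
  open import Data.Sum.Base using (_⊎_; inj₁; inj₂)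
  open import Function.Base using (_∘_)
  open import Relation.Binary.PropositionalEquality hiding ([_])
  open import Relation.Nullary using (yes; no)
  open import Data.Integer.Tactic.RingSolver using (solve-∀)

  Within : ℕ → ℕ → ℤ → Set
  Within b c z = ℤ.- + b ℤ.≤ z × z ℤ.≤ + c

  data Extreme (b c : ℕ) (z : ℤ) : Set where
    lowest  : z ≡ ℤ.- + suc b → Extreme b c z
    highest : z ≡ + suc c → Extreme b c z
    inner   : Within b c z → Extreme b c z

  extreme : ∀ b c {z} → Within (suc b) (suc c) z → Extreme b c z
  extreme b c {z} (lo , hi) with z ℤₚ.≟ ℤ.- + suc b | z ℤₚ.≟ + suc c
  ... | yes p | _     = lowest p
  ... | no _  | yes q = highest q
  ... | no p  | no q  = inner (low b z p lo , high z q hi)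
    where
    high : ∀ z → z ≢ + suc c → z ℤ.≤ + suc c → z ℤ.≤ + c
    high z z≢ z≤ with ℤₚ.i<j⇒i≤pred[j] (ℤₚ.≤∧≢⇒< z≤ z≢)
    ... | le = le
    low : ∀ b z → z ≢ -[1+ b ] → -[1+ b ] ℤ.≤ z → ℤ.- + b ℤ.≤ z
    low zero    z z≢ z≥ = ℤₚ.i<j⇒suc[i]≤j (ℤₚ.≤∧≢⇒< z≥ (≢-sym z≢))
    low (suc b) z z≢ z≥ = ℤₚ.i<j⇒suc[i]≤j (ℤₚ.≤∧≢⇒< z≥ (≢-sym z≢))

  module Merge {A : Set} (_⊕_ : A → A → A) (size : A → ℕ) (size-⊕ : ∀ a b → size (a ⊕ b) ≡ size a ℕ.+ size b) where

    Additive : (A → ℤ) → Set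
    Additive F = ∀ a b → F (a ⊕ b) ≡ F a ℤ.+ F b

    total : (A → ℤ) → List A → ℤ
    total F []       = 0ℤ
    total F (g ∷ gs) = F g ℤ.+ total F gs

    total-++ : ∀ F gs hs → total F (gs ++ hs) ≡ total F gs ℤ.+ total F hs
    total-++ F []       hs = sym (ℤₚ.+-identityˡ _)
    total-++ F (g ∷ gs) hs = trans (cong (λ x → F g ℤ.+ x) (total-++ F gs hs)) (sym (ℤₚ.+-assoc (F g) _ _))

    -- hs arises from gs by merging: additive quantities have the same total,
    -- and properties inherited by merged groups are preserved.
    record Coarser (gs hs : List A) : Set₁ where
      field
        totals : ∀ F → Additive F → total F hs ≡ total F gs
        closed : ∀ (Q : A → Set) → (∀ a b → Q a → Q b → Q (a ⊕ b)) → All Q gs → All Q hs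
    open Coarser

    Coarser-refl : ∀ {gs} → Coarser gs gs
    Coarser-refl = record { totals = λ _ _ → refl ; closed = λ _ _ q → q }

    Coarser-trans : ∀ {fs gs hs} → Coarser fs gs → Coarser gs hs → Coarser fs hs
    Coarser-trans r s = record
      { totals = λ F a → trans (totals s F a) (totals r F a)
      ; closed = λ Q q → closed s Q q ∘ closed r Q q }

    module _ (v : A → ℤ) (v-⊕ : Additive v) (b c s : ℕ) where

      -- Groups in `pend` sit at the extreme `z` and wait for one at the opposite extreme; those in
      -- `done` already lie in the narrower range. A merge joins two groups, which explains the
      -- doubled size.
      Opposite : ℤ → List A → List A → List A → Set₁
      Opposite z gs pend done =
        Coarser gs (pend ++ done) × All (λ g → v g ≡ z × size g ℕ.≤ s) pend ×
        All (λ g → Within b c (v g) × size g ℕ.≤ s ℕ.+ s) done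

      Paired : List A → Set₁
      Paired gs = ∃₂ λ pend done → Opposite (ℤ.- + suc b) gs pend done ⊎ Opposite (+ suc c) gs pend done

      private
        swap : ∀ {gs pend done} g → Coarser gs (pend ++ done) → Coarser (g ∷ gs) (pend ++ g ∷ done)
        swap {gs} {pend} {done} g r = record
          { totals = λ F a → trans (total-++ F pend (g ∷ done)) (trans (lem (total F pend) (F g) (total F done))
              (cong (λ x → F g ℤ.+ x) (trans (sym (total-++ F pend done)) (totals r F a))))
          ; closed = λ { Q q (qg ∷ qs) → let ps = closed r Q q qs in
              All.++⁺ (All.++⁻ˡ pend ps) (qg ∷ All.++⁻ʳ pend ps) } }
          where
          lem : ∀ x y z → x ℤ.+ (y ℤ.+ z) ≡ y ℤ.+ (x ℤ.+ z)
          lem = solve-∀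

        push : ∀ {gs hs} g → Coarser gs hs → Coarser (g ∷ gs) (g ∷ hs)
        push g r = record
          { totals = λ F a → cong (λ x → F g ℤ.+ x) (totals r F a)
          ; closed = λ { Q q (qg ∷ qs) → qg ∷ closed r Q q qs } }

        merge : ∀ {gs pend done} g h → Coarser gs (h ∷ pend ++ done) → Coarser (g ∷ gs) (pend ++ (g ⊕ h) ∷ done)
        merge {gs} {pend} {done} g h r = record
          { totals = λ F a → trans (total-++ F pend (g ⊕ h ∷ done)) (trans
              (trans (cong (λ x → total F pend ℤ.+ (x ℤ.+ total F done)) (a g h)) (lem (total F pend) (F g) (F h) (total F done)))
              (cong (λ x → F g ℤ.+ x) (trans (cong (λ x → F h ℤ.+ x) (sym (total-++ F pend done))) (totals r F a))))
          ; closed = λ { Q q (qg ∷ qs) → case′ Q q qg (closed r Q q qs) } }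
          where
          lem : ∀ x y z w → x ℤ.+ ((y ℤ.+ z) ℤ.+ w) ≡ y ℤ.+ (z ℤ.+ (x ℤ.+ w))
          lem = solve-∀
          case′ : ∀ Q → (∀ a b → Q a → Q b → Q (a ⊕ b)) → Q g → All Q (h ∷ pend ++ done) → All Q (pend ++ (g ⊕ h) ∷ done)
          case′ Q q qg (qh ∷ ps) = All.++⁺ (All.++⁻ˡ pend ps) (q g h qg qh ∷ All.++⁻ʳ pend ps)

        -- The sum is `c - b`, which lies between `- b` and `c`.
        cancel : Within b c (ℤ.- + suc b ℤ.+ + suc c)
        cancel = lo b , hi b c
          where
          lo : ∀ b → ℤ.- + b ℤ.≤ ℤ.- + suc b ℤ.+ + suc c
          lo b = subst (ℤ._≤ ℤ.- + suc b ℤ.+ + suc c) (lem (+ b))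
                   (ℤₚ.+-monoʳ-≤ (ℤ.- + suc b) (ℤ.+≤+ (s≤s (z≤n {c}))))
            where
            lem : ∀ x → ℤ.- (1ℤ ℤ.+ x) ℤ.+ 1ℤ ≡ ℤ.- x
            lem = solve-∀
          hi : ∀ b c → ℤ.- + suc b ℤ.+ + suc c ℤ.≤ + c
          hi b c = subst (ℤ.- + suc b ℤ.+ + suc c ℤ.≤_) (lem (+ c))
                   (ℤₚ.+-monoˡ-≤ (+ suc c) (ℤₚ.neg-mono-≤ (ℤ.+≤+ (s≤s (z≤n {b})))))
            where
            lem : ∀ x → ℤ.- 1ℤ ℤ.+ (1ℤ ℤ.+ x) ≡ x
            lem = solve-∀

        join : ∀ {g h} → v g ℤ.+ v h ≡ ℤ.- + suc b ℤ.+ + suc c → size g ℕ.≤ s → size h ℕ.≤ s →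
               Within b c (v (g ⊕ h)) × size (g ⊕ h) ℕ.≤ s ℕ.+ s
        join {g} {h} eq sg sh =
          subst (Within b c) (sym (trans (v-⊕ g h) eq)) cancel ,
          ℕ.≤-trans (ℕ.≤-reflexive (size-⊕ g h)) (ℕ.+-mono-≤ sg sh)

      -- Merging opposite extremes leaves extremes of one kind only.
      pair : ∀ {gs} → All (λ g → Within (suc b) (suc c) (v g) × size g ℕ.≤ s) gs → Paired gs
      pair [] = [] , [] , inj₁ (Coarser-refl , [] , [])
      pair {g ∷ gs} ((w , sg) ∷ ws) with extreme b c w | pair ws
      ... | inner i | pend , done , inj₁ (r , p , d) =
        pend , g ∷ done , inj₁ (swap {pend = pend} g r , p , (i , ℕ.≤-trans sg (ℕ.m≤m+n s s)) ∷ d)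
      ... | inner i | pend , done , inj₂ (r , p , d) =
        pend , g ∷ done , inj₂ (swap {pend = pend} g r , p , (i , ℕ.≤-trans sg (ℕ.m≤m+n s s)) ∷ d)
      ... | lowest e | pend , done , inj₁ (r , p , d) = g ∷ pend , done , inj₁ (push g r , (e , sg) ∷ p , d)
      ... | highest e | pend , done , inj₂ (r , p , d) = g ∷ pend , done , inj₂ (push g r , (e , sg) ∷ p , d)
      ... | lowest e | [] , done , inj₂ (r , p , d) = g ∷ [] , done , inj₁ (push g r , (e , sg) ∷ [] , d)
      ... | highest e | [] , done , inj₁ (r , p , d) = g ∷ [] , done , inj₂ (push g r , (e , sg) ∷ [] , d)
      ... | lowest e | h ∷ pend , done , inj₂ (r , (e′ , sh) ∷ p , d) =
        pend , (g ⊕ h) ∷ done , inj₂ (merge {pend = pend} g h r , p , join (cong₂ ℤ._+_ e e′) sg sh ∷ d)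
      ... | highest e | h ∷ pend , done , inj₁ (r , (e′ , sh) ∷ p , d) =
        pend , (g ⊕ h) ∷ done , inj₁ (merge {pend = pend} g h r , p ,
          join (trans (cong₂ ℤ._+_ e e′) (ℤₚ.+-comm (+ suc c) (ℤ.- + suc b))) sg sh ∷ d)

    Within-mono : ∀ {b b′ c c′ z} → b ℕ.≤ b′ → c ℕ.≤ c′ → Within b c z → Within b′ c′ z
    Within-mono p q (lo , hi) = ℤₚ.≤-trans (ℤₚ.neg-mono-≤ (ℤ.+≤+ p)) lo , ℤₚ.≤-trans hi (ℤ.+≤+ q)

    total≤0 : ∀ v gs → All (λ g → v g ℤ.≤ 0ℤ) gs → total v gs ℤ.≤ 0ℤ
    total≤0 v []       []       = ℤₚ.≤-refl
    total≤0 v (g ∷ gs) (p ∷ ps) = ℤₚ.+-mono-≤ p (total≤0 v gs ps)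

    all-zero : ∀ v gs → All (λ g → v g ℤ.≤ 0ℤ) gs → 0ℤ ℤ.≤ total v gs → All (λ g → 0ℤ ℤ.≤ v g) gs
    all-zero v []       []       _ = []
    all-zero v (g ∷ gs) (p ∷ ps) t =
      ℤₚ.≤-trans t (ℤₚ.≤-trans (ℤₚ.+-monoʳ-≤ (v g) (total≤0 v gs ps)) (ℤₚ.≤-reflexive (ℤₚ.+-identityʳ _))) ∷
      all-zero v gs ps (ℤₚ.≤-trans t (ℤₚ.≤-trans (ℤₚ.+-monoˡ-≤ (total v gs) p) (ℤₚ.≤-reflexive (ℤₚ.+-identityˡ _))))

    -- After `pair`, extremes of at most one kind remain, so the opposite end of the range can be
    -- moved inwards by one while sizes at most double; this happens at most `b + c` times. If the
    -- lower end reaches 0, all effects are non-negative. If the upper end does, all are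
    -- non-positive with a non-negative total, hence 0.
    refine : ∀ (v : A → ℤ) → Additive v → ∀ b c s gs →
             All (λ g → Within b c (v g) × size g ℕ.≤ s) gs → 0ℤ ℤ.≤ total v gs →
             ∃ λ hs → Coarser gs hs × All (λ g → 0ℤ ℤ.≤ v g × size g ℕ.≤ 2 ℕ.^ (b ℕ.+ c) ℕ.* s) hs
    refine v v-⊕ zero c s gs ws _ = gs , Coarser-refl ,
      All.map (λ ((lo , _) , sg) → lo , ℕ.≤-trans sg (ℕ.m≤n*m s (2 ℕ.^ c) ⦃ ℕ.m^n≢0 2 c ⦄)) ws
    refine v v-⊕ (suc b) zero s gs ws t = gs , Coarser-refl ,
      All.zip (all-zero v gs (All.map (proj₂ ∘ proj₁) ws) t ,
               All.map (λ (_ , sg) → ℕ.≤-trans sg (ℕ.m≤n*m s (2 ℕ.^ (suc b ℕ.+ 0)) ⦃ ℕ.m^n≢0 2 (suc b ℕ.+ 0) ⦄)) ws)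
    refine v v-⊕ (suc b) (suc c) s gs ws t with pair v v-⊕ b c s ws
    ... | pend , done , inj₁ (r , p , d) =
      let hs , r′ , q = refine v v-⊕ (suc b) c (s ℕ.+ s) (pend ++ done)
            (All.++⁺ (All.map (λ (e , sg) → (ℤₚ.≤-reflexive (sym e) , ℤₚ.≤-trans (ℤₚ.≤-reflexive e) ℤ.-≤+) , ℕ.≤-trans sg (ℕ.m≤m+n s s)) p)
                     (All.map (λ (w , sg) → Within-mono (ℕ.n≤1+n b) ℕ.≤-refl w , sg) d))
            (subst (0ℤ ℤ.≤_) (sym (totals r v v-⊕)) t)
      in hs , Coarser-trans r r′ , All.map (λ (z , sg) → z , ℕ.≤-trans sg (ℕ.≤-reflexive (sizes (suc b) c s))) q
      where
      sizes : ∀ b c s → 2 ℕ.^ (b ℕ.+ c) ℕ.* (s ℕ.+ s) ≡ 2 ℕ.^ (b ℕ.+ suc c) ℕ.* s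
      sizes b c s = trans (cong (λ t → 2 ℕ.^ (b ℕ.+ c) ℕ.* (s ℕ.+ t)) (sym (ℕ.+-identityʳ s)))
        (trans (sym (ℕ.*-assoc (2 ℕ.^ (b ℕ.+ c)) 2 s)) (cong (ℕ._* s)
          (trans (ℕ.*-comm (2 ℕ.^ (b ℕ.+ c)) 2) (cong (2 ℕ.^_) (sym (ℕ.+-suc b c))))))
    ... | pend , done , inj₂ (r , p , d) =
      let hs , r′ , q = refine v v-⊕ b (suc c) (s ℕ.+ s) (pend ++ done)
            (All.++⁺ (All.map (λ (e , sg) → (ℤₚ.≤-trans (ℤₚ.neg-mono-≤ (ℤ.+≤+ (z≤n {b}))) (ℤₚ.≤-trans (ℤ.+≤+ z≤n) (ℤₚ.≤-reflexive (sym e))) , ℤₚ.≤-reflexive e) , ℕ.≤-trans sg (ℕ.m≤m+n s s)) p)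
                     (All.map (λ (w , sg) → Within-mono ℕ.≤-refl (ℕ.n≤1+n c) w , sg) d))
            (subst (0ℤ ℤ.≤_) (sym (totals r v v-⊕)) t)
      in hs , Coarser-trans r r′ , All.map (λ (z , sg) → z , ℕ.≤-trans sg (ℕ.≤-reflexive (sizes (b ℕ.+ suc c) s))) q
      where
      sizes : ∀ e s → 2 ℕ.^ e ℕ.* (s ℕ.+ s) ≡ 2 ℕ.^ suc e ℕ.* s
      sizes e s = trans (cong (λ t → 2 ℕ.^ e ℕ.* (s ℕ.+ t)) (sym (ℕ.+-identityʳ s)))
        (trans (sym (ℕ.*-assoc (2 ℕ.^ e) 2 s)) (cong (ℕ._* s) (ℕ.*-comm (2 ℕ.^ e) 2)))

    total-neg : ∀ v gs → total (λ g → ℤ.- v g) gs ≡ ℤ.- total v gs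
    total-neg v []       = refl
    total-neg v (g ∷ gs) = trans (cong (λ x → ℤ.- v g ℤ.+ x) (total-neg v gs)) (sym (ℤₚ.neg-distrib-+ (v g) (total v gs)))

    OneSigned : (A → ℤ) → List A → Set
    OneSigned v gs = All (λ g → 0ℤ ℤ.≤ v g) gs ⊎ All (λ g → 0ℤ ℤ.≤ ℤ.- v g) gs

    module _ {P : Set} (v : P → A → ℤ) (v-⊕ : ∀ p → Additive (v p)) where

      -- Sizes and effects are both additive, so this bound passes to merged groups. Hence the range
      -- for the next vertex is controlled by the current sizes, whatever merging was done before.
      Small : A → P → Set
      Small g p = Within (size g) (size g) (v p g)

      small-⊕ : ∀ p g h → Small g p → Small h p → Small (g ⊕ h) p
      small-⊕ p g h (l , u) (l′ , u′) = subst₂ (λ m z → Within m m z) (sym (size-⊕ g h)) (sym (v-⊕ p g h))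
        ( ℤₚ.≤-trans (ℤₚ.≤-reflexive (ℤₚ.neg-distrib-+ (+ size g) (+ size h))) (ℤₚ.+-mono-≤ l l′)
        , ℤₚ.+-mono-≤ u u′ )

      -- With sizes at most `s` the effects on `p` lie in [-s, s], and `refine` multiplies sizes by
      -- at most 2^(2s), that is, turns `s` into `inflate s`. One-signedness for the earlier
      -- vertices is kept, since numbers of one sign have a sum of that sign.
      conform : ∀ ps D gs → All (λ g → (∀ p → Small g p) × size g ℕ.≤ D) gs →
                ∃ λ hs → Coarser gs hs × All (λ g → size g ℕ.≤ tower (length ps) D) hs × All (λ p → OneSigned (v p) hs) ps
      conform []       D gs ok = gs , Coarser-refl , All.map proj₂ ok , []
      conform (p ∷ ps) D gs ok with conform ps D gs ok
      ... | hs , r , hs≤ , signed = choose (ℤₚ.≤-total 0ℤ (total (v p) hs))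
        where
        s = tower (length ps) D
        small : All (λ g → Small g p) hs
        small = closed r (λ g → Small g p) (small-⊕ p) (All.map (λ ok → proj₁ ok p) ok)
        within : All (λ g → Within s s (v p g) × size g ℕ.≤ s) hs
        within = All.zip (All.zipWith (λ (w , g≤) → Within-mono g≤ g≤ w) (small , hs≤) , hs≤)
        negate : ∀ {b c z} → Within b c z → Within c b (ℤ.- z)
        negate {b} (lo , hi) = ℤₚ.neg-mono-≤ hi , ℤₚ.≤-trans (ℤₚ.neg-mono-≤ lo) (ℤₚ.≤-reflexive (ℤₚ.neg-involutive (+ b)))
        neg-⊕ : Additive (λ g → ℤ.- v p g)
        neg-⊕ g h = trans (cong ℤ.-_ (v-⊕ p g h)) (ℤₚ.neg-distrib-+ (v p g) (v p h))
        grow : ∀ {m} → m ℕ.≤ 2 ℕ.^ (s ℕ.+ s) ℕ.* s → m ℕ.≤ inflate s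
        grow m≤ = ℕ.≤-trans m≤ (ℕ.≤-reflexive (trans (cong (ℕ._* s) (trans
          (cong (λ t → 2 ℕ.^ (s ℕ.+ t)) (sym (ℕ.+-identityʳ s))) (sym (ℕ.^-*-assoc 2 2 s)))) (sym (inflate≡ s))))
        keep : ∀ {hs′} → Coarser hs hs′ → All (λ q → OneSigned (v q) hs′) ps
        keep r′ = All.map (λ {q} → λ
          { (inj₁ pos) → inj₁ (closed r′ _ (λ a b x y → subst (0ℤ ℤ.≤_) (sym (v-⊕ q a b)) (ℤₚ.+-mono-≤ x y)) pos)
          ; (inj₂ neg) → inj₂ (closed r′ _ (λ a b x y → subst (0ℤ ℤ.≤_) (sym (trans (cong ℤ.-_ (v-⊕ q a b)) (ℤₚ.neg-distrib-+ (v q a) (v q b)))) (ℤₚ.+-mono-≤ x y)) neg) }) signed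
        -- The sign of the total is the only sign that all groups could share; a non-positive total
        -- is treated by negating the effects.
        choose : 0ℤ ℤ.≤ total (v p) hs ⊎ total (v p) hs ℤ.≤ 0ℤ →
                 ∃ λ hs′ → Coarser gs hs′ × All (λ g → size g ℕ.≤ inflate s) hs′ × All (λ q → OneSigned (v q) hs′) (p ∷ ps)
        choose (inj₁ t) with refine (v p) (v-⊕ p) s s s hs within t
        ... | hs′ , r′ , q = hs′ , Coarser-trans r r′ , All.map (grow ∘ proj₂) q , inj₁ (All.map proj₁ q) ∷ keep r′
        choose (inj₂ t) with refine (λ g → ℤ.- v p g) neg-⊕ s s s hs (All.map (λ (w , g≤) → negate w , g≤) within)
                               (subst (0ℤ ℤ.≤_) (sym (total-neg (v p) hs)) (ℤₚ.neg-mono-≤ t))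
        ... | hs′ , r′ , q = hs′ , Coarser-trans r r′ , All.map (grow ∘ proj₂) q , inj₂ (All.map proj₁ q) ∷ keep r′

-- An improving group of few components

module Augmentation where

  open Routines
  open Procedure
  open Merging
  open import Data.Integer.Base as ℤ using (ℤ; +_; 0ℤ; 1ℤ)
  import Data.Integer.Properties as ℤₚ
  open import Data.Fin.Base using (Fin; zero; suc)
  open import Data.List.Base as List using (List; []; _∷_; length)
  open import Data.List.Membership.Propositional using (_∈_)
  open import Data.List.Relation.Unary.All as All using (All; []; _∷_)
  import Data.List.Relation.Unary.All.Properties as All
  open import Data.List.Relation.Unary.Any using (here; there)
  open import Data.Nat.Base as ℕ using (ℕ; zero; suc; z≤n)
  import Data.Nat.Properties as ℕ
  open import Data.Product.Base using (∃; _×_; _,_)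
  open import Data.Sum.Base using (inj₁; inj₂)
  open import Data.Vec.Base as Vec using (Vec; []; _∷_; zipWith; lookup; replicate)
  open import Data.Vec.Properties using (lookup-zipWith; lookup-replicate)
  import Data.Vec.Relation.Unary.All as VAll
  open import Function.Base using (_∘_)
  open import Relation.Binary.PropositionalEquality hiding ([_])
  open import Relation.Nullary using (yes; no)
  open import Data.Integer.Tactic.RingSolver using (solve-∀)

  infix 7 _·_
  _·_ : ∀ {m} → Vec ℕ m → Vec ℤ m → ℤ
  []      · []      = 0ℤ
  (a ∷ g) · (x ∷ w) = + a ℤ.* x ℤ.+ g · w

  -- A group of components is represented by its indicator vector, so merging disjoint groups is
  -- addition and effects become scalar products.
  _⊕_ : ∀ {m} → Vec ℕ m → Vec ℕ m → Vec ℕ m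
  _⊕_ = zipWith ℕ._+_

  ·-⊕ : ∀ {m} (w : Vec ℤ m) g h → (g ⊕ h) · w ≡ g · w ℤ.+ h · w
  ·-⊕ []      []      []      = refl
  ·-⊕ (x ∷ w) (a ∷ g) (b ∷ h) = trans (cong (λ z → + (a ℕ.+ b) ℤ.* x ℤ.+ z) (·-⊕ w g h))
    (lem (+ a) (+ b) x (g · w) (h · w))
    where
    lem : ∀ a b x y z → (a ℤ.+ b) ℤ.* x ℤ.+ (y ℤ.+ z) ≡ (a ℤ.* x ℤ.+ y) ℤ.+ (b ℤ.* x ℤ.+ z)
    lem = solve-∀

  -- `D` times the number of components in the group. As `D` bounds the effect of a single
  -- component, the weight bounds the effect of the group and can serve as its size.
  weight : ∀ {m} → ℕ → Vec ℕ m → ℕ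
  weight D g = Vec.foldr′ (λ a s → a ℕ.* D ℕ.+ s) 0 g

  weight-⊕ : ∀ {m} D (g h : Vec ℕ m) → weight D (g ⊕ h) ≡ weight D g ℕ.+ weight D h
  weight-⊕ D []      []      = refl
  weight-⊕ D (a ∷ g) (b ∷ h) = begin
    (a ℕ.+ b) ℕ.* D ℕ.+ weight D (g ⊕ h)               ≡⟨ cong₂ ℕ._+_ (ℕ.*-distribʳ-+ D a b) (weight-⊕ D g h) ⟩
    (a ℕ.* D ℕ.+ b ℕ.* D) ℕ.+ (weight D g ℕ.+ weight D h) ≡⟨ swap (a ℕ.* D) (b ℕ.* D) (weight D g) (weight D h) ⟩
    (a ℕ.* D ℕ.+ weight D g) ℕ.+ (b ℕ.* D ℕ.+ weight D h) ∎
    where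
    open ≡-Reasoning
    swap : ∀ p q r s → (p ℕ.+ q) ℕ.+ (r ℕ.+ s) ≡ (p ℕ.+ r) ℕ.+ (q ℕ.+ s)
    swap p q r s = trans (ℕ.+-assoc p q (r ℕ.+ s)) (trans (cong (p ℕ.+_) (trans (sym (ℕ.+-assoc q r s))
      (trans (cong (ℕ._+ s) (ℕ.+-comm q r)) (ℕ.+-assoc r q s)))) (sym (ℕ.+-assoc p r (q ℕ.+ s))))

  zeros ones : ∀ {m} → Vec ℕ m
  zeros = replicate _ 0
  ones  = replicate _ 1

  units : ∀ m → List (Vec ℕ m)
  units zero    = []
  units (suc m) = (1 ∷ zeros) ∷ List.map (0 ∷_) (units m)

  zeros-· : ∀ {m} (w : Vec ℤ m) → zeros · w ≡ 0ℤ
  zeros-· []      = refl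
  zeros-· (x ∷ w) = trans (cong (λ z → 0ℤ ℤ.* x ℤ.+ z) (zeros-· w)) (lem x)
    where
    lem : ∀ x → 0ℤ ℤ.* x ℤ.+ 0ℤ ≡ 0ℤ
    lem = solve-∀

  weight-zeros : ∀ m D → weight D (zeros {m}) ≡ 0
  weight-zeros zero    D = refl
  weight-zeros (suc m) D = weight-zeros m D

  ·-within : ∀ {m D} {w : Vec ℤ m} → VAll.All (Within D D) w → ∀ g → Within (weight D g) (weight D g) (g · w)
  ·-within VAll.[] [] = ℤₚ.≤-refl , ℤₚ.≤-refl
  ·-within {D = D} {x ∷ w} (p VAll.∷ ps) (a ∷ g) =
    add (scale a p) (·-within ps g)
    where
    add : ∀ {b c y z} → Within b b y → Within c c z → Within (b ℕ.+ c) (b ℕ.+ c) (y ℤ.+ z)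
    add {b} {c} (l , u) (l′ , u′) =
      ℤₚ.≤-trans (ℤₚ.≤-reflexive (ℤₚ.neg-distrib-+ (+ b) (+ c))) (ℤₚ.+-mono-≤ l l′) , ℤₚ.+-mono-≤ u u′
    scale : ∀ a → Within D D x → Within (a ℕ.* D) (a ℕ.* D) (+ a ℤ.* x)
    scale zero    _ = ℤₚ.≤-reflexive (sym (ℤₚ.*-zeroˡ x)) , ℤₚ.≤-reflexive (ℤₚ.*-zeroˡ x)
    scale (suc a) p = subst (Within (suc a ℕ.* D) (suc a ℕ.* D)) (lem (+ a) x) (add {D} {a ℕ.* D} p (scale a p))
      where
      lem : ∀ a x → x ℤ.+ a ℤ.* x ≡ (1ℤ ℤ.+ a) ℤ.* x
      lem = solve-∀

  module _ {m : ℕ} {P : Set} (D : ℕ) (e : Vec ℤ m) (d : P → Vec ℤ m) (ψ : P → ℤ → ℤ)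
           (small : ∀ p → VAll.All (Within D D) (d p))
           (ψ-zero : ∀ p → ψ p 0ℤ ≡ 0ℤ)
           (super⁺ : ∀ p x y → 0ℤ ℤ.≤ x → 0ℤ ℤ.≤ y → ψ p x ℤ.+ ψ p y ℤ.≤ ψ p (x ℤ.+ y))
           (super⁻ : ∀ p x y → 0ℤ ℤ.≤ ℤ.- x → 0ℤ ℤ.≤ ℤ.- y → ψ p x ℤ.+ ψ p y ℤ.≤ ψ p (x ℤ.+ y)) where

    open Merge (_⊕_ {m}) (weight D) (weight-⊕ D)
    open Coarser

    gain : List P → Vec ℕ m → ℤ
    gain []       g = g · e
    gain (p ∷ ps) g = ψ p (g · d p) ℤ.+ gain ps g

    private
      nonneg-total : ∀ v gs → All (λ g → 0ℤ ℤ.≤ v g) gs → 0ℤ ℤ.≤ total v gs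
      nonneg-total v []       []       = ℤₚ.≤-refl
      nonneg-total v (g ∷ gs) (p ∷ ps) = ℤₚ.+-mono-≤ p (nonneg-total v gs ps)

      superadditive : ∀ p v gs → OneSigned v gs → total (ψ p ∘ v) gs ℤ.≤ ψ p (total v gs)
      superadditive p v []       s = ℤₚ.≤-reflexive (sym (ψ-zero p))
      superadditive p v (g ∷ gs) (inj₁ (s ∷ ss)) = ℤₚ.≤-trans
        (ℤₚ.+-monoʳ-≤ (ψ p (v g)) (superadditive p v gs (inj₁ ss)))
        (super⁺ p _ _ s (nonneg-total v gs ss))
      superadditive p v (g ∷ gs) (inj₂ (s ∷ ss)) = ℤₚ.≤-trans
        (ℤₚ.+-monoʳ-≤ (ψ p (v g)) (superadditive p v gs (inj₂ ss)))
        (super⁻ p _ _ s (subst (0ℤ ℤ.≤_) (total-neg v gs) (nonneg-total (λ g → ℤ.- v g) gs ss)))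

      total-+ : ∀ u v gs → total (λ g → u g ℤ.+ v g) gs ≡ total u gs ℤ.+ total v gs
      total-+ u v []       = refl
      total-+ u v (g ∷ gs) = trans (cong (λ z → u g ℤ.+ v g ℤ.+ z) (total-+ u v gs)) (lem (u g) (v g) (total u gs) (total v gs))
        where
        lem : ∀ a b c d → a ℤ.+ b ℤ.+ (c ℤ.+ d) ≡ (a ℤ.+ c) ℤ.+ (b ℤ.+ d)
        lem = solve-∀

      negative : ∀ v gs → total v gs ℤ.< 0ℤ → ∃ λ g → g ∈ gs × v g ℤ.< 0ℤ
      negative v []       (ℤ.+<+ ())
      negative v (g ∷ gs) t with v g ℤₚ.<? 0ℤ
      ... | yes q = g , here refl , q
      ... | no ¬q with negative v gs (ℤₚ.≤-<-trans (ℤₚ.≤-trans (ℤₚ.≤-reflexive (sym (ℤₚ.+-identityˡ _)))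
                         (ℤₚ.+-monoˡ-≤ (total v gs) (ℤₚ.≮⇒≥ ¬q))) t)
      ...   | h , h∈ , q = h , there h∈ , q

      -- The linear part is additive and each `ψ p` is superadditive over groups of one sign.
      -- Carried out separately, the groups gain in total no more than together; if the joint change
      -- is negative, one of them is negative by itself.
      gain-total : ∀ ps gs → All (λ p → OneSigned (λ g → g · d p) gs) ps →
                   (∀ p → total (λ g → g · d p) gs ≡ ones · d p) → total (λ g → g · e) gs ≡ ones · e →
                   total (gain ps) gs ℤ.≤ gain ps ones
      gain-total []       gs []       td te = ℤₚ.≤-reflexive te
      gain-total (p ∷ ps) gs (s ∷ ss) td te = ℤₚ.≤-trans
        (ℤₚ.≤-reflexive (total-+ (λ g → ψ p (g · d p)) (gain ps) gs))
        (ℤₚ.+-mono-≤ (ℤₚ.≤-trans (superadditive p (λ g → g · d p) gs s) (ℤₚ.≤-reflexive (cong (ψ p) (td p))))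
                     (gain-total ps gs ss td te))

    private
      -- Inductions over `units` change the length of the vectors, whereas the opened `total` is
      -- tied to length `m`.
      total′ : ∀ {k} → (Vec ℕ k → ℤ) → List (Vec ℕ k) → ℤ
      total′ {k} = Merge.total (_⊕_ {k}) (weight D) (weight-⊕ D)

      total-cong : ∀ {k} {u v : Vec ℕ k → ℤ} → (∀ g → u g ≡ v g) → ∀ gs → total′ u gs ≡ total′ v gs
      total-cong eq []       = refl
      total-cong eq (g ∷ gs) = cong₂ ℤ._+_ (eq g) (total-cong eq gs)

      total-map′ : ∀ {k l} (f : Vec ℕ k → Vec ℕ l) F gs → total′ F (List.map f gs) ≡ total′ (F ∘ f) gs
      total-map′ f F []       = refl
      total-map′ f F (g ∷ gs) = cong (λ z → F (f g) ℤ.+ z) (total-map′ f F gs)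

      units-· : ∀ {k} (w : Vec ℤ k) → total′ (_· w) (units k) ≡ ones · w
      units-· []      = refl
      units-· {suc k} (x ∷ w) = cong₂ ℤ._+_ (trans (cong (λ z → 1ℤ ℤ.* x ℤ.+ z) (zeros-· w)) (ℤₚ.+-identityʳ (1ℤ ℤ.* x)))
        (trans (total-map′ (0 ∷_) (_· (x ∷ w)) (units k))
          (trans (total-cong (λ g → trans (cong (λ z → z ℤ.+ g · w) (ℤₚ.*-zeroˡ x)) (ℤₚ.+-identityˡ _)) (units k)) (units-· w)))

      zero-total : ∀ {k} (gs : List (Vec ℕ k)) → total′ (λ _ → 0ℤ) gs ≡ 0ℤ
      zero-total []       = refl
      zero-total (_ ∷ gs) = trans (ℤₚ.+-identityˡ _) (zero-total gs)

      units-lookup : ∀ {k} (i : Fin k) → total′ (λ g → + lookup g i) (units k) ≡ 1ℤ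
      units-lookup {suc k} zero    = trans (cong (λ z → 1ℤ ℤ.+ z) (trans (total-map′ (0 ∷_) (λ g → + lookup g zero) (units k)) (zero-total (units k)))) refl
      units-lookup {suc k} (suc i) = trans (cong₂ ℤ._+_ (cong +_ (lookup-replicate i 0))
        (trans (total-map′ (0 ∷_) (λ g → + lookup g (suc i)) (units k)) (units-lookup i))) refl

      units-weight : ∀ k → All (λ g → weight D g ℕ.≤ D) (units k)
      units-weight zero    = []
      units-weight (suc k) = ℕ.≤-reflexive (trans (cong (1 ℕ.* D ℕ.+_) (weight-zeros k D)) (trans (ℕ.+-identityʳ _) (ℕ.*-identityˡ D))) ∷
        All.map⁺ (units-weight k)

      member≤total : ∀ (v : Vec ℕ m → ℕ) {g gs} → g ∈ gs → + v g ℤ.≤ total (λ g → + v g) gs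
      member≤total v {g} {_ ∷ gs} (here refl) = ℤₚ.≤-trans (ℤₚ.≤-reflexive (sym (ℤₚ.+-identityʳ _)))
        (ℤₚ.+-monoʳ-≤ (+ v g) (nonneg-total (λ g → + v g) gs (All.universal (λ _ → ℤ.+≤+ z≤n) gs)))
      member≤total v {g} {h ∷ gs} (there g∈) = ℤₚ.≤-trans (member≤total v g∈) (ℤₚ.≤-trans
        (ℤₚ.≤-reflexive (sym (ℤₚ.+-identityˡ (total (λ g → + v g) gs))))
        (ℤₚ.+-monoˡ-≤ (total (λ g → + v g) gs) (ℤ.+≤+ (z≤n {v h}))))

    local-gain : ∀ ps → gain ps ones ℤ.< 0ℤ →
      ∃ λ g → (∀ i → lookup g i ℕ.≤ 1) × weight D g ℕ.≤ tower (length ps) D × gain ps g ℤ.< 0ℤ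
    local-gain ps neg with conform (λ p g → g · d p) (λ p → ·-⊕ (d p)) ps D (units m)
                             (All.map (λ {g} w≤ → (λ p → ·-within (small p) g) , w≤) (units-weight m))
    ... | hs , r , w≤ , signed
      with negative (gain ps) hs (ℤₚ.≤-<-trans (gain-total ps hs signed
             (λ p → trans (totals r (_· d p) (·-⊕ (d p))) (units-· (d p)))
             (trans (totals r (_· e) (·-⊕ e)) (units-· e))) neg)
    ... | g , g∈ , q = g
      -- The entries at component `i` add up to 1 over the unit vectors and hence over the merged
      -- groups, so no group contains a component twice.
      , (λ i → ℤₚ.drop‿+≤+ (ℤₚ.≤-trans (member≤total (λ g → lookup g i) g∈) (ℤₚ.≤-reflexive
          (trans (totals r (λ g → + lookup g i) (λ a b → cong +_ (lookup-zipWith ℕ._+_ i a b))) (units-lookup i)))))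
      , All.lookup w≤ g∈ , q

-- The dynamic program finds the improvement, and the local search ends at an optimum

module Optimality where

  open Routines
  open LocalSearch
  open Procedure
  open Merging
  open Augmentation
  open import Data.Bool.Base using (Bool; true; false; if_then_else_; _∧_)

  open import Data.Integer.Base as ℤ using (ℤ; +_; -[1+_]; 0ℤ; 1ℤ; ∣_∣)
  import Data.Integer.Properties as ℤₚ
  open import Data.Fin.Base using (zero; suc)
  open import Data.List.Base as List using (List; []; _∷_; _++_; length; map)
  open import Data.List.Membership.Propositional using (_∈_)
  open import Data.List.Membership.Propositional.Properties using (∈-map⁺; ∈-map⁻; ∈-concat⁺′)
  open import Data.List.Relation.Unary.All as All using (All; []; _∷_)
  import Data.List.Relation.Unary.All.Properties as All
  open import Data.List.Relation.Unary.Any using (here; there)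
  open import Data.Nat.Base as ℕ using (ℕ; zero; suc; _+_; _*_; _∸_; _≤_; _<_; z≤n; s≤s; ∣_-_∣)

  open import Data.Nat.Properties
  open import Data.Product.Base using (∃; _×_; _,_; proj₁; proj₂)
  open import Data.Sum.Base using (_⊎_; inj₁; inj₂)
  open import Data.Vec.Base as Vec using (Vec; []; _∷_; lookup)
  import Data.Vec.Relation.Unary.All as VAll
  open import Function.Base using (_∘_; id)
  open import Relation.Binary.PropositionalEquality hiding ([_])
  open import Relation.Nullary using (yes; no)
  open import Data.Integer.Tactic.RingSolver using (solve-∀)

  ∣⊖∣ : ∀ m n → ∣ + m ℤ.- + n ∣ ≡ ∣ m - n ∣
  ∣⊖∣ m n = trans (cong ∣_∣ (ℤₚ.m-n≡m⊖n m n)) (go m n)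
    where
    go : ∀ m n → ∣ m ℤ.⊖ n ∣ ≡ ∣ m - n ∣
    go zero    zero    = refl
    go zero    (suc n) = refl
    go (suc m) zero    = refl
    go (suc m) (suc n) = trans (cong ∣_∣ (ℤₚ.[1+m]⊖[1+n]≡m⊖n m n)) (go m n)

  ∣∣-shift : ∀ z n → 0ℤ ℤ.≤ z → ∣ z ℤ.+ + n ∣ ≡ ∣ z ∣ + n
  ∣∣-shift (+ m) n _ = refl

  -- This is convexity of the absolute value. If `a + m` is non-negative, adding `n` moves it away
  -- from 0 by exactly `n`, and the triangle inequality handles `a + n`; if it is non-positive,
  -- removing `m` moves it away from 0 by exactly `m`.
  abs-superadditive : ∀ a m n → ∣ a ℤ.+ + m ∣ + ∣ a ℤ.+ + n ∣ ≤ ∣ a ∣ + ∣ a ℤ.+ (+ m ℤ.+ + n) ∣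
  abs-superadditive a m n with ℤₚ.≤-total 0ℤ (a ℤ.+ + m)
  ... | inj₁ p = begin
    ∣ a ℤ.+ + m ∣ + ∣ a ℤ.+ + n ∣   ≤⟨ +-monoʳ-≤ ∣ a ℤ.+ + m ∣ (ℤₚ.∣i+j∣≤∣i∣+∣j∣ a (+ n)) ⟩
    ∣ a ℤ.+ + m ∣ + (∣ a ∣ + n)     ≡⟨ trans (sym (+-assoc _ ∣ a ∣ n)) (trans (cong (_+ n) (+-comm _ ∣ a ∣)) (+-assoc ∣ a ∣ _ n)) ⟩
    ∣ a ∣ + (∣ a ℤ.+ + m ∣ + n)     ≡⟨ cong (λ w → ∣ a ∣ + w) (∣∣-shift (a ℤ.+ + m) n p) ⟨
    ∣ a ∣ + ∣ a ℤ.+ + m ℤ.+ + n ∣   ≡⟨ cong (λ z → ∣ a ∣ + ∣ z ∣) (ℤₚ.+-assoc a (+ m) (+ n)) ⟩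
    ∣ a ∣ + ∣ a ℤ.+ (+ m ℤ.+ + n) ∣ ∎
    where open ≤-Reasoning
  ... | inj₂ p = begin
    ∣ a ℤ.+ + m ∣ + ∣ a ℤ.+ + n ∣                   ≤⟨ +-monoʳ-≤ ∣ a ℤ.+ + m ∣ tri ⟩
    ∣ a ℤ.+ + m ∣ + (m + ∣ a ℤ.+ (+ m ℤ.+ + n) ∣)   ≡⟨ +-assoc ∣ a ℤ.+ + m ∣ m _ ⟨
    ∣ a ℤ.+ + m ∣ + m + ∣ a ℤ.+ (+ m ℤ.+ + n) ∣     ≡⟨ cong (_+ ∣ a ℤ.+ (+ m ℤ.+ + n) ∣) shift ⟩
    ∣ a ∣ + ∣ a ℤ.+ (+ m ℤ.+ + n) ∣                 ∎
    where
    open ≤-Reasoning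
    l₁ : ∀ a m n → a ℤ.+ n ≡ (ℤ.- m) ℤ.+ (a ℤ.+ (m ℤ.+ n))
    l₁ = solve-∀
    l₂ : ∀ a m → ℤ.- (a ℤ.+ m) ℤ.+ m ≡ ℤ.- a
    l₂ = solve-∀
    tri : ∣ a ℤ.+ + n ∣ ≤ m + ∣ a ℤ.+ (+ m ℤ.+ + n) ∣
    tri = ≤-trans (≤-reflexive (cong ∣_∣ (l₁ a (+ m) (+ n)))) (≤-trans (ℤₚ.∣i+j∣≤∣i∣+∣j∣ (ℤ.- + m) _)
            (≤-reflexive (cong (_+ ∣ a ℤ.+ (+ m ℤ.+ + n) ∣) (ℤₚ.∣-i∣≡∣i∣ (+ m)))))
    shift : ∣ a ℤ.+ + m ∣ + m ≡ ∣ a ∣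
    shift = trans (cong (_+ m) (sym (ℤₚ.∣-i∣≡∣i∣ (a ℤ.+ + m)))) (trans
      (sym (∣∣-shift (ℤ.- (a ℤ.+ + m)) m (ℤₚ.neg-mono-≤ p)))
      (trans (cong ∣_∣ (l₂ a (+ m))) (ℤₚ.∣-i∣≡∣i∣ a)))

  -- The argument is doubled because one more neighbour on the left means one fewer on the right.
  excess : ℤ → ℤ → ℤ
  excess a x = + ∣ a ℤ.+ (x ℤ.+ x) ∣ ℤ.- + ∣ a ∣

  excess-zero : ∀ a → excess a 0ℤ ≡ 0ℤ
  excess-zero a = trans (cong (λ z → + ∣ z ∣ ℤ.- + ∣ a ∣) (ℤₚ.+-identityʳ a)) (ℤₚ.+-inverseʳ (+ ∣ a ∣))

  private
    excess-super : ∀ a m n → excess a (+ m) ℤ.+ excess a (+ n) ℤ.≤ excess a (+ m ℤ.+ + n)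
    excess-super a m n = begin
      excess a (+ m) ℤ.+ excess a (+ n)                                      ≡⟨ l₁ (+ ∣ a ℤ.+ (+ m ℤ.+ + m) ∣) (+ ∣ a ℤ.+ (+ n ℤ.+ + n) ∣) (+ ∣ a ∣) ⟩
      (+ ∣ a ℤ.+ (+ m ℤ.+ + m) ∣ ℤ.+ + ∣ a ℤ.+ (+ n ℤ.+ + n) ∣) ℤ.- (+ ∣ a ∣ ℤ.+ + ∣ a ∣) ≤⟨ ℤₚ.+-monoˡ-≤ (ℤ.- (+ ∣ a ∣ ℤ.+ + ∣ a ∣)) (ℤ.+≤+ (abs-superadditive a (m + m) (n + n))) ⟩
      (+ ∣ a ∣ ℤ.+ + ∣ a ℤ.+ ((+ m ℤ.+ + m) ℤ.+ (+ n ℤ.+ + n)) ∣) ℤ.- (+ ∣ a ∣ ℤ.+ + ∣ a ∣) ≡⟨ l₂ (+ ∣ a ∣) (+ ∣ a ℤ.+ ((+ m ℤ.+ + m) ℤ.+ (+ n ℤ.+ + n)) ∣) ⟩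
      + ∣ a ℤ.+ ((+ m ℤ.+ + m) ℤ.+ (+ n ℤ.+ + n)) ∣ ℤ.- + ∣ a ∣              ≡⟨ cong (λ z → + ∣ a ℤ.+ z ∣ ℤ.- + ∣ a ∣) (l₃ (+ m) (+ n)) ⟩
      excess a (+ m ℤ.+ + n)                                                 ∎
      where
      open ℤₚ.≤-Reasoning
      l₁ : ∀ x y z → (x ℤ.- z) ℤ.+ (y ℤ.- z) ≡ (x ℤ.+ y) ℤ.- (z ℤ.+ z)
      l₁ = solve-∀
      l₂ : ∀ z x → (z ℤ.+ x) ℤ.- (z ℤ.+ z) ≡ x ℤ.- z
      l₂ = solve-∀
      l₃ : ∀ x y → (x ℤ.+ x) ℤ.+ (y ℤ.+ y) ≡ (x ℤ.+ y) ℤ.+ (x ℤ.+ y)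
      l₃ = solve-∀

  excess⁺ : ∀ a x y → 0ℤ ℤ.≤ x → 0ℤ ℤ.≤ y → excess a x ℤ.+ excess a y ℤ.≤ excess a (x ℤ.+ y)
  excess⁺ a (+ m) (+ n) _ _ = excess-super a m n

  excess-neg : ∀ a x → excess (ℤ.- a) (ℤ.- x) ≡ excess a x
  excess-neg a x = cong₂ (λ u v → + u ℤ.- + v)
    (trans (cong ∣_∣ (lem a x)) (ℤₚ.∣-i∣≡∣i∣ (a ℤ.+ (x ℤ.+ x)))) (ℤₚ.∣-i∣≡∣i∣ a)
    where
    lem : ∀ a x → ℤ.- a ℤ.+ (ℤ.- x ℤ.+ ℤ.- x) ≡ ℤ.- (a ℤ.+ (x ℤ.+ x))
    lem = solve-∀

  excess⁻ : ∀ a x y → 0ℤ ℤ.≤ ℤ.- x → 0ℤ ℤ.≤ ℤ.- y → excess a x ℤ.+ excess a y ℤ.≤ excess a (x ℤ.+ y)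
  excess⁻ a x y p q = subst₂ ℤ._≤_ (cong₂ ℤ._+_ (excess-neg a x) (excess-neg a y))
    (trans (cong (excess (ℤ.- a)) (sym (ℤₚ.neg-distrib-+ x y))) (excess-neg a (x ℤ.+ y)))
    (excess⁺ (ℤ.- a) (ℤ.- x) (ℤ.- y) p q)

  left-++ : ∀ g A B p → left g (A ++ B) p ≡ left g A p + left g B p
  left-++ g []            B p       = refl
  left-++ g ((u , κ′) ∷ A) B (v , κ) = trans (cong (λ x → (if edge g v u ∧ (suc κ′ ≤?ᵇ κ) then 1 else 0) + x) (left-++ g A B (v , κ)))
    (sym (+-assoc (if edge g v u ∧ (suc κ′ ≤?ᵇ κ) then 1 else 0) _ _))

  left≤length : ∀ g A p → left g A p ≤ length A
  left≤length g []             p       = z≤n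
  left≤length g ((u , κ′) ∷ A) (v , κ) with edge g v u ∧ (suc κ′ ≤?ᵇ κ)
  ... | true  = s≤s (left≤length g A (v , κ))
  ... | false = ≤-trans (left≤length g A (v , κ)) (n≤1+n _)

  Options : ℕ → Sol → Set
  Options D = All (λ (it , _) → All (λ ψ → length ψ ≤ D) it)

  Fits-options : ∀ {D c s} → Fits c s → Options D c → Options D s
  Fits-options []      []       = []
  Fits-options (_ ∷ f) (o ∷ os) = o ∷ Fits-options f os

  Fits-self : ∀ {c s} → Fits c s → Fits s s
  Fits-self []      = []
  Fits-self (x ∷ f) = x ∷ Fits-self f

  Fits-swap : ∀ {c s t} → Fits c s → Fits c t → Fits s t
  Fits-swap []      []      = []
  Fits-swap (_ ∷ f) (y ∷ h) = y ∷ Fits-swap f h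

  within⇒∣∣ : ∀ {R z} → Within R R z → ∣ z ∣ ≤ R
  within⇒∣∣ {R} {+ n}      (_ , hi) = ℤₚ.drop‿+≤+ hi
  within⇒∣∣ {suc R} { -[1+ n ]} (ℤ.-≤- n≤ , _) = s≤s n≤

  module Optimal (g : List (List Bool)) (φ : Asg) (box : List Asg) (R : ℕ) where
    open Solver g φ box R

    -- Switches from `c` to `y` on the components of the group. Every positive entry counts as one
    -- switch, so the additive formulas are stated for `0/1` vectors.
    mix : ∀ {c y} → Fits c y → Vec ℕ (length c) → Sol
    mix []                       []          = []
    mix (_∷_ {it} {x} {ψ} _ f) (zero ∷ γ)  = (it , x) ∷ mix f γ
    mix (_∷_ {it} {x} {ψ} _ f) (suc _ ∷ γ) = (it , ψ) ∷ mix f γ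

    cost : Asg → ℕ
    cost ψ = imb g ψ (ψ ++ φ)

    Δcost : ∀ {c y} → Fits c y → Vec ℤ (length c)
    Δcost []                    = []
    Δcost (_∷_ {_} {x} {ψ} _ f) = (+ cost ψ ℤ.- + cost x) ∷ Δcost f

    Δleft : ∀ {c y} → Fits c y → Key → Vec ℤ (length c)
    Δleft []                    p = []
    Δleft (_∷_ {_} {x} {ψ} _ f) p = (+ left g ψ p ℤ.- + left g x p) ∷ Δleft f p

    0/1 : ∀ {m} → Vec ℕ m → Set
    0/1 γ = ∀ i → lookup γ i ≤ 1

    mix-ones : ∀ {c y} (f : Fits c y) → mix f ones ≡ y
    mix-ones []      = refl
    mix-ones (_ ∷ f) = cong (_ ∷_) (mix-ones f)

    mix-fits : ∀ {c y} → Fits c c → (f : Fits c y) (γ : Vec ℕ (length c)) → Fits c (mix f γ)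
    mix-fits []      []      []          = []
    mix-fits (x ∷ h) (y ∷ f) (zero ∷ γ)  = x ∷ mix-fits h f γ
    mix-fits (x ∷ h) (y ∷ f) (suc _ ∷ γ) = y ∷ mix-fits h f γ

    private
      keep : ∀ a b x w → b ℤ.+ w ≡ x → a ℤ.+ b ℤ.+ (0ℤ ℤ.+ w) ≡ a ℤ.+ x
      keep a b x w refl = lem a b w
        where
        lem : ∀ a b w → a ℤ.+ b ℤ.+ (0ℤ ℤ.+ w) ≡ a ℤ.+ (b ℤ.+ w)
        lem = solve-∀
      move : ∀ a a′ b x w → b ℤ.+ w ≡ x → a ℤ.+ b ℤ.+ (1ℤ ℤ.* (a′ ℤ.- a) ℤ.+ w) ≡ a′ ℤ.+ x
      move a a′ b x w refl = lem a a′ b w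
        where
        lem : ∀ a a′ b w → a ℤ.+ b ℤ.+ (1ℤ ℤ.* (a′ ℤ.- a) ℤ.+ w) ≡ a′ ℤ.+ (b ℤ.+ w)
        lem = solve-∀

    mix-lin : ∀ {c y} (f : Fits c y) γ → 0/1 γ → + lin c ℤ.+ γ · Δcost f ≡ + lin (mix f γ)
    mix-lin []      []          _ = refl
    mix-lin {(_ , x) ∷ c} (_∷_ {ψ = ψ} _ f) (zero ∷ γ) b = trans
      (cong (λ z → + cost x ℤ.+ + lin c ℤ.+ (z ℤ.+ γ · Δcost f)) (ℤₚ.*-zeroˡ (+ cost ψ ℤ.- + cost x)))
      (keep (+ cost x) (+ lin c) _ (γ · Δcost f) (mix-lin f γ (b ∘ suc)))
    mix-lin {(_ , x) ∷ c} (_∷_ {ψ = ψ} _ f) (suc zero ∷ γ) b =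
      move (+ cost x) (+ cost ψ) (+ lin c) _ (γ · Δcost f) (mix-lin f γ (b ∘ suc))
    mix-lin (_ ∷ f) (suc (suc a) ∷ γ) b with b zero
    ... | s≤s ()

    mix-left : ∀ {c y} (f : Fits c y) γ → 0/1 γ → ∀ p → + left g (asg c) p ℤ.+ γ · Δleft f p ≡ + left g (asg (mix f γ)) p
    mix-left []      []          _ p = refl
    mix-left {(_ , x) ∷ c} (_∷_ {ψ = ψ} _ f) (zero ∷ γ) b p = begin
      + left g (x ++ asg c) p ℤ.+ (0ℤ ℤ.* Δ ℤ.+ γ · Δleft f p)            ≡⟨ cong₂ (λ u z → + u ℤ.+ (z ℤ.+ γ · Δleft f p)) (left-++ g x (asg c) p) (ℤₚ.*-zeroˡ Δ) ⟩
      + left g x p ℤ.+ + left g (asg c) p ℤ.+ (0ℤ ℤ.+ γ · Δleft f p)      ≡⟨ keep (+ left g x p) (+ left g (asg c) p) _ (γ · Δleft f p) (mix-left f γ (b ∘ suc) p) ⟩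
      + (left g x p + left g (asg (mix f γ)) p)                          ≡⟨ cong +_ (left-++ g x (asg (mix f γ)) p) ⟨
      + left g (x ++ asg (mix f γ)) p                                    ∎
      where
      open ≡-Reasoning
      Δ = + left g ψ p ℤ.- + left g x p
    mix-left {(_ , x) ∷ c} (_∷_ {ψ = ψ} _ f) (suc zero ∷ γ) b p = begin
      + left g (x ++ asg c) p ℤ.+ (1ℤ ℤ.* Δ ℤ.+ γ · Δleft f p)            ≡⟨ cong (λ u → + u ℤ.+ (1ℤ ℤ.* Δ ℤ.+ γ · Δleft f p)) (left-++ g x (asg c) p) ⟩
      + left g x p ℤ.+ + left g (asg c) p ℤ.+ (1ℤ ℤ.* Δ ℤ.+ γ · Δleft f p) ≡⟨ move (+ left g x p) (+ left g ψ p) (+ left g (asg c) p) _ (γ · Δleft f p) (mix-left f γ (b ∘ suc) p) ⟩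
      + (left g ψ p + left g (asg (mix f γ)) p)                          ≡⟨ cong +_ (left-++ g ψ (asg (mix f γ)) p) ⟨
      + left g (ψ ++ asg (mix f γ)) p                                    ∎
      where
      open ≡-Reasoning
      Δ = + left g ψ p ℤ.- + left g x p
    mix-left (_ ∷ f) (suc (suc a) ∷ γ) b p with b zero
    ... | s≤s ()

    Δleft-small : ∀ {D c y} → Options D c → Fits c c → (f : Fits c y) → ∀ p → VAll.All (Within D D) (Δleft f p)
    Δleft-small []       []        []       p = VAll.[]
    Δleft-small {D} (o ∷ os) (_∷_ {x = x} x∈ h) (_∷_ {ψ = ψ} ψ∈ f) p =
      diff (≤-trans (left≤length g ψ p) (All.lookup o ψ∈)) (≤-trans (left≤length g x p) (All.lookup o x∈))
      VAll.∷ Δleft-small os h f p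
      where
      diff : ∀ {a b} → a ≤ D → b ≤ D → Within D D (+ a ℤ.- + b)
      diff {a} {b} a≤ b≤ =
        ℤₚ.≤-trans (ℤₚ.neg-mono-≤ (ℤ.+≤+ b≤)) (ℤₚ.≤-trans (ℤₚ.≤-reflexive (sym (ℤₚ.+-identityˡ (ℤ.- + b)))) (ℤₚ.+-monoˡ-≤ (ℤ.- + b) (ℤ.+≤+ z≤n)))
        , ℤₚ.≤-trans (ℤₚ.i-j≤i (+ a) (+ b)) (ℤ.+≤+ a≤)

    -- The signed imbalance of a cover vertex, split into a part fixed by `φ` and the doubled count
    -- that the components contribute.
    offset : Sol → Key → ℤ
    offset s p = + (2 * left g φ p) ℤ.- + deg g (proj₁ p) ℤ.+ (+ left g (asg s) p ℤ.+ + left g (asg s) p)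

    dev≡ : ∀ s p → dev g (φ ++ asg s) p ≡ ∣ offset s p ∣
    dev≡ s p = trans (sym (∣⊖∣ (2 * left g (φ ++ asg s) p) (deg g (proj₁ p)))) (cong ∣_∣
      (trans (cong (λ l → + (2 * l) ℤ.- + deg g (proj₁ p)) (left-++ g φ (asg s) p))
        (trans (cong (λ z → + z ℤ.- + deg g (proj₁ p)) (trans (*-distribˡ-+ 2 (left g φ p) l) (cong (λ w → 2 * left g φ p + w) (cong (λ w → l + w) (+-identityʳ l)))))
          (lem (+ (2 * left g φ p)) (+ l) (+ deg g (proj₁ p))))))
      where
      l = left g (asg s) p
      lem : ∀ a l d → a ℤ.+ (l ℤ.+ l) ℤ.- d ≡ a ℤ.- d ℤ.+ (l ℤ.+ l)
      lem = solve-∀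

    module _ {c y : Sol} (D : ℕ) (os : Options D c) (h : Fits c c) (f : Fits c y) where

      change : List Key → Vec ℕ (length c) → ℤ
      change = gain D (Δcost f) (Δleft f) (λ p → excess (offset c p)) (Δleft-small os h f)
        (λ p → excess-zero (offset c p)) (λ p → excess⁺ (offset c p)) (λ p → excess⁻ (offset c p))

      local-change : ∀ ps → change ps ones ℤ.< 0ℤ →
        ∃ λ γ → 0/1 γ × weight D γ ≤ tower (length ps) D × change ps γ ℤ.< 0ℤ
      local-change = local-gain D (Δcost f) (Δleft f) (λ p → excess (offset c p)) (Δleft-small os h f)
        (λ p → excess-zero (offset c p)) (λ p → excess⁺ (offset c p)) (λ p → excess⁻ (offset c p))

      change≡ : ∀ γ → 0/1 γ → ∀ ps →
        + (lin c + imb g ps (φ ++ asg c)) ℤ.+ change ps γ ≡ + (lin (mix f γ) + imb g ps (φ ++ asg (mix f γ)))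
      change≡ γ b [] = trans (cong (λ z → + z ℤ.+ γ · Δcost f) (+-identityʳ (lin c)))
        (trans (mix-lin f γ b) (cong +_ (sym (+-identityʳ (lin (mix f γ))))))
      change≡ γ b (p ∷ ps) = begin
        + (lin c + (dev g (φ ++ asg c) p + I)) ℤ.+ (excess (offset c p) (γ · Δleft f p) ℤ.+ change ps γ)
          ≡⟨ cong (λ d → + (lin c + (d + I)) ℤ.+ (excess (offset c p) (γ · Δleft f p) ℤ.+ change ps γ)) (dev≡ c p) ⟩
        (+ lin c ℤ.+ (o ℤ.+ + I)) ℤ.+ ((n ℤ.- o) ℤ.+ change ps γ)
          ≡⟨ lem (+ lin c) o (+ I) n (change ps γ) ⟩
        n ℤ.+ (+ (lin c + I) ℤ.+ change ps γ)
          ≡⟨ cong₂ ℤ._+_ (cong +_ (trans (cong ∣_∣ off) (sym (dev≡ (mix f γ) p)))) (change≡ γ b ps) ⟩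
        + (dev g (φ ++ asg (mix f γ)) p + (lin (mix f γ) + imb g ps (φ ++ asg (mix f γ))))
          ≡⟨ cong +_ (swap (dev g (φ ++ asg (mix f γ)) p) (lin (mix f γ)) (imb g ps (φ ++ asg (mix f γ)))) ⟩
        + (lin (mix f γ) + imb g (p ∷ ps) (φ ++ asg (mix f γ))) ∎
        where
        open ≡-Reasoning
        I = imb g ps (φ ++ asg c)
        o = + ∣ offset c p ∣
        n = + ∣ offset c p ℤ.+ (γ · Δleft f p ℤ.+ γ · Δleft f p) ∣
        lem : ∀ l o i n c → (l ℤ.+ (o ℤ.+ i)) ℤ.+ ((n ℤ.- o) ℤ.+ c) ≡ n ℤ.+ ((l ℤ.+ i) ℤ.+ c)
        lem = solve-∀
        swap : ∀ d l i → d + (l + i) ≡ l + (d + i)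
        swap d l i = trans (sym (+-assoc d l i)) (trans (cong (_+ i) (+-comm d l)) (+-assoc l d i))
        lem₂ : ∀ a l x → a ℤ.+ (l ℤ.+ l) ℤ.+ (x ℤ.+ x) ≡ a ℤ.+ ((l ℤ.+ x) ℤ.+ (l ℤ.+ x))
        lem₂ = solve-∀
        off : offset c p ℤ.+ (γ · Δleft f p ℤ.+ γ · Δleft f p) ≡ offset (mix f γ) p
        off = trans (lem₂ (+ (2 * left g φ p) ℤ.- + deg g (proj₁ p)) (+ left g (asg c) p) (γ · Δleft f p))
          (cong (λ l → + (2 * left g φ p) ℤ.- + deg g (proj₁ p) ℤ.+ (l ℤ.+ l)) (mix-left f γ b p))

    -- The bound is imposed on every suffix and not only on the whole solution, because the table is
    -- pruned after each component.
    data Close : Sol → Sol → Set where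
      []  : Close [] []
      _∷_ : ∀ {i j c z} → (∀ p → ∣ left g (asg (i ∷ c)) p - left g (asg (j ∷ z)) p ∣ ≤ R) → Close c z → Close (i ∷ c) (j ∷ z)

    -- A suffix of a group has at most the weight of the group, and effects are bounded by weights.
    -- So a group of weight at most `R` never leaves the box on the way.
    mix-close : ∀ {D c y} → Options D c → Fits c c → (f : Fits c y) → ∀ γ → 0/1 γ → weight D γ ≤ R → Close c (mix f γ)
    mix-close os h [] [] b w = []
    mix-close {D} {c} (o ∷ os) h′@(x ∷ h) f′@(y ∷ f) (a ∷ γ) b w = go a refl
      where
      close : ∀ p → ∣ left g (asg c) p - left g (asg (mix f′ (a ∷ γ))) p ∣ ≤ R
      close p = begin
        ∣ l - left g (asg (mix f′ (a ∷ γ))) p ∣          ≡⟨ ∣⊖∣ l (left g (asg (mix f′ (a ∷ γ))) p) ⟨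
        ∣ + l ℤ.- + left g (asg (mix f′ (a ∷ γ))) p ∣    ≡⟨ cong (λ z → ∣ + l ℤ.- z ∣) (mix-left f′ (a ∷ γ) b p) ⟨
        ∣ + l ℤ.- (+ l ℤ.+ d) ∣                               ≡⟨ trans (cong ∣_∣ (lem (+ l) d)) (ℤₚ.∣-i∣≡∣i∣ d) ⟩
        ∣ d ∣                                                 ≤⟨ within⇒∣∣ (·-within (Δleft-small (o ∷ os) h′ f′ p) (a ∷ γ)) ⟩
        weight D (a ∷ γ)                                      ≤⟨ w ⟩
        R                                                     ∎
        where
        open ≤-Reasoning
        l = left g (asg c) p
        d = (a ∷ γ) · Δleft f′ p
        lem : ∀ l d → l ℤ.- (l ℤ.+ d) ≡ ℤ.- d
        lem = solve-∀
      go : ∀ k → a ≡ k → Close c (mix f′ (a ∷ γ))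
      go zero          refl = close ∷ mix-close os h f γ (b ∘ suc) w
      go (suc zero)    refl = close ∷ mix-close os h f γ (b ∘ suc) (≤-trans (m≤n+m (weight D γ) (1 * D)) w)
      go (suc (suc _)) refl with b zero
      ... | s≤s ()

  ∈-select⁺ : ∀ {A : Set} (p : A → Bool) {x xs} → x ∈ xs → p x ≡ true → x ∈ select p xs
  ∈-select⁺ p {xs = y ∷ _} (here refl) eq with p y
  ∈-select⁺ p (here refl) refl | true = here refl
  ∈-select⁺ p {xs = y ∷ _} (there x∈) eq with p y
  ... | true  = there (∈-select⁺ p x∈ eq)
  ... | false = ∈-select⁺ p x∈ eq

  select-sound : ∀ {A : Set} (p : A → Bool) xs → All (λ x → p x ≡ true) (select p xs)
  select-sound p []       = []
  select-sound p (x ∷ xs) with p x in eq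
  ... | true  = eq ∷ select-sound p xs
  ... | false = select-sound p xs

  every⁺ : ∀ {A : Set} (p : A → Bool) xs → (∀ x → x ∈ xs → p x ≡ true) → every p xs ≡ true
  every⁺ p []       _ = refl
  every⁺ p (x ∷ xs) h with p x | h x (here refl)
  ... | true | _ = every⁺ p xs (λ y y∈ → h y (there y∈))

  every⁻ : ∀ {A : Set} (p : A → Bool) {xs} → every p xs ≡ true → ∀ {x} → x ∈ xs → p x ≡ true
  every⁻ p {y ∷ xs} eq x∈ with p y in py
  every⁻ p {y ∷ xs} eq (here refl) | true = py
  every⁻ p {y ∷ xs} eq (there x∈)  | true = every⁻ p eq x∈

  argmin≤d : ∀ {A : Set} (key : A → ℕ) d xs → key (argmin key d xs) ≤ key d
  argmin≤d key d []       = ≤-refl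
  argmin≤d key d (x ∷ xs) with key x ≤?ᵇ key (argmin key d xs) in eq
  ... | true  = ≤-trans (≤?ᵇ-sound eq) (argmin≤d key d xs)
  ... | false = argmin≤d key d xs

  argmin≤ : ∀ {A : Set} (key : A → ℕ) d {x xs} → x ∈ xs → key (argmin key d xs) ≤ key x
  argmin≤ key d {xs = y ∷ xs} x∈ with key y ≤?ᵇ key (argmin key d xs) in eq
  argmin≤ key d (here refl) | true  = ≤-refl
  argmin≤ key d (there x∈)  | true  = ≤-trans (≤?ᵇ-sound eq) (argmin≤ key d x∈)
  argmin≤ key d (here refl) | false = <⇒≤ (≤?ᵇ-false eq)
  argmin≤ key d (there x∈)  | false = argmin≤ key d x∈

  best≤ : ∀ {A : Set} (key : A → ℕ) {x xs} → x ∈ xs → ∃ λ b → b ∈ best key xs × key b ≤ key x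
  best≤ key {xs = y ∷ xs} x∈ = argmin key y (y ∷ xs) , here refl , argmin≤ key y x∈

  module _ (g : List (List Bool)) (φ : Asg) (box : List Asg) (R : ℕ) where
    open Solver g φ box R

    start-fits : ∀ {is} → All (λ it → headOr [] it ∈ it) is → Fits (start is) (start is)
    start-fits []       = []
    start-fits (x ∷ xs) = x ∷ start-fits xs

    final-fits : ∀ is → All (λ it → headOr [] it ∈ it) is → Fits (start is) (final is)
    final-fits is ne = proj₁ (repeat-fits g φ box R (Fits (start is)) (start is) (start-fits ne) id (obj (start is)))

  Keyed : (ℕ → ℕ) → List ℕ → Asg
  Keyed K = map (λ v → v , K v)

  module Search (g : List (List Bool)) (φ : Asg) (box : List Asg) (R : ℕ) (S : List ℕ) (K : ℕ → ℕ)
                (φ≡ : φ ≡ Keyed K S)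
                (box∋ : ∀ (off : ℕ → ℕ) → (∀ {s : ℕ} → s ∈ S → off s ≤ 2 * R) → Keyed off S ∈ box) where
    open Solver g φ box R
    open Optimal g φ box R

    Same : Sol → Sol → Set
    Same s t = ∀ {p} → p ∈ φ → left g (asg s) p ≡ left g (asg t) p

    -- `s` matches the vector of its own effects, so the solution kept for this vector is at most as
    -- expensive; matching the same vector, it has the same effects.
    prune-complete : ∀ c T {s} → s ∈ T → (∀ {p} → p ∈ φ → ∣ left g (asg c) p - left g (asg s) p ∣ ≤ R) →
                     ∃ λ t → t ∈ prune c T × lin t ≤ lin s × Same t s
    prune-complete c T {s} s∈ close = t , ∈-concat⁺′ t∈ (∈-map⁺ (λ v → best lin (select (λ s → match c s v) T)) v∈) , t≤ , same
      where
      off : ℕ → ℕ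
      -- The effect of `s` relative to `c`, shifted by `R`. Closeness makes the truncated
      -- subtraction exact (`c≤`) and keeps the result within `2 * R` (`off≤`).
      off x = R + left g (asg s) (x , K x) ∸ left g (asg c) (x , K x)
      c≤ : ∀ {p} → p ∈ φ → left g (asg c) p ≤ R + left g (asg s) p
      c≤ {p} p∈ = ≤-trans (m≤n+∣m-n∣ (left g (asg c) p) (left g (asg s) p)) (≤-trans (+-monoʳ-≤ (left g (asg s) p) (close p∈)) (≤-reflexive (+-comm _ R)))
      key∈ : ∀ {x} → x ∈ S → (x , K x) ∈ φ
      key∈ x∈ = subst (_ ∈_) (sym φ≡) (∈-map⁺ (λ x → x , K x) x∈)
      off≤ : ∀ {x} → x ∈ S → off x ≤ 2 * R
      off≤ {x} x∈ = ≤-trans (∸-monoˡ-≤ (left g (asg c) p) (+-monoʳ-≤ R (≤-trans (m≤n+∣n-m∣ (left g (asg s) p) (left g (asg c) p)) (+-monoʳ-≤ (left g (asg c) p) (close (key∈ x∈))))))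
        (≤-reflexive (trans (cong (_∸ left g (asg c) p) (swap R (left g (asg c) p) R)) (trans (m+n∸m≡n (left g (asg c) p) (R + R)) (cong (λ w → R + w) (sym (+-identityʳ R))))))
        where
        p = x , K x
        swap : ∀ a b c → a + (b + c) ≡ b + (a + c)
        swap a b c = trans (sym (+-assoc a b c)) (trans (cong (_+ c) (+-comm a b)) (+-assoc b a c))
      v = map (λ x → x , off x) S
      v∈ = box∋ off off≤
      spec : Asg → Sol → ℕ × ℕ → Key → Bool
      spec _ z b p = if proj₁ b ≡?ᵇ proj₁ p then proj₂ b + left g (asg c) p ≡?ᵇ R + left g (asg z) p else true
      ok : ∀ b → b ∈ v → every (spec v s b) φ ≡ true
      ok b b∈ with ∈-map⁻ (λ x → x , off x) b∈
      ... | x , _ , refl = every⁺ (spec v s (x , off x)) φ go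
        where
        go : ∀ p → p ∈ φ → spec v s (x , off x) p ≡ true
        go p p∈ with ∈-map⁻ (λ s → s , K s) (subst (p ∈_) φ≡ p∈)
        ... | y , _ , refl with x ≡?ᵇ y in eq
        ...   | false = refl
        ...   | true with ≡?ᵇ-sound {x} {y} eq
        ...     | refl = ≡?ᵇ-complete (m∸n+n≡m (c≤ p∈))
      matched : match c s v ≡ true
      matched = every⁺ (λ b → every (spec v s b) φ) v ok
      found = best≤ lin (∈-select⁺ (λ s → match c s v) s∈ matched)
      t  = proj₁ found
      t∈ = proj₁ (proj₂ found)
      t≤ = proj₂ (proj₂ found)
      t-match : match c t v ≡ true
      t-match = All.lookup (All-best lin (select-sound (λ s → match c s v) T)) t∈
      balance : ∀ z → match c z v ≡ true → ∀ {x} → x ∈ S → off x + left g (asg c) (x , K x) ≡ R + left g (asg z) (x , K x)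
      balance z mz {x} x∈ with x ≡?ᵇ x | ≡?ᵇ-complete {x} refl
        | every⁻ (spec v z (x , off x)) (every⁻ (λ b → every (spec v z b) φ) mz (∈-map⁺ (λ x → x , off x) x∈))
                  (key∈ x∈)
      ... | true | _ | e = ≡?ᵇ-sound e
      same : Same t s
      same {p} p∈ with ∈-map⁻ (λ s → s , K s) (subst (p ∈_) φ≡ p∈)
      ... | x , x∈ , refl = +-cancelˡ-≡ R _ _ (trans (sym (balance t t-match x∈)) (balance s matched x∈))

    -- An exchange argument: the tail of `z` is replaced by the kept solution `w`. The cost of the
    -- head option depends on nothing in the tail, and `w` has the same left counts as the tail, so
    -- the extended solution is no dearer than `z` and is still close to `c`.
    dp-complete : ∀ {c z} → Fits c z → Close c z → ∃ λ t → t ∈ proj₁ (dp c) × lin t ≤ lin z × Same t z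
    dp-complete [] [] = [] , here refl , ≤-refl , λ _ → refl
    dp-complete {(it , x) ∷ c} {(_ , ψ) ∷ z} (ψ∈ ∷ f) (close ∷ cl) =
      proj₁ kept , proj₁ (proj₂ kept) , ≤-trans (proj₁ (proj₂ (proj₂ kept))) (+-monoʳ-≤ (cost ψ) w≤) ,
      λ {p} p∈ → trans (proj₂ (proj₂ (proj₂ kept)) p∈) (glue p∈)
      where
      rest = dp-complete f cl
      w  = proj₁ rest
      w≤ = proj₁ (proj₂ (proj₂ rest))
      glue : ∀ {p} → p ∈ φ → left g (asg ((it , ψ) ∷ w)) p ≡ left g (asg ((it , ψ) ∷ z)) p
      glue {p} p∈ = trans (left-++ g ψ (asg w) p)
        (trans (cong (λ l → left g ψ p + l) (proj₂ (proj₂ (proj₂ rest)) p∈)) (sym (left-++ g ψ (asg z) p)))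
      near : ∀ {p} → p ∈ φ → ∣ left g (asg ((it , x) ∷ proj₂ (dp c))) p - left g (asg ((it , ψ) ∷ w)) p ∣ ≤ R
      near {p} p∈ = subst₂ (λ d l → ∣ left g (asg ((it , x) ∷ d)) p - l ∣ ≤ R)
        (sym (dp-second g φ box R c)) (sym (glue p∈)) (close p)
      kept = prune-complete ((it , x) ∷ proj₂ (dp c)) (extend it (proj₁ (dp c))) {(it , ψ) ∷ w}
        (∈-concat⁺′ (∈-map⁺ ((it , ψ) ∷_) (proj₁ (proj₂ rest))) (∈-map⁺ (λ ψ → map ((it , ψ) ∷_) (proj₁ (dp c))) ψ∈)) near

    Same-imb : ∀ {s t} → Same s t → imb g φ (φ ++ asg s) ≡ imb g φ (φ ++ asg t)
    Same-imb {s} {t} same = go φ same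
      where
      go : ∀ ps → (∀ {p} → p ∈ ps → left g (asg s) p ≡ left g (asg t) p) → imb g ps (φ ++ asg s) ≡ imb g ps (φ ++ asg t)
      go []       _ = refl
      go (p ∷ ps) h = cong₂ _+_
        (cong (λ l → ∣ 2 * l - deg g (proj₁ p) ∣) (trans (left-++ g φ (asg s) p)
          (trans (cong (λ l → left g φ p + l) (h (here refl))) (sym (left-++ g φ (asg t) p)))))
        (go ps (λ p∈ → h (there p∈)))

    module _ (D : ℕ) (D≤ : tower (length φ) D ≤ R) where

      improve-decreases : ∀ {c y} → Options D c → Fits c c → Fits c y → obj y < obj c → obj (improve c) < obj c
      improve-decreases {c} {y} os h f y<c = found (local-change D os h f φ gain<0)
        where
        as-sum : ∀ γ → 0/1 γ → + obj c ℤ.+ change D os h f φ γ ≡ + obj (mix f γ)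
        as-sum γ b = change≡ D os h f γ b φ
        cancel : ∀ {z} → + obj c ℤ.+ z ℤ.< + obj c → z ℤ.< 0ℤ
        cancel {z} lt = ℤₚ.≰⇒> λ 0≤z → ℤₚ.<⇒≱ lt (ℤₚ.≤-trans (ℤₚ.≤-reflexive (sym (ℤₚ.+-identityʳ (+ obj c)))) (ℤₚ.+-monoʳ-≤ (+ obj c) 0≤z))
        ones≤1 : ∀ {m} → 0/1 (ones {m})
        ones≤1 {suc m} zero    = ≤-refl
        ones≤1 {suc m} (suc i) = ones≤1 i
        gain<0 : change D os h f φ ones ℤ.< 0ℤ
        -- Mixing with the vector of ones gives `y`, so the joint change is the negative difference
        -- of the two objectives.
        gain<0 = cancel (subst (ℤ._< + obj c) (sym (trans (as-sum ones ones≤1) (cong (λ s → + obj s) (mix-ones f)))) (ℤ.+<+ y<c))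
        found : (∃ λ γ → 0/1 γ × weight D γ ≤ tower (length φ) D × change D os h f φ γ ℤ.< 0ℤ) →
                obj (improve c) < obj c
        found (γ , b , w , neg) = ≤-<-trans (argmin≤ obj c t∈) (≤-<-trans
          (+-mono-≤ t≤ (≤-reflexive (Same-imb {proj₁ kept} {mix f γ} (proj₂ (proj₂ (proj₂ kept))))))
          (ℤₚ.drop‿+<+ (subst₂ ℤ._<_ (as-sum γ b) (ℤₚ.+-identityʳ (+ obj c)) (ℤₚ.+-monoʳ-< (+ obj c) neg))))
          where
          kept = dp-complete (mix-fits h f γ) (mix-close os h f γ b (≤-trans w D≤))
          t∈ = proj₁ (proj₂ kept)
          t≤ = proj₁ (proj₂ (proj₂ kept))

      module _ (items : List Item) (short : All (All (λ ψ → length ψ ≤ D)) items)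
               (nonempty : All (λ it → headOr [] it ∈ it) items) where

        x₀ : Sol
        x₀ = start items

        fits : ∀ i → Fits x₀ (repeat improve x₀ i)
        fits i = proj₁ (repeat-fits g φ box R (Fits x₀) x₀ (start-fits g φ box R nonempty) id i)

        -- The competitor `y` is fixed. Once an iterate is as good as `y` it stays so, because
        -- `improve` has the current solution as its default; until then every round gains at least
        -- 1.
        progress : ∀ {y} → Fits x₀ y → ∀ i → obj (repeat improve x₀ i) ≤ obj y ⊎ obj (repeat improve x₀ i) + i ≤ obj x₀
        progress fy zero    = inj₂ (≤-reflexive (+-identityʳ _))
        progress {y} fy (suc i) with progress fy i | obj (repeat improve x₀ i) ≤? obj y
        ... | inj₁ le | _      = inj₁ (≤-trans (argmin≤d obj (repeat improve x₀ i) (proj₁ (dp (repeat improve x₀ i)))) le)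
        ... | inj₂ _  | yes le = inj₁ (≤-trans (argmin≤d obj (repeat improve x₀ i) (proj₁ (dp (repeat improve x₀ i)))) le)
        ... | inj₂ p  | no ¬le = inj₂ (≤-trans (≤-reflexive (+-suc _ i)) (≤-trans (+-monoˡ-≤ i
                (improve-decreases (Fits-options (fits i) (All.map⁺ short)) (Fits-self (fits i)) (Fits-swap (fits i) fy) (≰⇒> ¬le))) p))

        solve-optimal : ∀ {y} → Fits x₀ y → solve items ≤ obj y
        solve-optimal fy with progress fy (obj x₀)
        ... | inj₁ le = le
        -- A loss of at least `obj x₀` within `obj x₀` rounds leaves an objective of 0.
        ... | inj₂ p  = ≤-trans (≤-trans (m+n≤o⇒m≤o∸n (solve items) p) (≤-reflexive (n∸n≡0 (obj x₀)))) z≤n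

-- Solutions as labellings of all vertices

module Labellings where

  open Routines
  open LocalSearch
  open Procedure
  open Optimality
  open import Data.Bool.Base using (Bool; true; false; if_then_else_; _∧_; not)
  open import Data.List.Base as List using (List; []; _∷_; _++_; foldr; length; map; concat)
  open import Data.List.Membership.Propositional using (_∈_)
  open import Data.List.Membership.Propositional.Properties using (∈-map⁺; ∈-map⁻; ∈-concat⁺′; ∈-concat⁻′)
  open import Data.List.Properties using (map-cong-local; map-∘; length-map)
  open import Data.List.Relation.Unary.All as All using (All; []; _∷_)
  import Data.List.Relation.Unary.All.Properties as All
  open import Data.List.Relation.Unary.AllPairs using ([]; _∷_)
  open import Data.List.Relation.Unary.Any using (here; there)
  open import Data.List.Relation.Unary.Unique.Propositional using (Unique)
  import Data.List.Relation.Unary.Unique.Propositional.Properties as Unique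
  open import Data.Nat.Base as ℕ using (ℕ; zero; suc; _+_; _*_; _≤_; _<_; z≤n; s≤s; ∣_-_∣)
  open import Data.Nat.ListAction using (sum)
  open import Data.Nat.Properties
  open import Data.Product.Base using (∃; _×_; _,_; proj₁; proj₂)
  open import Data.Sum.Base using (_⊎_; inj₁; inj₂)
  open import Function.Base using (_∘_; id)
  open import Relation.Binary.PropositionalEquality hiding ([_])
  open import Relation.Nullary using (contradiction)

  Σ[_] : ∀ {A : Set} → List A → (A → ℕ) → ℕ
  Σ[ xs ] f = sum (map f xs)

  module _ {A : Set} where

    Σ-cong : ∀ {f h : A → ℕ} xs → (∀ {x} → x ∈ xs → f x ≡ h x) → Σ[ xs ] f ≡ Σ[ xs ] h
    Σ-cong []       eq = refl
    Σ-cong (x ∷ xs) eq = cong₂ _+_ (eq (here refl)) (Σ-cong xs (eq ∘ there))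

    +-swap : ∀ a b c d → (a + b) + (c + d) ≡ (a + c) + (b + d)
    +-swap a b c d = trans (+-assoc a b (c + d)) (trans (cong (a +_) (trans (sym (+-assoc b c d))
      (trans (cong (_+ d) (+-comm b c)) (+-assoc c b d)))) (sym (+-assoc a c (b + d))))

    Σ-+ : ∀ (f h : A → ℕ) xs → Σ[ xs ] (λ x → f x + h x) ≡ Σ[ xs ] f + Σ[ xs ] h
    Σ-+ f h []       = refl
    Σ-+ f h (x ∷ xs) = trans (cong (f x + h x +_) (Σ-+ f h xs)) (+-swap (f x) (h x) _ _)

    Σ-zero : ∀ (xs : List A) → Σ[ xs ] (λ _ → 0) ≡ 0
    Σ-zero []       = refl
    Σ-zero (_ ∷ xs) = Σ-zero xs

    Σ-select : ∀ (p : A → Bool) f xs → Σ[ select p xs ] f ≡ Σ[ xs ] (λ x → if p x then f x else 0)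
    Σ-select p f []       = refl
    Σ-select p f (x ∷ xs) with p x
    ... | true  = cong (f x +_) (Σ-select p f xs)
    ... | false = Σ-select p f xs

    Σ-++ : ∀ (f : A → ℕ) xs ys → Σ[ xs ++ ys ] f ≡ Σ[ xs ] f + Σ[ ys ] f
    Σ-++ f []       ys = refl
    Σ-++ f (x ∷ xs) ys = trans (cong (f x +_) (Σ-++ f xs ys)) (sym (+-assoc (f x) _ _))

  module _ {A B : Set} where

    Σ-swap : ∀ (f : A → B → ℕ) xs ys → Σ[ xs ] (λ x → Σ[ ys ] (f x)) ≡ Σ[ ys ] (λ y → Σ[ xs ] (λ x → f x y))
    Σ-swap f []       ys = sym (Σ-zero ys)
    Σ-swap f (x ∷ xs) ys = trans (cong (Σ[ ys ] (f x) +_) (Σ-swap f xs ys)) (sym (Σ-+ (f x) _ ys))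

    Σ-map : ∀ (f : B → ℕ) (h : A → B) xs → Σ[ map h xs ] f ≡ Σ[ xs ] (f ∘ h)
    Σ-map f h xs = cong sum (sym (map-∘ xs))

  ∈-range⁺ : ∀ {x n} → x < n → x ∈ range n
  ∈-range⁺ {zero}  {suc n} _         = here refl
  ∈-range⁺ {suc x} {suc n} (s≤s x<n) = there (∈-map⁺ suc (∈-range⁺ x<n))

  ∈-range⁻ : ∀ {x n} → x ∈ range n → x < n
  ∈-range⁻ {n = suc n} (here refl) = s≤s z≤n
  ∈-range⁻ {n = suc n} (there x∈) with ∈-map⁻ suc x∈
  ... | y , y∈ , refl = s≤s (∈-range⁻ y∈)

  range-unique : ∀ n → Unique (range n)
  range-unique zero    = []
  range-unique (suc n) = All.map⁺ (All.universal (λ _ ()) (range n)) ∷ Unique.map⁺ suc-injective (range-unique n)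

  select-unique : ∀ {A : Set} (p : A → Bool) {xs} → Unique xs → Unique (select p xs)
  select-unique p []               = []
  select-unique p {x ∷ _} (px ∷ ps) with p x
  ... | true  = All-select p px ∷ select-unique p ps
  ... | false = select-unique p ps

  ∈-select⁻ : ∀ {A : Set} (p : A → Bool) {x xs} → x ∈ select p xs → x ∈ xs × p x ≡ true
  ∈-select⁻ p {xs = xs} x∈ = All.lookup (All-select p (All.tabulate id)) x∈ , All.lookup (select-sound p xs) x∈

  ≡?ᵇ-refl : ∀ n → (n ≡?ᵇ n) ≡ true
  ≡?ᵇ-refl n = ≡?ᵇ-complete {n} refl

  ≡?ᵇ-false : ∀ {m n} → m ≢ n → (m ≡?ᵇ n) ≡ false
  ≡?ᵇ-false {m} {n} m≢n with m ≡?ᵇ n in eq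
  ... | true  = contradiction (≡?ᵇ-sound eq) m≢n
  ... | false = refl

  Σ-delta : ∀ {y xs} c → Unique xs → y ∈ xs → Σ[ xs ] (λ r → if y ≡?ᵇ r then c else 0) ≡ c
  Σ-delta {y} {_ ∷ xs} c (px ∷ ps) (here refl) rewrite ≡?ᵇ-refl y =
    trans (cong (c +_) (trans (Σ-cong xs λ {r} r∈ → cong (if_then c else 0) (≡?ᵇ-false (All.lookup px r∈))) (Σ-zero xs))) (+-identityʳ c)
  Σ-delta {y} {x ∷ xs} c (px ∷ ps) (there y∈) rewrite ≡?ᵇ-false {y} {x} (≢-sym (All.lookup px y∈)) = Σ-delta c ps y∈

  module _ {A B : Set} where

    ∈-tuples⁺ : ∀ (h : A → B) (f : A → List B) xs → (∀ {x} → x ∈ xs → h x ∈ f x) → map h xs ∈ tuples (map f xs)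
    ∈-tuples⁺ h f []       _  = here refl
    ∈-tuples⁺ h f (x ∷ xs) h∈ = ∈-concat⁺′ (∈-map⁺ (h x ∷_) (∈-tuples⁺ h f xs (h∈ ∘ there)))
      (∈-map⁺ (λ y → map (y ∷_) (tuples (map f xs))) (h∈ (here refl)))

  Keyed-cong : ∀ {K K′} xs → (∀ {x} → x ∈ xs → K x ≡ K′ x) → Keyed K xs ≡ Keyed K′ xs
  Keyed-cong xs eq = map-cong-local (All.tabulate λ x∈ → cong (_ ,_) (eq x∈))

  -- A tuple is read back as a function. The entries of `xs` are distinct, so the function for the
  -- tail can be redefined at the head without disturbing the other values.
  ∈-tuples⁻ : ∀ (f : ℕ → List Key) (valid : ℕ → ℕ → Set) (f⁻ : ∀ {v p} → p ∈ f v → ∃ λ κ → p ≡ (v , κ) × valid v κ) →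
              ∀ {xs t} → Unique xs → t ∈ tuples (map f xs) →
              ∃ λ K → t ≡ Keyed K xs × (∀ {v} → v ∈ xs → valid v (K v))
  ∈-tuples⁻ f valid f⁻ {[]}     []        (here refl) = id , refl , λ ()
  ∈-tuples⁻ f valid f⁻ {x ∷ xs} (px ∷ ps) t∈
    with ∈-concat⁻′ (map (λ y → map (y ∷_) (tuples (map f xs))) (f x)) t∈
  ... | ts , t∈ts , ts∈ with ∈-map⁻ (λ y → map (y ∷_) (tuples (map f xs))) ts∈
  ... | y , y∈ , refl with ∈-map⁻ (y ∷_) t∈ts
  ... | t′ , t′∈ , refl with f⁻ y∈ | ∈-tuples⁻ f valid f⁻ ps t′∈
  ... | κ , refl , ok | K , refl , oks = K′ , cong₂ _∷_ (cong (x ,_) (sym K′x)) (Keyed-cong xs (λ v∈ → sym (K′≡ v∈))) ,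
        λ { (here refl) → subst (valid x) (sym K′x) ok ; (there v∈) → subst (valid _) (sym (K′≡ v∈)) (oks v∈) }
    where
    K′ : ℕ → ℕ
    K′ v = if v ≡?ᵇ x then κ else K v
    K′x : K′ x ≡ κ
    K′x rewrite ≡?ᵇ-refl x = refl
    K′≡ : ∀ {v} → v ∈ xs → K′ v ≡ K v
    K′≡ {v} v∈ rewrite ≡?ᵇ-false {v} {x} (≢-sym (All.lookup px v∈)) = refl

  minimum-cases : ∀ {A : Set} (f : A → ℕ) d xs → minimum f d xs ≡ d ⊎ ∃ λ x → x ∈ xs × minimum f d xs ≡ f x
  minimum-cases f d []       = inj₁ refl
  minimum-cases f d (x ∷ xs) with f x ≤?ᵇ minimum f d xs | minimum-cases f d xs
  ... | true  | _                  = inj₂ (x , here refl , refl)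
  ... | false | inj₁ eq            = inj₁ eq
  ... | false | inj₂ (y , y∈ , eq) = inj₂ (y , there y∈ , eq)

  module Labelled (g : List (List Bool)) (s : List Bool) where
    open Main g s

    Valid : ℕ → ℕ → Set
    Valid v κ = ∃ λ j → j < labels × κ ≡ v + n * j

    keys⁻ : ∀ {v p} → p ∈ keys v → ∃ λ κ → p ≡ (v , κ) × Valid v κ
    keys⁻ {v} p∈ with ∈-map⁻ (λ j → v , v + n * j) p∈
    ... | j , j∈ , refl = v + n * j , refl , j , ∈-range⁻ j∈ , refl

    keys⁺ : ∀ {v κ} → Valid v κ → (v , κ) ∈ keys v
    keys⁺ {v} (j , j< , refl) = ∈-map⁺ (λ j → v , v + n * j) (∈-range⁺ j<)

    verts-unique : Unique verts
    verts-unique = range-unique n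

    rep∈ : ∀ {v} → v ∈ verts → rep v ∈ verts
    rep∈ {v} v∈ with select (near v) verts in eq
    ... | []    = v∈
    ... | x ∷ _ = proj₁ (∈-select⁻ (near v) (subst (x ∈_) (sym eq) (here refl)))

    inComp : ℕ → ℕ → Bool
    inComp r u = not (inCover u) ∧ (rep u ≡?ᵇ r)

    comp-rep : ∀ {r v} → v ∈ comp r → v ∈ verts × inCover v ≡ false × rep v ≡ r
    comp-rep {r} {v} v∈ with ∈-select⁻ (inComp r) v∈
    ... | v∈ , eq with inCover v
    ...   | false = v∈ , refl , ≡?ᵇ-sound eq

    -- After exchanging the two sums, a vertex outside the cover is counted for exactly one `r`, its
    -- representative, which is a vertex by `rep∈`.
    partition : ∀ f → Σ[ cover ] f + Σ[ verts ] (λ r → Σ[ comp r ] f) ≡ Σ[ verts ] f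
    partition f = begin
      Σ[ cover ] f + Σ[ verts ] (λ r → Σ[ comp r ] f)
        ≡⟨ cong₂ _+_ (Σ-select inCover f verts) (trans (Σ-cong verts λ {r} _ → Σ-select (inComp r) f verts)
             (Σ-swap (λ r u → if inComp r u then f u else 0) verts verts)) ⟩
      Σ[ verts ] (λ u → if inCover u then f u else 0) + Σ[ verts ] (λ u → Σ[ verts ] (λ r → if inComp r u then f u else 0))
        ≡⟨ Σ-+ _ _ verts ⟨
      Σ[ verts ] (λ u → (if inCover u then f u else 0) + Σ[ verts ] (λ r → if inComp r u then f u else 0))
        ≡⟨ Σ-cong verts each ⟩
      Σ[ verts ] f ∎
      where
      open ≡-Reasoning
      each : ∀ {u} → u ∈ verts → (if inCover u then f u else 0) + Σ[ verts ] (λ r → if inComp r u then f u else 0) ≡ f u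
      each {u} u∈ with inCover u
      ... | true  = trans (cong (f u +_) (Σ-zero verts)) (+-identityʳ _)
      ... | false = Σ-delta (f u) verts-unique (rep∈ u∈)

    earlier : (ℕ → ℕ) → ℕ → ℕ → ℕ
    earlier K v u = if edge g v u ∧ (suc (K u) ≤?ᵇ K v) then 1 else 0

    deviation : (ℕ → ℕ) → ℕ → ℕ
    deviation K v = ∣ 2 * Σ[ verts ] (earlier K v) - deg g v ∣

    left-Keyed : ∀ K xs v → left g (Keyed K xs) (v , K v) ≡ Σ[ xs ] (earlier K v)
    left-Keyed K xs v = Σ-map _ (λ u → u , K u) xs

    solution : (ℕ → ℕ) → List ℕ → Sol
    solution K = map (λ r → tuples (map keys (comp r)) , Keyed K (comp r))

    left-solution : ∀ K rs v → left g (asg (solution K rs)) (v , K v) ≡ Σ[ rs ] (λ r → Σ[ comp r ] (earlier K v))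
    left-solution K []       v = refl
    left-solution K (r ∷ rs) v = trans (left-++ g (Keyed K (comp r)) _ (v , K v))
      (cong₂ _+_ (left-Keyed K (comp r) v) (left-solution K rs v))

    module _ (twins : ∀ {u v} → u ∈ verts → v ∈ verts → inCover u ≡ false → inCover v ≡ false →
                      edge g v u ≡ true → rep u ≡ rep v) where

      -- By `twins` a neighbour of `v` outside the cover has the representative of `v`, so nothing
      -- outside the component and the cover contributes.
      left-local : ∀ K {r v} → v ∈ comp r → left g (Keyed K (comp r) ++ Keyed K cover) (v , K v) ≡ Σ[ verts ] (earlier K v)
      left-local K {r} {v} v∈ = begin
        left g (Keyed K (comp r) ++ Keyed K cover) (v , K v)
          ≡⟨ trans (left-++ g (Keyed K (comp r)) (Keyed K cover) (v , K v)) (cong₂ _+_ (left-Keyed K (comp r) v) (left-Keyed K cover v)) ⟩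
        Σ[ comp r ] (earlier K v) + Σ[ cover ] (earlier K v)
          ≡⟨ cong₂ _+_ (Σ-select (inComp r) (earlier K v) verts) (Σ-select inCover (earlier K v) verts) ⟩
        Σ[ verts ] (λ u → if inComp r u then earlier K v u else 0) + Σ[ verts ] (λ u → if inCover u then earlier K v u else 0)
          ≡⟨ Σ-+ _ _ verts ⟨
        Σ[ verts ] (λ u → (if inComp r u then earlier K v u else 0) + (if inCover u then earlier K v u else 0))
          ≡⟨ Σ-cong verts each ⟩
        Σ[ verts ] (earlier K v) ∎
        where
        open ≡-Reasoning
        each : ∀ {u} → u ∈ verts → (if inComp r u then earlier K v u else 0) + (if inCover u then earlier K v u else 0) ≡ earlier K v u
        each {u} u∈ with inCover u in cu
        ... | true  = refl
        ... | false with edge g v u in e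
        ...   | false with rep u ≡?ᵇ r
        ...     | true  = refl
        ...     | false = refl
        each {u} u∈ | false | true
          with comp-rep v∈
        ... | v∈′ , cv , refl rewrite ≡?ᵇ-complete {rep u} {rep v} (twins u∈ v∈′ cu cv e) = +-identityʳ _

      module _ (K : ℕ → ℕ) where
        open Solver g (Keyed K cover) box radius

        -- The costs of the options account for the vertices of the components, the remaining term
        -- for the cover; `partition` is applied both to the left counts of cover vertices and to
        -- the deviations.
        objective : obj (solution K verts) ≡ Σ[ verts ] (deviation K)
        objective = begin
          obj (solution K verts)
            ≡⟨ cong₂ _+_ (trans (Σ-map _ _ verts) (Σ-cong verts λ {r} _ → local r)) global ⟩
          Σ[ verts ] (λ r → Σ[ comp r ] (deviation K)) + Σ[ cover ] (deviation K)
            ≡⟨ trans (+-comm _ (Σ[ cover ] (deviation K))) (partition (deviation K)) ⟩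
          Σ[ verts ] (deviation K) ∎
          where
          open ≡-Reasoning
          local : ∀ r → imb g (Keyed K (comp r)) (Keyed K (comp r) ++ Keyed K cover) ≡ Σ[ comp r ] (deviation K)
          local r = trans (Σ-map _ (λ u → u , K u) (comp r))
            (Σ-cong (comp r) λ {v} v∈ → cong (λ l → ∣ 2 * l - deg g v ∣) (left-local K v∈))
          global : imb g (Keyed K cover) (Keyed K cover ++ asg (solution K verts)) ≡ Σ[ cover ] (deviation K)
          global = trans (Σ-map _ (λ u → u , K u) cover) (Σ-cong cover λ {v} _ → cong (λ l → ∣ 2 * l - deg g v ∣)
            (trans (left-++ g (Keyed K cover) (asg (solution K verts)) (v , K v))
              (trans (cong₂ _+_ (left-Keyed K cover v) (left-solution K verts v)) (partition (earlier K v)))))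

    covers⁺ : ∀ K → (∀ {v} → v ∈ verts → Valid v (K v)) → Keyed K cover ∈ covers
    covers⁺ K ok = ∈-tuples⁺ (λ v → v , K v) keys cover λ v∈ → keys⁺ (ok (proj₁ (∈-select⁻ inCover v∈)))

    comp⁺ : ∀ K → (∀ {v} → v ∈ verts → Valid v (K v)) → ∀ r → Keyed K (comp r) ∈ tuples (map keys (comp r))
    comp⁺ K ok r = ∈-tuples⁺ (λ v → v , K v) keys (comp r) λ v∈ → keys⁺ (ok (proj₁ (∈-select⁻ (inComp r) v∈)))

    itemsOf : List ℕ → List Item
    itemsOf = map (λ r → tuples (map keys (comp r)))

    start : List Item → Sol
    start = map (λ it → it , headOr [] it)

    solution-fits : ∀ K → (∀ {v} → v ∈ verts → Valid v (K v)) → ∀ rs → Fits (start (itemsOf rs)) (solution K rs)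
    solution-fits K ok []       = []
    solution-fits K ok (r ∷ rs) = comp⁺ K ok r ∷ solution-fits K ok rs

    fits⁻ : ∀ rs {x} → Unique rs → Fits (start (itemsOf rs)) x →
            ∃ λ K → x ≡ solution K rs × (∀ {r v} → r ∈ rs → v ∈ comp r → Valid v (K v))
    fits⁻ []       []        []       = id , refl , λ ()
    fits⁻ (r ∷ rs) (pr ∷ ps) (ψ∈ ∷ f)
      with ∈-tuples⁻ keys Valid keys⁻ (select-unique (inComp r) verts-unique) ψ∈ | fits⁻ rs ps f
    ... | K₁ , refl , ok₁ | K₂ , refl , ok₂ = K′
        , cong₂ _∷_ (cong (_ ,_) (Keyed-cong (comp r) (λ v∈ → sym (here′ v∈))))
            (map-cong-local (All.tabulate λ r∈ → cong (_ ,_) (Keyed-cong _ (λ v∈ → sym (there′ r∈ v∈)))))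
        , λ { (here refl) v∈ → subst (Valid _) (sym (here′ v∈)) (ok₁ v∈)
            ; (there r∈) v∈ → subst (Valid _) (sym (there′ r∈ v∈)) (ok₂ r∈ v∈) }
      where
      K′ : ℕ → ℕ
      K′ v = if rep v ≡?ᵇ r then K₁ v else K₂ v
      here′ : ∀ {v} → v ∈ comp r → K′ v ≡ K₁ v
      here′ {v} v∈ rewrite ≡?ᵇ-complete {rep v} {r} (proj₂ (proj₂ (comp-rep v∈))) = refl
      there′ : ∀ {q v} → q ∈ rs → v ∈ comp q → K′ v ≡ K₂ v
      there′ {q} {v} q∈ v∈ rewrite ≡?ᵇ-false {rep v} {r} (λ eq → All.lookup pr q∈ (trans (sym eq) (proj₂ (proj₂ (comp-rep v∈))))) = refl

    -- The labellings of the cover and of the components have disjoint domains, so one function can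
    -- be glued from them.
    labelled : ∀ {φ x} → φ ∈ covers → Fits (start items) x →
               ∃ λ K → φ ≡ Keyed K cover × x ≡ solution K verts × (∀ {v} → v ∈ verts → Valid v (K v))
    labelled φ∈ f with ∈-tuples⁻ keys Valid keys⁻ (select-unique inCover {verts} verts-unique) φ∈ | fits⁻ verts verts-unique f
    ... | K₁ , refl , ok₁ | K₂ , refl , ok₂ = K′
        , Keyed-cong cover (λ v∈ → sym (in′ (proj₂ (∈-select⁻ inCover {xs = verts} v∈))))
        , map-cong-local (All.tabulate λ _ → cong (_ ,_) (Keyed-cong _ λ v∈ → sym (out′ (proj₁ (proj₂ (comp-rep v∈))))))
        , ok
      where
      K′ : ℕ → ℕ
      K′ v = if inCover v then K₁ v else K₂ v
      in′ : ∀ {v} → inCover v ≡ true → K′ v ≡ K₁ v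
      in′ eq rewrite eq = refl
      out′ : ∀ {v} → inCover v ≡ false → K′ v ≡ K₂ v
      out′ eq rewrite eq = refl
      ok : ∀ {v} → v ∈ verts → Valid v (K′ v)
      ok {v} v∈ = go (inCover v) refl
        where
        go : ∀ b → inCover v ≡ b → Valid v (K′ v)
        go true  eq = subst (Valid v) (sym (in′ eq)) (ok₁ (∈-select⁺ inCover v∈ eq))
        go false eq = subst (Valid v) (sym (out′ eq)) (ok₂ (rep∈ v∈)
          (∈-select⁺ (inComp (rep v)) v∈ (subst (λ b → not b ∧ (rep v ≡?ᵇ rep v) ≡ true) (sym eq) (≡?ᵇ-refl (rep v)))))

    comp≤size : ∀ {r} → r ∈ verts → length (comp r) ≤ size
    comp≤size = go verts
      where
      go : ∀ rs {r} → r ∈ rs → length (comp r) ≤ foldr (λ r m → if length (comp r) ≤?ᵇ m then m else length (comp r)) 0 rs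
      go (q ∷ rs) r∈ with length (comp q) ≤?ᵇ foldr (λ r m → if length (comp r) ≤?ᵇ m then m else length (comp r)) 0 rs in eq
      go (q ∷ rs) (here refl) | true  = ≤?ᵇ-sound eq
      go (q ∷ rs) (there r∈)  | true  = go rs r∈
      go (q ∷ rs) (here refl) | false = ≤-refl
      go (q ∷ rs) (there r∈)  | false = ≤-trans (go rs r∈) (<⇒≤ (≤?ᵇ-false eq))

    -- The label with number 0 is available to every vertex, which shows that no item is empty.
    initial : ∀ {v} → v ∈ verts → Valid v v
    initial {v} _ = 0 , s≤s z≤n , sym (trans (cong (v +_) (*-zeroʳ n)) (+-identityʳ v))

    short : All (All (λ ψ → length ψ ≤ labels)) items
    short = All.map⁺ (All.tabulate λ {r} r∈ → All.tabulate λ {ψ} ψ∈ → bounded r r∈ ψ ψ∈)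
      where
      bounded : ∀ r → r ∈ verts → ∀ ψ → ψ ∈ tuples (map keys (comp r)) → length ψ ≤ labels
      bounded r r∈ ψ ψ∈ with ∈-tuples⁻ keys Valid keys⁻ (select-unique (inComp r) {verts} verts-unique) ψ∈
      ... | K , refl , _ = ≤-trans (≤-reflexive (length-map _ (comp r)))
        (≤-trans (comp≤size r∈) (≤-trans (n≤1+n size) (m≤n*m (suc size) (suc (length cover)))))

    nonempty : All (λ it → headOr [] it ∈ it) items
    nonempty = All.map⁺ (All.tabulate λ {r} _ → head∈ (comp⁺ id initial r))
      where
      head∈ : ∀ {ψ : Asg} {it} → ψ ∈ it → headOr [] it ∈ it
      head∈ {it = _ ∷ _} _ = here refl

    module _ (twins : ∀ {u v} → u ∈ verts → v ∈ verts → inCover u ≡ false → inCover v ≡ false →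
                      edge g v u ≡ true → rep u ≡ rep v) where

      private
        module _ (K : ℕ → ℕ) where
          open Search g (Keyed K cover) box radius cover K refl
            (λ off off≤ → ∈-tuples⁺ (λ v → v , off v) offsets cover
              λ {v} v∈ → ∈-map⁺ (λ j → v , j) (∈-range⁺ (s≤s (off≤ v∈)))) public

          radius-suffices : tower (length (Keyed K cover)) labels ≤ radius
          radius-suffices = tower-mono {j = labels} (≤-trans (≤-reflexive (length-map _ cover))
            (≤-trans (n≤1+n _) (m≤m*n (suc (length cover)) (suc size)))) ≤-refl

      value≤ : ∀ K → (∀ {v} → v ∈ verts → Valid v (K v)) → value ≤ Σ[ verts ] (deviation K)
      value≤ K ok = ≤-trans (minimum≤f (λ φ → Solver.solve g φ box radius items) (n * n) (covers⁺ K ok))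
        (≤-trans (solve-optimal K labels (radius-suffices K) items short nonempty (solution-fits K ok verts))
          (≤-reflexive (objective twins K)))
        where
        minimum≤f : ∀ {A : Set} (f : A → ℕ) d {x xs} → x ∈ xs → minimum f d xs ≤ f x
        minimum≤f f d {xs = y ∷ xs} x∈ with f y ≤?ᵇ minimum f d xs in eq
        minimum≤f f d (here refl) | true  = ≤-refl
        minimum≤f f d (there x∈)  | true  = ≤-trans (≤?ᵇ-sound eq) (minimum≤f f d x∈)
        minimum≤f f d (here refl) | false = <⇒≤ (≤?ᵇ-false eq)
        minimum≤f f d (there x∈)  | false = minimum≤f f d x∈

      value-attained : value ≡ n * n ⊎ ∃ λ K → (∀ {v} → v ∈ verts → Valid v (K v)) × value ≡ Σ[ verts ] (deviation K)
      value-attained = attained (minimum-cases (λ φ → Solver.solve g φ box radius items) (n * n) covers)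
        where
        attained : value ≡ n * n ⊎ (∃ λ φ → φ ∈ covers × value ≡ Solver.solve g φ box radius items) →
                   value ≡ n * n ⊎ ∃ λ K → (∀ {v} → v ∈ verts → Valid v (K v)) × value ≡ Σ[ verts ] (deviation K)
        attained (inj₁ eq) = inj₁ eq
        attained (inj₂ (φ , φ∈ , eq)) = inj₂ (K , proj₂ (proj₂ (proj₂ lab)) , trans eq
          (trans (cong₂ (λ φ x → Solver.obj g φ box radius x) (proj₁ (proj₂ lab)) (proj₁ (proj₂ (proj₂ lab)))) (objective twins K)))
          where
          lab = labelled φ∈ (final-fits g φ box radius items nonempty)
          K   = proj₁ lab

-- From labellings to layouts and back

module Layouts where

  open Routines
  open LocalSearch using (edge; deg)

  open Labellings using (Σ[_]; Σ-select; ∈-range⁺; ∈-range⁻; ∈-select⁻)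
  open import Algebra.Properties.CommutativeMonoid.Sum using (sum)
  open import Data.Bool.Base using (Bool; true; false; if_then_else_; _∧_; not)
  open import Data.Fin.Base as Fin using (Fin; zero; suc; toℕ; fromℕ<; punchOut)
  open import Data.Fin.Permutation as Perm using (_⟨$⟩ʳ_; permutation)
  import Data.Fin.Properties as Fin
  open import Data.Fin.Subset using (Subset; _∈_; ∣_∣)
  open import Data.Fin.Subset.Properties using (∣p∣≤n)
  open import Data.List.Base as List using (List; []; _∷_; length; map)
  import Data.List.Membership.Propositional as List
  import Data.List.Membership.Propositional.Properties as List
  open import Data.Nat.Base as ℕ using (ℕ; zero; suc; _+_; _*_; _≤_; _<_; z≤n; s≤s; ∣_-_∣)
  open import Data.Nat.Properties
  open import Data.List.Properties using (map-∘)
  open import Data.Sum.Base using (_⊎_; inj₁; inj₂)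
  open import Data.Product.Base using (∃; _×_; _,_; proj₁; proj₂)
  open import Data.Vec.Base as Vec using (Vec; []; _∷_; tabulate; lookup; toList)
  open import Data.Vec.Properties using (lookup∘tabulate; lookup-zipWith; lookup-map; length-toList; lookup⇒[]=; []=⇒lookup)
  open import Data.Bool.Properties using (∧-zeroʳ)
  open import Function.Base using (_∘_; id)
  open import Relation.Binary.PropositionalEquality hiding ([_])
  open import Relation.Binary.Definitions using (Tri; tri<; tri≈; tri>)
  open import Relation.Nullary using (yes; no; contradiction; ¬_; Dec)
  open import Relation.Nullary.Decidable using (⌊_⌋)

  ∑ : ∀ {n} → (Fin n → ℕ) → ℕ
  ∑ = sum +-0-commutativeMonoid

  ∑-cong : ∀ {n} {f h : Fin n → ℕ} → (∀ i → f i ≡ h i) → ∑ f ≡ ∑ h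
  ∑-cong {zero}  eq = refl
  ∑-cong {suc n} eq = cong₂ _+_ (eq zero) (∑-cong (eq ∘ suc))

  ∑-mono : ∀ {n} {f h : Fin n → ℕ} → (∀ i → f i ≤ h i) → ∑ f ≤ ∑ h
  ∑-mono {zero}  le = z≤n
  ∑-mono {suc n} le = +-mono-≤ (le zero) (∑-mono (le ∘ suc))

  ∑-strict : ∀ {n} {f h : Fin n → ℕ} → (∀ i → f i ≤ h i) → ∀ j → f j < h j → ∑ f < ∑ h
  ∑-strict le zero    lt = +-mono-<-≤ lt (∑-mono (le ∘ suc))
  ∑-strict le (suc j) lt = +-mono-≤-< (le zero) (∑-strict (le ∘ suc) j lt)

  ∑-const : ∀ n k → ∑ {n} (λ _ → k) ≡ n * k
  ∑-const zero    k = refl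
  ∑-const (suc n) k = cong (k +_) (∑-const n k)

  range-∑ : ∀ n f → Σ[ range n ] f ≡ ∑ {n} (f ∘ toℕ)
  range-∑ zero    f = refl
  range-∑ (suc n) f = cong (f 0 +_) (trans (cong (λ xs → List.foldr _+_ 0 xs) (sym (map-∘ (range n)))) (range-∑ n (f ∘ suc)))

  bit : Bool → ℕ
  bit b = if b then 1 else 0

  bit-mono : ∀ {b c} → (b ≡ true → c ≡ true) → bit b ≤ bit c
  bit-mono {false}     _ = z≤n
  bit-mono {true}  {c} f rewrite f refl = ≤-refl

  count : ∀ {n} → (Fin n → Bool) → ℕ
  count p = ∑ (bit ∘ p)

  count-mono : ∀ {n} (p q : Fin n → Bool) → (∀ i → p i ≡ true → q i ≡ true) → count p ≤ count q
  count-mono p q p⊆q = ∑-mono λ i → bit-mono (p⊆q i)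

  count-strict : ∀ {n} (p q : Fin n → Bool) → (∀ i → p i ≡ true → q i ≡ true) →
                 ∀ j → p j ≡ false → q j ≡ true → count p < count q
  count-strict p q p⊆q j pj qj = ∑-strict (λ i → bit-mono (p⊆q i)) j (subst₂ (λ a b → bit a < bit b) (sym pj) (sym qj) (s≤s z≤n))

  count-true : ∀ n → count {n} (λ _ → true) ≡ n
  count-true n = trans (∑-const n 1) (*-identityʳ n)

  ∣∣-count : ∀ {n} (p : Subset n) → ∣ p ∣ ≡ count (lookup p)
  ∣∣-count []          = refl
  ∣∣-count (true  ∷ p) = cong suc (∣∣-count p)
  ∣∣-count (false ∷ p) = ∣∣-count p

  select-count : ∀ n (p : ℕ → Bool) → length (select p (range n)) ≡ count {n} (p ∘ toℕ)
  select-count n p = trans (sym (ones (select p (range n)))) (trans (Σ-select p (λ _ → 1) (range n)) (range-∑ n (λ x → bit (p x))))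
    where
    ones : ∀ (xs : List ℕ) → Σ[ xs ] (λ _ → 1) ≡ length xs
    ones []       = refl
    ones (_ ∷ xs) = cong suc (ones xs)

  repeat-tail : ∀ {A : Set} (x : A) xs i → repeat tail (x ∷ xs) (suc i) ≡ repeat tail xs i
  repeat-tail x xs zero    = refl
  repeat-tail x xs (suc i) = cong tail (repeat-tail x xs i)

  nth-toList : ∀ {A : Set} {n} d (xs : Vec A n) i → nth d (toList xs) (toℕ i) ≡ lookup xs i
  nth-toList d (x ∷ xs) zero    = refl
  nth-toList d (x ∷ xs) (suc i) = trans (cong (headOr d) (repeat-tail x (toList xs) (toℕ i))) (nth-toList d xs i)

  select-toList : ∀ {n} (p : Subset n) → length (select id (toList p)) ≡ ∣ p ∣
  select-toList []          = refl
  select-toList (true  ∷ p) = cong suc (select-toList p)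
  select-toList (false ∷ p) = select-toList p

  Bool-ext : ∀ {b c : Bool} → (b ≡ true → c ≡ true) → (c ≡ true → b ≡ true) → b ≡ c
  Bool-ext {true}  {c}     f h = sym (f refl)
  Bool-ext {false} {true}  f h = h refl
  Bool-ext {false} {false} f h = refl

  ∧-true : ∀ {b c} → b ∧ c ≡ true → b ≡ true × c ≡ true
  ∧-true {true} {true} _ = refl , refl

  not-true : ∀ {b} → not b ≡ true → b ≡ false
  not-true {false} _ = refl

  module _ {P : Set} where

    ⌊⌋-yes : (d : Dec P) → P → ⌊ d ⌋ ≡ true
    ⌊⌋-yes (yes _) _ = refl
    ⌊⌋-yes (no ¬p) p = contradiction p ¬p

    ⌊⌋-no : (d : Dec P) → ¬ P → ⌊ d ⌋ ≡ false
    ⌊⌋-no (yes p) ¬p = contradiction p ¬p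
    ⌊⌋-no (no _)  _  = refl

    ⌊⌋-sound : (d : Dec P) → ⌊ d ⌋ ≡ true → P
    ⌊⌋-sound (yes p) _ = p

  -- If `j` were missed, punching it out would inject `suc m` elements into `m`.
  injective⇒surjective : ∀ {m} (f : Fin m → Fin m) → (∀ {i j} → f i ≡ f j → i ≡ j) → ∀ j → ∃ λ i → f i ≡ j
  injective⇒surjective {suc m} f inj j with Fin.any? (λ i → f i Fin.≟ j)
  ... | yes found = found
  ... | no ¬found = contradiction (Fin.injective⇒≤ {f = λ i → punchOut {i = j} (λ e → ¬found (i , sym e))}
          (λ {a} {b} eq → inj (Fin.punchOut-injective (λ e → ¬found (a , sym e)) (λ e → ¬found (b , sym e)) eq))) 1+n≰n

  module _ {n : ℕ} (k : Fin n → ℕ) (k-injective : ∀ {i j} → k i ≡ k j → i ≡ j) where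

    private
      below : Fin n → Fin n → Bool
      below i u = suc (k u) ≤?ᵇ k i

      rank : Fin n → ℕ
      rank i = count (below i)

      below-irrefl : ∀ i → below i i ≡ false
      below-irrefl i = go (below i i) refl
        where
        go : ∀ b → below i i ≡ b → b ≡ false
        go false _ = refl
        go true  p = contradiction (≤?ᵇ-sound {suc (k i)} {k i} p) (<-irrefl refl)

      rank-mono : ∀ {i j} → k i < k j → rank i < rank j
      rank-mono {i} {j} lt = count-strict (below i) (below j)
        (λ u p → ≤?ᵇ-complete (<-trans (≤?ᵇ-sound {suc (k u)} {k i} p) lt)) i (below-irrefl i) (≤?ᵇ-complete lt)

      rank<n : ∀ i → rank i < n
      rank<n i = <-≤-trans (count-strict (below i) (λ _ → true) (λ _ _ → refl) i (below-irrefl i) refl) (≤-reflexive (count-true n))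

      position : Fin n → Fin n
      position i = fromℕ< (rank<n i)

      toℕ-position : ∀ i → toℕ (position i) ≡ rank i
      toℕ-position i = Fin.toℕ-fromℕ< (rank<n i)

      position-injective : ∀ {i j} → position i ≡ position j → i ≡ j
      position-injective {i} {j} eq with <-cmp (k i) (k j)
      ... | tri≈ _ e _  = k-injective e
      ... | tri< lt _ _ = contradiction (rank≡ eq) (<⇒≢ (rank-mono lt))
        where
        rank≡ : position i ≡ position j → rank i ≡ rank j
        rank≡ eq = trans (sym (toℕ-position i)) (trans (cong toℕ eq) (toℕ-position j))
      ... | tri> _ _ gt = contradiction (rank≡ eq) (≢-sym (<⇒≢ (rank-mono gt)))
        where
        rank≡ : position i ≡ position j → rank i ≡ rank j
        rank≡ eq = trans (sym (toℕ-position i)) (trans (cong toℕ eq) (toℕ-position j))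

    ordering : Layout n
    ordering = permutation position (proj₁ ∘ onto) (λ j → proj₂ (onto j)) (λ i → position-injective (proj₂ (onto (position i))))
      where
      onto = injective⇒surjective position position-injective

    ordering⁺ : ∀ {i j} → k i < k j → ordering ⟨$⟩ʳ i Fin.< ordering ⟨$⟩ʳ j
    ordering⁺ {i} {j} lt = subst₂ _<_ (sym (toℕ-position i)) (sym (toℕ-position j)) (rank-mono lt)

  module _ {n : ℕ} (G : Graph n) (σ : Layout n) where

    earlierIn : Fin n → Fin n → Bool
    earlierIn v u = lookup (N G v) u ∧ ⌊ σ ⟨$⟩ʳ u Fin.<? σ ⟨$⟩ʳ v ⌋

    ∣Nᴸ∣ : ∀ v → ∣ Nᴸ G v σ ∣ ≡ count (earlierIn v)
    ∣Nᴸ∣ v = trans (∣∣-count (Nᴸ G v σ)) (∑-cong λ u → cong bit (trans (lookup-zipWith _∧_ u (N G v) (before σ v))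
      (cong (lookup (N G v) u ∧_) (lookup∘tabulate _ u))))

    loop-free : ∀ v → lookup (N G v) v ≡ false
    loop-free v with lookup (N G v) v in eq
    ... | true  = contradiction (lookup⇒[]= v (N G v) eq) (loopless G v)
    ... | false = refl

    -- A neighbour of `v` differs from `v`, and positions of distinct vertices differ, so it is
    -- counted on exactly one side.
    degree : ∀ v → ∣ N G v ∣ ≡ ∣ Nᴸ G v σ ∣ + ∣ Nᴿ G v σ ∣
    degree v = trans (∣∣-count (N G v)) (trans (∑-cong each) (trans (split (bit ∘ earlierIn v) later)
        (cong₂ _+_ (sym (∣Nᴸ∣ v)) (sym (trans (∣∣-count (Nᴿ G v σ)) (∑-cong λ u → cong bit (trans (lookup-zipWith _∧_ u (N G v) (after σ v))
          (cong (lookup (N G v) u ∧_) (lookup∘tabulate _ u)))))))))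
      where
      later : Fin n → ℕ
      later u = bit (lookup (N G v) u ∧ ⌊ σ ⟨$⟩ʳ v Fin.<? σ ⟨$⟩ʳ u ⌋)
      split : ∀ {m} (f h : Fin m → ℕ) → ∑ (λ i → f i + h i) ≡ ∑ f + ∑ h
      split {zero}  f h = refl
      split {suc m} f h = trans (cong (f zero + h zero +_) (split (f ∘ suc) (h ∘ suc))) (Labellings.+-swap {ℕ} (f zero) (h zero) _ _)
      each : ∀ u → bit (lookup (N G v) u) ≡ bit (earlierIn v u) + later u
      each u with lookup (N G v) u in eq
      ... | false = refl
      ... | true with Fin.<-cmp (σ ⟨$⟩ʳ u) (σ ⟨$⟩ʳ v)
      ...   | tri< lt _ ¬gt = sym (cong₂ (λ a b → bit a + bit b) (⌊⌋-yes (σ ⟨$⟩ʳ u Fin.<? σ ⟨$⟩ʳ v) lt) (⌊⌋-no (σ ⟨$⟩ʳ v Fin.<? σ ⟨$⟩ʳ u) ¬gt))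
      ...   | tri> ¬lt _ gt = sym (cong₂ (λ a b → bit a + bit b) (⌊⌋-no (σ ⟨$⟩ʳ u Fin.<? σ ⟨$⟩ʳ v) ¬lt) (⌊⌋-yes (σ ⟨$⟩ʳ v Fin.<? σ ⟨$⟩ʳ u) gt))
      ...   | tri≈ _ e _ with trans (sym (Perm.inverseˡ σ)) (trans (cong (σ Perm.⟨$⟩ˡ_) e) (Perm.inverseˡ σ))
      ...     | refl = contradiction (trans (sym eq) (loop-free v)) λ ()

    -- Adding `l` to both arguments of the distance turns them into twice `l` and the degree.
    vertexImbalance≡ : ∀ v → vertexImbalance G v σ ≡ ∣ 2 * count (earlierIn v) - ∣ N G v ∣ ∣
    vertexImbalance≡ v = trans (sym (∣m+n-m+o∣≡∣n-o∣ l l r)) (cong₂ ∣_-_∣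
      (trans (cong (l +_) (sym (+-identityʳ l))) (cong (2 *_) (∣Nᴸ∣ v))) (sym (degree v)))
      where
      l = ∣ Nᴸ G v σ ∣
      r = ∣ Nᴿ G v σ ∣

    layoutImbalance≤ : layoutImbalance G σ ≤ n * n
    layoutImbalance≤ = ≤-trans (∑-mono λ v → ≤-trans (∣m-n∣≤m⊔n ∣ Nᴸ G v σ ∣ ∣ Nᴿ G v σ ∣)
      (⊔-lub (∣p∣≤n (Nᴸ G v σ)) (∣p∣≤n (Nᴿ G v σ)))) (≤-reflexive (∑-const n n))

  module Bridge {n : ℕ} (G : Graph n) (S : Subset n) where

    rows : List (List Bool)
    rows = toList (Vec.map toList (tabulate (N G)))

    marks : List Bool
    marks = toList S

    open Procedure.Main rows marks hiding (n)
    open Labellings.Labelled rows marks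

    length-rows : length rows ≡ n
    length-rows = length-toList (Vec.map toList (tabulate (N G)))

    verts≡ : verts ≡ range n
    verts≡ = cong range length-rows

    ∑-verts : ∀ f → Σ[ verts ] f ≡ ∑ {n} (f ∘ toℕ)
    ∑-verts f = trans (cong (λ xs → Σ[ xs ] f) verts≡) (range-∑ n f)

    toℕ∈verts : ∀ i → toℕ i List.∈ verts
    toℕ∈verts i = subst (toℕ i List.∈_) (sym verts≡) (∈-range⁺ {toℕ i} {n} (Fin.toℕ<n i))

    ∈verts⁻ : ∀ {x} → x List.∈ verts → ∃ λ i → x ≡ toℕ {n} i
    ∈verts⁻ x∈ = fromℕ< (∈-range⁻ {n = n} (subst (_ List.∈_) verts≡ x∈)) , sym (Fin.toℕ-fromℕ< _)

    row : ∀ v → nth [] rows (toℕ v) ≡ toList (N G v)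
    row v = trans (nth-toList [] (Vec.map toList (tabulate (N G))) v)
      (trans (lookup-map v toList (tabulate (N G))) (cong toList (lookup∘tabulate (N G) v)))

    edge≡ : ∀ v u → edge rows (toℕ v) (toℕ u) ≡ lookup (N G v) u
    edge≡ v u = trans (cong (λ r → nth false r (toℕ u)) (row v)) (nth-toList false (N G v) u)

    deg≡ : ∀ v → deg rows (toℕ v) ≡ ∣ N G v ∣
    deg≡ v = trans (cong (λ r → length (select id r)) (row v)) (select-toList (N G v))

    inCover≡ : ∀ v → inCover (toℕ v) ≡ lookup S v
    inCover≡ v = nth-toList false S v

    -- Only the order of adjacent vertices enters the imbalance. Agreement on edges is a weaker
    -- demand than agreement of the orders, and this is why few labels suffice.
    deviation-layout : ∀ σ K → (∀ v u → lookup (N G v) u ≡ true → (suc (K (toℕ u)) ≤?ᵇ K (toℕ v)) ≡ ⌊ σ ⟨$⟩ʳ u Fin.<? σ ⟨$⟩ʳ v ⌋) →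
                       Σ[ verts ] (deviation K) ≡ layoutImbalance G σ
    deviation-layout σ K agree = trans (∑-verts (deviation K)) (∑-cong λ v → trans
      (cong₂ (λ l d → ∣ 2 * l - d ∣) (trans (∑-verts (earlier K (toℕ v))) (∑-cong (bits v))) (deg≡ v))
      (sym (vertexImbalance≡ G σ v)))
      where
      bits : ∀ v u → earlier K (toℕ v) (toℕ u) ≡ bit (earlierIn G σ v u)
      bits v u = trans (cong (λ e → bit (e ∧ (suc (K (toℕ u)) ≤?ᵇ K (toℕ v)))) (edge≡ v u)) (go (lookup (N G v) u) refl)
        where
        go : ∀ e → lookup (N G v) u ≡ e → bit (lookup (N G v) u ∧ (suc (K (toℕ u)) ≤?ᵇ K (toℕ v))) ≡ bit (earlierIn G σ v u)
        go false eq rewrite eq = refl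
        go true  eq = cong (λ b → bit (lookup (N G v) u ∧ b)) (agree v u eq)

    -- The vertex is the remainder of its label modulo `n`, so labels are distinct and sorting by
    -- them gives a layout.
    labelled-layout : ∀ K → (∀ {v} → v List.∈ verts → Valid v (K v)) → ∃ λ σ → Σ[ verts ] (deviation K) ≡ layoutImbalance G σ
    labelled-layout K ok = σ , deviation-layout σ K λ v u e → Bool-ext
        (λ le → ⌊⌋-yes (σ ⟨$⟩ʳ u Fin.<? σ ⟨$⟩ʳ v) (ordering⁺ k (λ {i} {j} → k-injective {i} {j}) {u} {v} (≤?ᵇ-sound {suc (k u)} {k v} le)))
        (λ lt → ≤?ᵇ-complete (reflects {u} {v} (⌊⌋-sound (σ ⟨$⟩ʳ u Fin.<? σ ⟨$⟩ʳ v) lt)))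
      where
      k : Fin n → ℕ
      k = K ∘ toℕ
      below : ∀ i → ∃ λ j → k i ≡ toℕ i + n * j
      below i with ok (toℕ∈verts i)
      ... | j , _ , eq = j , trans eq (cong (λ m → toℕ i + m * j) length-rows)
      digits : ∀ {a b i j} → a < n → b < n → a + n * i ≡ b + n * j → a ≡ b
      digits {a} {b} {i} {j} a<n b<n eq with <-cmp i j
      ... | tri≈ _ refl _ = +-cancelʳ-≡ (n * i) a b eq
      ... | tri< lt _ _ = contradiction eq (<⇒≢ (<-≤-trans (+-monoˡ-< (n * i) a<n)
              (≤-trans (≤-reflexive (sym (*-suc n i))) (≤-trans (*-monoʳ-≤ n lt) (m≤n+m _ b)))))
      ... | tri> _ _ gt = contradiction (sym eq) (<⇒≢ (<-≤-trans (+-monoˡ-< (n * j) b<n)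
              (≤-trans (≤-reflexive (sym (*-suc n j))) (≤-trans (*-monoʳ-≤ n gt) (m≤n+m _ a)))))
      k-injective : ∀ {i j} → k i ≡ k j → i ≡ j
      k-injective {i} {j} eq = Fin.toℕ-injective (digits {i = proj₁ (below i)} {proj₁ (below j)} (Fin.toℕ<n i) (Fin.toℕ<n j)
        (trans (sym (proj₂ (below i))) (trans eq (proj₂ (below j)))))
      σ = ordering k (λ {i} {j} → k-injective {i} {j})
      reflects : ∀ {i j} → σ ⟨$⟩ʳ i Fin.< σ ⟨$⟩ʳ j → k i < k j
      reflects {i} {j} lt = go (<-cmp (k i) (k j))
        where
        go : Tri (k i < k j) (k i ≡ k j) (k j < k i) → k i < k j
        go (tri< l _ _) = l
        go (tri≈ _ e _) = contradiction (cong (λ u → toℕ (σ ⟨$⟩ʳ u)) (k-injective {i} {j} e)) (<⇒≢ lt)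
        go (tri> _ _ g) = contradiction (ordering⁺ k (λ {i} {j} → k-injective {i} {j}) {j} {i} g) (<⇒≯ lt)

    module _ (twins : ∀ {u v} → u List.∈ verts → v List.∈ verts → inCover u ≡ false → inCover v ≡ false →
                      edge rows v u ≡ true → rep u ≡ rep v) (σ : Layout n) where

      private
        infix 5 _≺_
        _≺_ : Fin n → Fin n → Bool
        u ≺ v = ⌊ σ ⟨$⟩ʳ u Fin.<? σ ⟨$⟩ʳ v ⌋

        before-trans : ∀ {u v w} → u ≺ v ≡ true → σ ⟨$⟩ʳ v Fin.< σ ⟨$⟩ʳ w → u ≺ w ≡ true
        before-trans {u} {v} {w} p lt = ⌊⌋-yes (σ ⟨$⟩ʳ u Fin.<? σ ⟨$⟩ʳ w) (<-trans (⌊⌋-sound (σ ⟨$⟩ʳ u Fin.<? σ ⟨$⟩ʳ v) p) lt)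

        before-irrefl : ∀ v → v ≺ v ≡ false
        before-irrefl v = ⌊⌋-no (σ ⟨$⟩ʳ v Fin.<? σ ⟨$⟩ʳ v) (<-irrefl refl)

        -- In the gap after g vertices of the cover, the vertices of a component get
        -- the slots 0, 1, …, and the next vertex of the cover the last slot.
        gap rank slot label : Fin n → ℕ
        gap v  = count (λ u → inCover (toℕ u) ∧ (u ≺ v))
        rank v = count (λ u → inComp (rep (toℕ v)) (toℕ u) ∧ (u ≺ v))
        slot v = if inCover (toℕ v) then size else rank v
        label v = slot v + gap v * suc size

        gap≤ : ∀ v → gap v ≤ length cover
        gap≤ v = ≤-trans (count-mono (λ u → inCover (toℕ u) ∧ (u ≺ v)) (inCover ∘ toℕ) λ u p → proj₁ (∧-true p))
          (≤-reflexive (sym (trans (cong (λ xs → length (select inCover xs)) verts≡) (select-count n inCover))))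

        rank< : ∀ v → inCover (toℕ v) ≡ false → rank v < size
        rank< v cv = <-≤-trans (count-strict (λ u → inComp (rep (toℕ v)) (toℕ u) ∧ (u ≺ v)) (inComp (rep (toℕ v)) ∘ toℕ) (λ u p → proj₁ (∧-true p)) v
            (trans (cong (inComp (rep (toℕ v)) (toℕ v) ∧_) (before-irrefl v)) (∧-zeroʳ _))
            (subst (λ b → not b ∧ (rep (toℕ v) ≡?ᵇ rep (toℕ v)) ≡ true) (sym cv) (Labellings.≡?ᵇ-refl (rep (toℕ v)))))
          (≤-trans (≤-reflexive (sym (trans (cong (λ xs → length (select (inComp (rep (toℕ v))) xs)) verts≡) (select-count n (inComp (rep (toℕ v)))))))
            (comp≤size (rep∈ (toℕ∈verts v))))

        slot≤ : ∀ v → slot v ≤ size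
        slot≤ v = go (inCover (toℕ v)) refl
          where
          go : ∀ b → inCover (toℕ v) ≡ b → slot v ≤ size
          go true  eq rewrite eq = ≤-refl
          go false eq = subst (λ b → (if b then size else rank v) ≤ size) (sym eq) (<⇒≤ (rank< v eq))

        label< : ∀ v → label v < labels
        label< v = s≤s (+-mono-≤ (slot≤ v) (*-monoˡ-≤ (suc size) (gap≤ v)))

        next-gap : ∀ {u v} → gap u < gap v → label u < label v
        next-gap {u} {v} lt = ≤-trans (s≤s (+-monoˡ-≤ (gap u * suc size) (slot≤ u)))
          (≤-trans (*-monoˡ-≤ (suc size) lt) (m≤n+m _ (slot v)))

        gap-mono : ∀ {u v} → σ ⟨$⟩ʳ u Fin.< σ ⟨$⟩ʳ v → gap u ≤ gap v
        gap-mono {u} {v} lt = count-mono (λ w → inCover (toℕ w) ∧ (w ≺ u)) (λ w → inCover (toℕ w) ∧ (w ≺ v)) λ w p → let c , b = ∧-true p in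
          cong₂ _∧_ c (before-trans {w} {u} {v} b lt)

        -- A cover vertex `u` counts in the gap of `v` but not in its own, so the gap grows. Within
        -- one gap, a cover vertex `v` has the last slot and thus follows `u`; if neither is in the
        -- cover, adjacency puts them into the same component, where `u` has the smaller rank.
        label-mono : ∀ {u v} → lookup (N G v) u ≡ true → σ ⟨$⟩ʳ u Fin.< σ ⟨$⟩ʳ v → label u < label v
        label-mono {u} {v} e lt = go (inCover (toℕ u)) (inCover (toℕ v)) refl refl (m≤n⇒m<n∨m≡n (gap-mono {u} {v} lt))
          where
          go : ∀ b c → inCover (toℕ u) ≡ b → inCover (toℕ v) ≡ c → gap u < gap v ⊎ gap u ≡ gap v → label u < label v
          go b c cu cv (inj₁ g<) = next-gap {u} {v} g<
          go true c cu cv (inj₂ _) = next-gap {u} {v} (count-strict (λ w → inCover (toℕ w) ∧ (w ≺ u)) (λ w → inCover (toℕ w) ∧ (w ≺ v))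
            (λ w p → let c , b = ∧-true p in cong₂ _∧_ c (before-trans {w} {u} {v} b lt)) u
            (trans (cong (inCover (toℕ u) ∧_) (before-irrefl u)) (∧-zeroʳ _))
            (cong₂ _∧_ cu (⌊⌋-yes (σ ⟨$⟩ʳ u Fin.<? σ ⟨$⟩ʳ v) lt)))
          go false true cu cv (inj₂ g≡) = subst₂ (λ b c → (if b then size else rank u) + gap u * suc size <
              (if c then size else rank v) + gap v * suc size) (sym cu) (sym cv)
            (+-mono-<-≤ (rank< u cu) (≤-reflexive (cong (_* suc size) g≡)))
          go false false cu cv (inj₂ g≡) = subst₂ (λ b c → (if b then size else rank u) + gap u * suc size <
              (if c then size else rank v) + gap v * suc size) (sym cu) (sym cv)
            (+-mono-<-≤ rank-lt (≤-reflexive (cong (_* suc size) g≡)))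
            where
            same : rep (toℕ u) ≡ rep (toℕ v)
            same = twins (toℕ∈verts u) (toℕ∈verts v) cu cv (trans (edge≡ v u) e)
            rank-lt : rank u < rank v
            rank-lt = count-strict (λ w → inComp (rep (toℕ u)) (toℕ w) ∧ (w ≺ u)) (λ w → inComp (rep (toℕ v)) (toℕ w) ∧ (w ≺ v))
              (λ w p → let c , b = ∧-true p in cong₂ _∧_ (subst (λ r → inComp r (toℕ w) ≡ true) same c) (before-trans {w} {u} {v} b lt)) u
              (trans (cong (inComp (rep (toℕ u)) (toℕ u) ∧_) (before-irrefl u)) (∧-zeroʳ _))
              (cong₂ _∧_ (subst₂ (λ b r → not b ∧ (rep (toℕ u) ≡?ᵇ r) ≡ true) (sym cu) same (Labellings.≡?ᵇ-refl (rep (toℕ u))))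
                (⌊⌋-yes (σ ⟨$⟩ʳ u Fin.<? σ ⟨$⟩ʳ v) lt))

        -- Labels are compared first and vertex numbers only break ties, as these are less than `n`.
        -- The list extends `label` from `Fin n` to all numbers.
        K : ℕ → ℕ
        K x = x + length rows * nth 0 (toList (tabulate label)) x

        K≡ : ∀ v → K (toℕ v) ≡ toℕ v + length rows * label v
        K≡ v = cong (λ l → toℕ v + length rows * l) (trans (nth-toList 0 (tabulate label) v) (lookup∘tabulate label v))

        K-valid : ∀ {x} → x List.∈ verts → Valid x (K x)
        K-valid x∈ with ∈verts⁻ x∈
        ... | v , refl = label v , label< v , K≡ v

        K-mono : ∀ {u v} → label u < label v → K (toℕ u) < K (toℕ v)
        K-mono {u} {v} lt = subst₂ _<_ (sym (K≡ u)) (sym (K≡ v)) (<-≤-trans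
          (+-monoˡ-< (length rows * label u) (<-≤-trans (Fin.toℕ<n u) (≤-reflexive (sym length-rows))))
          (≤-trans (≤-reflexive (sym (*-suc (length rows) (label u)))) (≤-trans (*-monoʳ-≤ (length rows) lt) (m≤n+m _ (toℕ v)))))

        edge-sym : ∀ v u → lookup (N G v) u ≡ true → lookup (N G u) v ≡ true
        edge-sym v u e = []=⇒lookup (symmetric G (lookup⇒[]= u (N G v) e))

      layout-labelled : ∃ λ K → (∀ {v} → v List.∈ verts → Valid v (K v)) × Σ[ verts ] (deviation K) ≡ layoutImbalance G σ
      layout-labelled = K , K-valid , deviation-layout σ K agree
        where
        agree : ∀ v u → lookup (N G v) u ≡ true → (suc (K (toℕ u)) ≤?ᵇ K (toℕ v)) ≡ u ≺ v
        agree v u e = go (Fin.<-cmp (σ ⟨$⟩ʳ u) (σ ⟨$⟩ʳ v))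
          where
          no-bool : ∀ b → ¬ (b ≡ true) → b ≡ false
          no-bool true  f = contradiction refl f
          no-bool false _ = refl
          go : Tri (σ ⟨$⟩ʳ u Fin.< σ ⟨$⟩ʳ v) (σ ⟨$⟩ʳ u ≡ σ ⟨$⟩ʳ v) (σ ⟨$⟩ʳ v Fin.< σ ⟨$⟩ʳ u) →
               (suc (K (toℕ u)) ≤?ᵇ K (toℕ v)) ≡ (u ≺ v)
          go (tri< lt _ _)  = trans (≤?ᵇ-complete (K-mono {u} {v} (label-mono e lt))) (sym (⌊⌋-yes (σ ⟨$⟩ʳ u Fin.<? σ ⟨$⟩ʳ v) lt))
          go (tri> ¬lt _ gt) = trans (no-bool _ λ le → <⇒≯ (≤?ᵇ-sound {suc (K (toℕ u))} {K (toℕ v)} le) (K-mono {v} {u} (label-mono (edge-sym v u e) gt)))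
                                     (sym (⌊⌋-no (σ ⟨$⟩ʳ u Fin.<? σ ⟨$⟩ʳ v) ¬lt))
          go (tri≈ _ eq _) = contradiction (trans (sym (subst (λ w → lookup (N G v) w ≡ true) u≡v e)) (loop-free G σ v)) λ ()
            where
            u≡v : u ≡ v
            u≡v = trans (sym (Perm.inverseˡ σ)) (trans (cong (σ Perm.⟨$⟩ˡ_) eq) (Perm.inverseˡ σ))

-- Computed components and true components

module TwinCovers where

  open Routines
  open LocalSearch using (edge)
  open Optimality using (∈-select⁺)
  open Labellings using (Σ[_]; ∈-select⁻; ≡?ᵇ-refl)
  open Layouts
  open import Data.Bool.Base using (Bool; true; false; if_then_else_; _∧_; _∨_; not)
  import Data.Bool.Properties as Bool
  open import Data.Fin.Base as Fin using (Fin; zero; suc; toℕ)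
  import Data.Fin.Permutation as Perm
  import Data.Fin.Properties as Fin
  open import Data.Fin.Subset using (Subset; _∈_; _∉_; ⁅_⁆)
  open import Data.Fin.Subset.Properties using (x∈⁅x⁆; x∈⁅y⁆⇒x≡y)
  open import Data.List.Base as List using (List; []; _∷_; length)
  import Data.List.Membership.Propositional as List
  open import Data.List.Relation.Unary.Any using (here; there)
  open import Data.Nat.Base as ℕ using (ℕ; zero; suc; _*_; _≤_; z≤n)
  open import Data.Nat.Properties
  open import Data.Product.Base using (∃; _×_; _,_; proj₁; proj₂)
  open import Data.Sum.Base using (_⊎_; inj₁; inj₂)
  open import Data.Vec.Base as Vec using (Vec; tabulate; lookup)
  open import Data.Vec.Properties using (lookup∘tabulate; lookup-zipWith; lookup⇒[]=; []=⇒lookup; ≡-dec)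
  open import Function.Base using (_∘_; id)
  open import Function.Bundles using (_⇔_; mk⇔; Equivalence)
  open import Relation.Binary.Construct.Closure.ReflexiveTransitive using (ε; _◅_)
  open import Relation.Binary.PropositionalEquality hiding ([_])
  open import Relation.Nullary using (yes; no; contradiction; ¬_; Dec; does)
  open import Relation.Nullary.Decidable using (decidable-stable; ¬¬-excluded-middle)

  -- To present a component as a `Subset` its membership must be decided. What is concluded from the
  -- twin cover and its bound is decidable, hence stable under double negation, so it is enough that
  -- reachability is not undecidable at each of finitely many vertices.
  ¬¬-decide : ∀ {n} {P : Fin n → Set} → ¬ ¬ (∀ i → Dec (P i))
  ¬¬-decide {zero}  k = k λ ()
  ¬¬-decide {suc n} k = ¬¬-excluded-middle λ d → ¬¬-decide λ ds → k λ { zero → d ; (suc i) → ds i }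

  select-cong : ∀ {A : Set} {p q : A → Bool} xs → (∀ {x} → x List.∈ xs → p x ≡ q x) → select p xs ≡ select q xs
  select-cong []       eq = refl
  select-cong (x ∷ xs) eq = cong₂ (λ b ys → if b then x ∷ ys else ys) (eq (here refl)) (select-cong xs (eq ∘ there))

  headOr-∈ : ∀ {A : Set} d {x : A} {xs} → x List.∈ xs → headOr d xs List.∈ xs
  headOr-∈ d {xs = _ ∷ _} _ = here refl

  headOr-cong : ∀ {A : Set} d d′ {x : A} {xs} → x List.∈ xs → headOr d xs ≡ headOr d′ xs
  headOr-cong d d′ {xs = _ ∷ _} _ = refl

  module Correct {n : ℕ} (G : Graph n) (S : Subset n) where
    open Bridge G S
    open Procedure.Main rows marks hiding (n)
    open Labellings.Labelled rows marks

    outside-∉ : ∀ {v} → inCover (toℕ v) ≡ false → v ∉ S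
    outside-∉ {v} cv v∈ = contradiction (trans (sym ([]=⇒lookup v∈)) (trans (sym (inCover≡ v)) cv)) λ ()

    Component : Fin n → Subset n → Set
    Component v X = ∀ u → u ∈ X ⇔ Reachable G S v u

    ¬¬-component : ∀ v → ¬ ¬ ∃ (Component v)
    ¬¬-component v k = ¬¬-decide λ reach? → k (tabulate (λ u → does (reach? u)) , λ u → mk⇔
      (λ u∈ → sound (reach? u) (trans (sym (lookup∘tabulate _ u)) ([]=⇒lookup u∈)))
      (λ r → lookup⇒[]= u _ (trans (lookup∘tabulate _ u) (complete (reach? u) r))))
      where
      sound : ∀ {P : Set} (d : Dec P) → does d ≡ true → P
      sound (yes p) _ = p
      complete : ∀ {P : Set} (d : Dec P) → P → does d ≡ true
      complete (yes _) _ = refl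
      complete (no ¬p) p = contradiction p ¬p

    adjacent : ∀ {u v} → inCover (toℕ u) ≡ false → inCover (toℕ v) ≡ false → edge rows (toℕ u) (toℕ v) ≡ true → Adjacent G S u v
    adjacent {u} {v} cu cv e = outside-∉ cu , outside-∉ cv , lookup⇒[]= v (N G u) (trans (sym (edge≡ u v)) e)

    neighbourhood : Fin n → Fin n → Bool
    neighbourhood v u = if edge rows (toℕ v) (toℕ u) then true else (toℕ u ≡?ᵇ toℕ v)

    neighbourhood≡ : ∀ v u → neighbourhood v u ≡ lookup (N[_] G v) u
    neighbourhood≡ v u = trans (cong₂ (λ a b → if a then true else b) (edge≡ v u) single)
      (trans (if-or (lookup (N G v) u)) (sym (lookup-zipWith _∨_ u (N G v) ⁅ v ⁆)))
      where
      if-or : ∀ a {b} → (if a then true else b) ≡ a ∨ b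
      if-or true  = refl
      if-or false = refl
      single : (toℕ u ≡?ᵇ toℕ v) ≡ lookup ⁅ v ⁆ u
      single = Bool-ext
        (λ eq → subst (λ w → lookup ⁅ v ⁆ w ≡ true) (sym (Fin.toℕ-injective (≡?ᵇ-sound {toℕ u} {toℕ v} eq))) ([]=⇒lookup (x∈⁅x⁆ v)))
        (λ l → ≡?ᵇ-complete {toℕ u} {toℕ v} (cong toℕ (x∈⁅y⁆⇒x≡y v (lookup⇒[]= u ⁅ v ⁆ l))))

    near-self : ∀ {v} → inCover v ≡ false → near v v ≡ true
    near-self {v} cv = trans (cong₂ (λ c e → not c ∧ (if edge rows v v then true else e)) cv (≡?ᵇ-refl v)) (const-true (edge rows v v))
      where
      const-true : ∀ b → (if b then true else true) ≡ true
      const-true true  = refl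
      const-true false = refl

    self∈ : ∀ {v} → v List.∈ verts → inCover v ≡ false → v List.∈ select (near v) verts
    self∈ {v} v∈ cv = ∈-select⁺ (near v) v∈ (near-self {v} cv)

    rep-near : ∀ {v} → v List.∈ verts → inCover v ≡ false → near v (rep v) ≡ true
    rep-near {v} v∈ cv = proj₂ (∈-select⁻ (near v) {xs = verts} (headOr-∈ v (self∈ {v} v∈ cv)))

    module _ (twinCover : IsTwinCover G S) where

      same-neighbourhood : ∀ {u v} → inCover (toℕ u) ≡ false → inCover (toℕ v) ≡ false →
                           edge rows (toℕ v) (toℕ u) ≡ true → N[_] G v ≡ N[_] G u
      same-neighbourhood {u} {v} cu cv e = decidable-stable (≡-dec Bool._≟_ (N[_] G v) (N[_] G u)) λ ≢ →
        ¬¬-component v λ (X , component) → ≢ (twinCover X (v , outside-∉ cv , component) v u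
          (Equivalence.from (component v) ε) (Equivalence.from (component u) (adjacent cv cu e ◅ ε)))

      -- Equal closed neighbourhoods give equal lists of near vertices; these contain the vertex
      -- itself, so their heads agree although the defaults differ.
      twins : ∀ {u v} → u List.∈ verts → v List.∈ verts → inCover u ≡ false → inCover v ≡ false →
              edge rows v u ≡ true → rep u ≡ rep v
      twins u∈ v∈ cu cv e with ∈verts⁻ u∈ | ∈verts⁻ v∈
      ... | i , refl | j , refl = trans (headOr-cong (toℕ i) (toℕ j) (self∈ {toℕ i} u∈ cu))
        (cong (headOr (toℕ j)) (select-cong verts agree))
        where
        agree : ∀ {w} → w List.∈ verts → near (toℕ i) w ≡ near (toℕ j) w
        agree w∈ with ∈verts⁻ w∈
        ... | k , refl = cong (not (inCover (toℕ k)) ∧_) (trans (neighbourhood≡ i k)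
          (trans (cong (λ X → lookup X k) (sym (same-neighbourhood {i} {j} cu cv e))) (sym (neighbourhood≡ j k))))

      value≡imbalance : value ≡ imbalance G
      value≡imbalance = ≤-antisym upper (lower (value-attained twins))
        where
        upper : value ≤ imbalance G
        upper = ≤-trans (value≤ twins (proj₁ found) (proj₁ (proj₂ found))) (≤-reflexive (proj₂ (proj₂ found)))
          where
          found = layout-labelled twins (optimalLayout G)
        lower : value ≡ length rows * length rows ⊎ (∃ λ K → (∀ {v} → v List.∈ verts → Valid v (K v)) × value ≡ Σ[ verts ] (deviation K)) →
                imbalance G ≤ value
        lower (inj₁ eq) = ≤-trans (imbalance-minimal G Perm.id) (≤-trans (layoutImbalance≤ G Perm.id)
          (≤-reflexive (sym (trans eq (cong₂ _*_ length-rows length-rows)))))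
        lower (inj₂ (K , ok , eq)) = ≤-trans (imbalance-minimal G (proj₁ found)) (≤-reflexive (sym (trans eq (proj₂ found))))
          where
          found = labelled-layout K ok

    module _ {ℓ : ℕ} (bounded : IsBounded G S ℓ) where

      private
        -- The representative of `w` belongs to the closed neighbourhood of `w`, so `i` is `w`
        -- itself or a neighbour of it outside the cover.
        reach : ∀ i w → inCover (toℕ i) ≡ false → inComp (toℕ i) (toℕ w) ≡ true → Reachable G S i w
        reach i w ci w∈ = close (edge rows (toℕ w) (toℕ i)) refl
          where
          member : toℕ w List.∈ comp (toℕ i)
          member = ∈-select⁺ (inComp (toℕ i)) (toℕ∈verts w) w∈
          cw : inCover (toℕ w) ≡ false
          cw = proj₁ (proj₂ (comp-rep {toℕ i} member))
          near-i : near (toℕ w) (toℕ i) ≡ true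
          near-i = subst (λ x → near (toℕ w) x ≡ true) (proj₂ (proj₂ (comp-rep {toℕ i} member))) (rep-near (toℕ∈verts w) cw)
          close : ∀ b → edge rows (toℕ w) (toℕ i) ≡ b → Reachable G S i w
          close true  e = let w∉ , i∉ , i∈ = adjacent {w} {i} cw ci e in (i∉ , w∉ , symmetric G i∈) ◅ ε
          close false e = subst (Reachable G S i) (Fin.toℕ-injective (≡?ᵇ-sound {toℕ i} {toℕ w}
            (subst (λ b → (if b then true else (toℕ i ≡?ᵇ toℕ w)) ≡ true) e (proj₂ (∧-true {not (inCover (toℕ i))} near-i))))) ε

        centred : ∀ i → inCover (toℕ i) ≡ false → length (comp (toℕ i)) ≤ ℓ
        centred i ci = decidable-stable (length (comp (toℕ i)) ≤? ℓ) λ ≰ → ¬¬-component i λ (X , component) →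
          ≰ (≤-trans (≤-reflexive (trans (cong (λ xs → length (select (inComp (toℕ i)) xs)) verts≡) (select-count n (inComp (toℕ i)))))
              (≤-trans (count-mono (inComp (toℕ i) ∘ toℕ) (lookup X) λ w w∈ →
                  []=⇒lookup (Equivalence.from (component w) (reach i w ci w∈)))
                (≤-trans (≤-reflexive (sym (∣∣-count X))) (bounded X (i , outside-∉ ci , component)))))

        -- If `comp r` contains `u`, then `r` is the representative of `u` and therefore a vertex
        -- outside the cover, to which `centred` applies.
        inhabited : ∀ {r u} → u List.∈ comp r → length (comp r) ≤ ℓ
        inhabited {r} {u} u∈ = subst (λ r → length (comp r) ≤ ℓ) (sym r≡) (centred (proj₁ index)
            (subst (λ x → inCover x ≡ false) (trans rep≡ r≡) (not-true (proj₁ (∧-true {not (inCover (rep u))} (rep-near u∈verts cu))))))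
          where
          u∈verts = proj₁ (comp-rep {r} u∈)
          cu      = proj₁ (proj₂ (comp-rep {r} u∈))
          rep≡    = proj₂ (proj₂ (comp-rep {r} u∈))
          index   = ∈verts⁻ (subst (List._∈ verts) rep≡ (rep∈ u∈verts))
          r≡      = proj₂ index

      comp≤ : ∀ r → length (comp r) ≤ ℓ
      comp≤ r = go (comp r) refl
        where
        go : ∀ us → comp r ≡ us → length (comp r) ≤ ℓ
        go []       eq = ≤-trans (≤-reflexive (cong length eq)) z≤n
        go (u ∷ us) eq = inhabited (subst (u List.∈_) (sym eq) (here refl))

-- Binary numerals, the comparison with the limit, and the final time bound

module Answer where

  open PolynomialTime
  open Routines
  open LocalSearch
  open Procedure
  open Layouts hiding (degree)
  open TwinCovers
  open import Data.Bool.Base using (Bool; true; false; if_then_else_)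
  open import Data.Fin.Patterns using (0F; 1F; 2F)
  open import Data.Fin.Base using (toℕ)
  open import Data.Fin.Subset using (Subset; ∣_∣)
  import Data.Integer as ℤ
  open ℤ using (ℤ)
  import Data.Integer.Properties as ℤₚ
  open import Data.List.Base as List using (List; []; _∷_; _++_; foldr; length; _ʳ++_)
  open import Data.List.Properties using (foldr-++)
  open import Data.Nat using (ℕ; zero; suc; _+_; _*_; _^_; _≤_; z≤n; s≤s; s≤s⁻¹)
  open import Data.Nat.Binary.Base as ℕᵇ using (ℕᵇ; 2[1+_]; 1+[2_])
  import Data.Nat.Binary.Properties as ℕᵇ
  open import Data.Nat.Properties 
  open import Data.Product using (∃; _×_; _,_; proj₁; proj₂)
  open import Data.Vec as Vec using (Vec; []; _∷_; toList; tabulate)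

  open import Function.Base using (id)
  open import Relation.Binary.PropositionalEquality hiding ([_])

  open import Relation.Nullary.Decidable using (⌊_⌋)

  private
    variable
      E : Ty

  -- Binary numerals, measured by their value and not by their length.
  Binᵗ Digitsᵗ : Ty
  Binᵗ    = base ℕ encodeℕ id
  Digitsᵗ = Listᵗ Boolᵗ

  digits : ℕᵇ → List Bool
  digits ℕᵇ.zero  = []
  digits 2[1+ b ] = true ∷ digits b
  digits 1+[2 b ] = false ∷ digits b

  enc-digits : ∀ b → encodeℕᵇ b ≡ enc Digitsᵗ (digits b)
  enc-digits ℕᵇ.zero  = refl
  enc-digits 2[1+ b ] = cong (cons _) (enc-digits b)
  enc-digits 1+[2 b ] = cong (cons _) (enc-digits b)

  -- A carry travels from the lowest digit, but the fold starts at the highest. Every suffix is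
  -- therefore kept both unchanged and incremented: digit 2 (`true`) becomes 1 with a carry into the
  -- suffix, digit 1 becomes 2 without one.
  increment-step : Bool → List Bool × List Bool → List Bool × List Bool
  increment-step d p = d ∷ proj₁ p , (if d then false ∷ proj₂ p else true ∷ proj₁ p)

  increment : List Bool → List Bool
  increment ds = proj₂ (foldr increment-step ([] , false ∷ []) ds)

  increment-fst : ∀ ds → proj₁ (foldr increment-step ([] , false ∷ []) ds) ≡ ds
  increment-fst []       = refl
  increment-fst (d ∷ ds) = cong (d ∷_) (increment-fst ds)

  increment-digits : ∀ b → increment (digits b) ≡ digits (ℕᵇ.suc b)
  increment-digits ℕᵇ.zero  = refl
  increment-digits 2[1+ b ] = cong (false ∷_) (increment-digits b)
  increment-digits 1+[2 b ] = cong (true ∷_) (increment-fst (digits b))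

  μ-increment : ∀ ds → μ Digitsᵗ (increment ds) ≤ 1 + μ Digitsᵗ ds
  μ-increment []           = ≤-refl
  μ-increment (true ∷ ds)  = s≤s (μ-increment ds)
  μ-increment (false ∷ ds) = ≤-trans (≤-reflexive (cong (λ xs → 1 + μ Digitsᵗ xs) (increment-fst ds))) (n≤1+n _)

  incrementᵖ : ∀ {f} → PT E Digitsᵗ f → PT E Digitsᵗ (λ e → increment (f e))
  incrementᵖ {f = f} P = sndᵖ (foldᵖ P (const′ [] ,ᵖ const′ (false ∷ []))
    ((fstᵖ π₂ ∷ᵖ fstᵖ (sndᵖ π₂)) ,ᵖ ifᵖ (fstᵖ π₂) (const′ false ∷ᵖ sndᵖ (sndᵖ π₂)) (const′ true ∷ᵖ fstᵖ (sndᵖ π₂)))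
    (O-+ (size-O P) (O-+ (O-const 1) (size-O P)))
    λ e ys zs s → +-mono-≤ (≤-trans (≤-reflexive (cong (μ Digitsᵗ) (increment-fst zs))) (suffix-μ (μ Boolᵗ) ys zs s))
      (≤-trans (μ-increment zs) (s≤s (suffix-μ (μ Boolᵗ) ys zs s))))

  digits-fromℕ : ∀ n → digits (ℕᵇ.fromℕ n) ≡ repeat increment [] n
  digits-fromℕ n = trans (cong digits (ℕᵇ.fromℕ≡fromℕ' n)) (go n)
    where
    go : ∀ n → digits (ℕᵇ.fromℕ' n) ≡ repeat increment [] n
    go zero    = refl
    go (suc n) = trans (sym (increment-digits (ℕᵇ.fromℕ' n))) (cong increment (go n))

  digitsᵖ : ∀ {f} → PT E ℕᵗ f → PT E Digitsᵗ (λ e → digits (ℕᵇ.fromℕ (f e)))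
  digitsᵖ {f = f} P = ext (λ e → sym (digits-fromℕ (f e))) (repeatᵖ P (const′ []) (incrementᵖ π₂) (size-O P)
    λ e i i≤ → ≤-trans (go i) i≤)
    where
    go : ∀ i → μ Digitsᵗ (repeat increment [] i) ≤ i
    go zero    = z≤n
    go (suc i) = ≤-trans (μ-increment (repeat increment [] i)) (s≤s (go i))

  binaryᵖ : ∀ {f} → PT E ℕᵗ f → PT E Binᵗ f
  binaryᵖ {E} {f} P = mkPT (prog D) (time D)
    (λ ρ e → subst (λ t → _ ⊢ prog D ⇓ t [ time D e ]) (sym (enc-digits (ℕᵇ.fromℕ (f e)))) (run D ρ e)) (time-O D) (size-O P)
    where
    D : PT E Digitsᵗ (λ e → digits (ℕᵇ.fromℕ (f e)))
    D = digitsᵖ P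

  digitValue : Bool → ℕ → ℕ
  digitValue d v = if d then 2 + (v + v) else 1 + (v + v)

  valueOf : List Bool → ℕ
  valueOf = foldr digitValue 0

  double : ∀ v → v + v ≡ 2 * v
  double v = cong (λ w → v + w) (sym (+-identityʳ v))

  valueOf-digits : ∀ b → valueOf (digits b) ≡ ℕᵇ.toℕ b
  valueOf-digits ℕᵇ.zero  = refl
  valueOf-digits 2[1+ b ] rewrite valueOf-digits b = trans (cong (2 +_) (double (ℕᵇ.toℕ b))) (sym (*-suc 2 (ℕᵇ.toℕ b)))
  valueOf-digits 1+[2 b ] rewrite valueOf-digits b = cong suc (double (ℕᵇ.toℕ b))

  valueOf-fromℕ : ∀ n → valueOf (digits (ℕᵇ.fromℕ n)) ≡ n
  valueOf-fromℕ n = trans (valueOf-digits (ℕᵇ.fromℕ n)) (ℕᵇ.toℕ-fromℕ n)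

  ≤-digitValue : ∀ d v → v ≤ digitValue d v
  ≤-digitValue true  v = ≤-trans (m≤m+n v v) (m≤n+m _ 2)
  ≤-digitValue false v = ≤-trans (m≤m+n v v) (m≤n+m _ 1)

  length≤valueOf : ∀ ds → μ Digitsᵗ ds ≤ valueOf ds
  length≤valueOf []           = z≤n
  length≤valueOf (true ∷ ds)  = s≤s (≤-trans (length≤valueOf ds) (≤-trans (m≤m+n _ _) (n≤1+n _)))
  length≤valueOf (false ∷ ds) = s≤s (≤-trans (length≤valueOf ds) (m≤m+n _ _))

  suffix-valueOf : ∀ {l} ys zs → l ≡ ys ʳ++ zs → valueOf zs ≤ valueOf l
  suffix-valueOf []       zs refl = ≤-refl
  suffix-valueOf (y ∷ ys) zs eq   = ≤-trans (≤-digitValue y (valueOf zs)) (suffix-valueOf ys (y ∷ zs) eq)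

  -- Doubling stays within the measure, since the value of every suffix of the digits is at most the
  -- value of the whole numeral.
  unaryᵇ : ∀ {f} → PT E Binᵗ f → PT E ℕᵗ f
  unaryᵇ {E} {f} P = ext (λ e → valueOf-fromℕ (f e)) (foldᵖ
    (P ▸ recode (λ n → digits (ℕᵇ.fromℕ n)) (λ n → enc-digits (ℕᵇ.fromℕ n))
      (O-mono (λ n → ≤-trans (length≤valueOf (digits (ℕᵇ.fromℕ n))) (≤-reflexive (valueOf-fromℕ n))) O-μ))
    (const′ 0)
    (ifᵖ (fstᵖ π₂) (sucᵖ (sucᵖ (sndᵖ π₂ +ᵖ sndᵖ π₂))) (sucᵖ (sndᵖ π₂ +ᵖ sndᵖ π₂)))
    (size-O P) λ e ys zs s → ≤-trans (suffix-valueOf ys zs s) (≤-reflexive (valueOf-fromℕ (f e))))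

  powᵖ : ∀ c {f} → PT E ℕᵗ f → PT E ℕᵗ (λ e → f e ^ c)
  powᵖ zero    P = const′ 1
  powᵖ (suc c) P = P *ᵖ powᵖ c P

  -- `Computable₂` asks for some halting time without a bound, so the measure can be the very value
  -- that is to be computed.
  Paramᵗ : Ty
  Paramᵗ = base (ℕ × ℕ) (λ (k , ℓ) → cons (encodeℕ k) (encodeℕ ℓ)) (λ (k , ℓ) → budget k ℓ)

  budgetᵖ : PT Paramᵗ ℕᵗ (λ (k , ℓ) → budget k ℓ)
  budgetᵖ = towerᵖ (sucᵖ (sucᵖ b)) b O-μ λ _ → ≤-refl
    where
    param≤ : ∀ k ℓ → k + ℓ ≤ budget k ℓ
    param≤ k ℓ = ≤-trans (≤-trans (+-mono-≤ (n≤1+n k) (m≤n*m ℓ (suc k))) (≤-reflexive (sym (*-suc (suc k) ℓ))))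
      (tower-mono {j = 2 + suc k * suc ℓ} z≤n ≤-refl)
    input : PT Paramᵗ (Binᵗ ×ᵗ Binᵗ) id
    input = recode id (λ _ → refl) (O-mono (λ (k , ℓ) → param≤ k ℓ) O-μ)
    b : PT Paramᵗ ℕᵗ (λ (k , ℓ) → suc k * suc ℓ)
    b = sucᵖ (unaryᵇ (input ▸ π₁)) *ᵖ sucᵖ (unaryᵇ (input ▸ π₂))

  computable : ∀ c → Computable₂ (λ k ℓ → (2 + budget k ℓ) ^ c)
  computable c = let′ (cons (var 0F) (var 1F)) (prog P) , λ k ℓ → _ ,
    let′ (cons (var 0F) (var 1F)) (run P _ (k , ℓ))
    where
    P : PT Paramᵗ Binᵗ (λ (k , ℓ) → (2 + budget k ℓ) ^ c)
    P = binaryᵖ (powᵖ c (sucᵖ (sucᵖ budgetᵖ)))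

  isNil : Tree → Bool
  isNil nil        = true
  isNil (cons _ _) = false

  fstᵀ sndᵀ : Tree → Tree
  fstᵀ nil        = nil
  fstᵀ (cons a _) = a
  sndᵀ nil        = nil
  sndᵀ (cons _ b) = b

  isNilᵖ : ∀ {f} → PT E Treeᵗ f → PT E Boolᵗ (λ e → isNil (f e))
  isNilᵖ {E} {f} P = mkPT (case (prog P) (cons nil nil) nil) (λ e → 1 + time P e + t (f e))
    (λ ρ e → go ρ e (f e) (run P ρ e)) (O-+ (O-+ (O-const 1) (time-O P)) (O-mono t≤ (O-const 3))) (O-const 0)
    where
    t : Tree → ℕ
    t nil        = 3
    t (cons _ _) = 1
    t≤ : ∀ e → t (f e) ≤ 3
    t≤ e with f e
    ... | nil      = ≤-refl
    ... | cons _ _ = s≤s z≤n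
    go : ∀ {m} (ρ : Vec Tree m) e u → (enc E e ∷ ρ) ⊢ prog P ⇓ u [ time P e ] →
         (enc E e ∷ ρ) ⊢ case (prog P) (cons nil nil) nil ⇓ encodeBool (isNil u) [ 1 + time P e + t u ]
    go ρ e nil        d = case-nil d (cons nil nil)
    go ρ e (cons _ _) d = case-cons d nil

  fstᵀᵖ : ∀ {f} → PT E Treeᵗ f → PT E Treeᵗ (λ e → fstᵀ (f e))
  fstᵀᵖ {E} {f} P = mkPT (case (prog P) nil (var 0F)) (λ e → 1 + time P e + 1)
    (λ ρ e → go ρ e (f e) (run P ρ e)) (O-+ (O-+ (O-const 1) (time-O P)) (O-const 1)) (O-const 0)
    where
    go : ∀ {m} (ρ : Vec Tree m) e u → (enc E e ∷ ρ) ⊢ prog P ⇓ u [ time P e ] →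
         (enc E e ∷ ρ) ⊢ case (prog P) nil (var 0F) ⇓ fstᵀ u [ 1 + time P e + 1 ]
    go ρ e nil        d = case-nil d nil
    go ρ e (cons _ _) d = case-cons d (var 0F)

  sndᵀᵖ : ∀ {f} → PT E Treeᵗ f → PT E Treeᵗ (λ e → sndᵀ (f e))
  sndᵀᵖ {E} {f} P = mkPT (case (prog P) nil (var 1F)) (λ e → 1 + time P e + 1)
    (λ ρ e → go ρ e (f e) (run P ρ e)) (O-+ (O-+ (O-const 1) (time-O P)) (O-const 1)) (O-const 0)
    where
    go : ∀ {m} (ρ : Vec Tree m) e u → (enc E e ∷ ρ) ⊢ prog P ⇓ u [ time P e ] →
         (enc E e ∷ ρ) ⊢ case (prog P) nil (var 1F) ⇓ sndᵀ u [ 1 + time P e + 1 ]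
    go ρ e nil        d = case-nil d nil
    go ρ e (cons _ _) d = case-cons d (var 1F)

  reverse′ : List Bool → List Bool
  reverse′ = foldr (λ d ds → ds ++ d ∷ []) []

  reverseᵖ : ∀ {f} → PT E Digitsᵗ f → PT E Digitsᵗ (λ e → reverse′ (f e))
  reverseᵖ {f = f} P = foldᵖ P (const′ []) (sndᵖ π₂ ++ᵖ (fstᵖ π₂ ∷ᵖ const′ [])) (size-O P)
    λ e ys zs s → ≤-trans (≤-reflexive (go zs)) (suffix-μ (μ Boolᵗ) ys zs s)
    where
    go : ∀ ds → μ Digitsᵗ (reverse′ ds) ≡ μ Digitsᵗ ds
    go []       = refl
    go (d ∷ ds) = trans (μList-++ (μ Boolᵗ) (reverse′ ds) (d ∷ [])) (trans (+-comm _ 1) (cong suc (go ds)))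

  -- Comparison of binary numerals from the lowest digit upwards. The flag says
  -- how the numerals compare on equal remaining digits (true: ≤), and the loop
  -- follows the left numeral, so that the size of the right one is irrelevant.
  compare-step : Bool → Tree × Bool → Tree × Bool
  compare-step d s =
    if isNil (proj₁ s) then nil , false
    else (sndᵀ (proj₁ s) , (if d then (if isNil (fstᵀ (proj₁ s)) then false else proj₂ s)
                                 else (if isNil (fstᵀ (proj₁ s)) then proj₂ s else true)))

  -- When the left digits are used up, any digit remaining on the right makes the right numeral
  -- larger; otherwise the flag decides.
  verdict : Tree × Bool → Bool
  verdict s = if isNil (proj₁ s) then proj₂ s else true

  -- `foldr` meets the last entry first, so the reversed list presents the lowest digit first.
  atMost : List Bool → Tree → Bool
  atMost ds t = verdict (foldr compare-step (t , true) (reverse′ ds))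

  atMostᵖ : ∀ {f t} → PT E Digitsᵗ f → PT E Treeᵗ t → PT E Boolᵗ (λ e → atMost (f e) (t e))
  atMostᵖ P T = verdictᵖ (foldᵖ (reverseᵖ P) (T ,ᵖ const′ true)
      (ifᵖ (isNilᵖ tree) (const′ nil ,ᵖ const′ false) (sndᵀᵖ tree ,ᵖ
        ifᵖ (fstᵖ π₂) (ifᵖ (isNilᵖ (fstᵀᵖ tree)) (const′ false) flag) (ifᵖ (isNilᵖ (fstᵀᵖ tree)) flag (const′ true))))
      (O-const 0) λ _ _ _ _ → z≤n)
    where
    tree = fstᵖ (sndᵖ π₂)
    flag = sndᵖ (sndᵖ π₂)
    verdictᵖ : ∀ {s} → PT E (Treeᵗ ×ᵗ Boolᵗ) s → PT E Boolᵗ (λ e → verdict (s e))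
    verdictᵖ S = ifᵖ (isNilᵖ (fstᵖ S)) (sndᵖ S) (const′ true)

  -- The flag as a summand: `v + 0 ≤ w` is the comparison by ≤, and `v + 1 ≤ w` the strict one.
  slack : Bool → ℕ
  slack true  = 0
  slack false = 1

  iff⇒≤?ᵇ : ∀ {m n m′ n′} → (m ≤ n → m′ ≤ n′) → (m′ ≤ n′ → m ≤ n) → (m ≤?ᵇ n) ≡ (m′ ≤?ᵇ n′)
  iff⇒≤?ᵇ {m} {n} {m′} {n′} f h = Bool-ext (λ p → ≤?ᵇ-complete (f (≤?ᵇ-sound {m} {n} p))) (λ p → ≤?ᵇ-complete (h (≤?ᵇ-sound {m′} {n′} p)))

  slack≤1 : ∀ flag → slack flag ≤ 1
  slack≤1 true  = z≤n
  slack≤1 false = ≤-refl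

  -- A parity argument: for `e = 1` the left side is odd and the right side even, so there is room
  -- for one more `e`.
  halve : ∀ v w e → e ≤ 1 → v + v + e ≤ w + w → v + e ≤ w
  halve v w e e≤1 le = ≮⇒≥ λ w< → <⇒≱ (begin-strict
    w + w         <⟨ +-mono-≤-< (+-cancelʳ-≤ 1 w v (≤-trans (≤-reflexive (+-comm w 1)) (≤-trans w< (+-monoʳ-≤ v e≤1)))) w< ⟩
    v + (v + e)   ≡⟨ +-assoc v v e ⟨
    v + v + e     ∎) le
    where open ≤-Reasoning

  twice : ∀ v w e → v + e ≤ w → v + v + e ≤ w + w
  twice v w e le = ≤-trans (≤-reflexive (+-assoc v v e)) (+-mono-≤ (≤-trans (m≤m+n v e) le) le)

  halve< : ∀ v w e → 1 + (v + v) + e ≤ w + w → v + 1 ≤ w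
  halve< v w e le = halve v w 1 ≤-refl (≤-trans (≤-reflexive (+-comm (v + v) 1)) (≤-trans (m≤m+n _ e) le))

  twice< : ∀ v w e → e ≤ 1 → v + 1 ≤ w → 1 + (v + v) + e ≤ w + w
  twice< v w e e≤1 le = ≤-trans (+-monoʳ-≤ (1 + (v + v)) e≤1) (≤-trans (≤-reflexive lem) (+-mono-≤ le le))
    where
    lem : 1 + (v + v) + 1 ≡ v + 1 + (v + 1)
    lem = trans (cong (_+ 1) (trans (sym (+-assoc 1 v v)) (cong (_+ v) (+-comm 1 v)))) (+-assoc (v + 1) v 1)

  -- Equal digits leave the flag alone; 2 against 1 demands a strict inequality of the higher parts,
  -- and 1 against 2 only a weak one.
  compare-digit : ∀ d v b e → e ≤ 1 →
    (digitValue d v + e ≤?ᵇ ℕᵇ.toℕ 2[1+ b ]) ≡ (if d then v + e ≤?ᵇ ℕᵇ.toℕ b else v + 0 ≤?ᵇ ℕᵇ.toℕ b) ×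
    (digitValue d v + e ≤?ᵇ ℕᵇ.toℕ 1+[2 b ]) ≡ (if d then v + 1 ≤?ᵇ ℕᵇ.toℕ b else v + e ≤?ᵇ ℕᵇ.toℕ b)
  compare-digit d v b e e≤1 = even d , odd d
    where
    w = ℕᵇ.toℕ b
    2w : 2 * suc w ≡ 2 + (w + w)
    2w = trans (*-suc 2 w) (cong (2 +_) (sym (double w)))
    even : ∀ d → (digitValue d v + e ≤?ᵇ 2 * suc w) ≡ (if d then v + e ≤?ᵇ w else v + 0 ≤?ᵇ w)
    even true = trans (cong (2 + (v + v) + e ≤?ᵇ_) 2w) (iff⇒≤?ᵇ {2 + (v + v) + e} {2 + (w + w)} {v + e} {w}
      (λ le → halve v w e e≤1 (s≤s⁻¹ (s≤s⁻¹ le))) (λ le → s≤s (s≤s (twice v w e le))))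
    even false = trans (cong (1 + (v + v) + e ≤?ᵇ_) 2w) (iff⇒≤?ᵇ {1 + (v + v) + e} {2 + (w + w)} {v + 0} {w}
      (λ le → ≤-trans (≤-reflexive (+-identityʳ v)) (≮⇒≥ λ w<v → <⇒≱ (s≤s (≤-trans (s≤s (≤-reflexive (sym (+-suc w w))))
        (≤-trans (+-mono-≤ w<v w<v) (m≤m+n (v + v) e)))) le))
      (λ le → s≤s (≤-trans (+-monoʳ-≤ (v + v) e≤1) (≤-trans (≤-reflexive (+-comm (v + v) 1))
        (s≤s (+-mono-≤ (≤-trans (m≤m+n v 0) le) (≤-trans (m≤m+n v 0) le)))))))
    odd : ∀ d → (digitValue d v + e ≤?ᵇ suc (2 * w)) ≡ (if d then v + 1 ≤?ᵇ w else v + e ≤?ᵇ w)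
    odd true = trans (cong (λ z → 2 + (v + v) + e ≤?ᵇ suc z) (sym (double w))) (iff⇒≤?ᵇ {2 + (v + v) + e} {suc (w + w)} {v + 1} {w}
      (λ le → halve< v w e (s≤s⁻¹ le)) (λ le → s≤s (twice< v w e e≤1 le)))
    odd false = trans (cong (λ z → 1 + (v + v) + e ≤?ᵇ suc z) (sym (double w))) (iff⇒≤?ᵇ {1 + (v + v) + e} {suc (w + w)} {v + e} {w}
      (λ le → halve v w e e≤1 (s≤s⁻¹ le)) (λ le → s≤s (twice v w e le)))

  compare-correct : ∀ ds b flag → verdict (foldr compare-step (encodeℕᵇ b , flag) (reverse′ ds)) ≡
                    (valueOf ds + slack flag ≤?ᵇ ℕᵇ.toℕ b)
  compare-correct []       ℕᵇ.zero  true  = refl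
  compare-correct []       ℕᵇ.zero  false = refl
  compare-correct []       2[1+ b ] flag  = sym (≤?ᵇ-complete {slack flag} {2 * suc (ℕᵇ.toℕ b)} (≤-trans (slack≤1 flag) (s≤s z≤n)))
  compare-correct []       1+[2 b ] flag  = sym (≤?ᵇ-complete {slack flag} {suc (2 * ℕᵇ.toℕ b)} (≤-trans (slack≤1 flag) (s≤s z≤n)))
  compare-correct (d ∷ ds) b flag = trans
    (cong verdict (foldr-++ compare-step (encodeℕᵇ b , flag) (reverse′ ds) (d ∷ []))) (go b d flag)
    where
    v = valueOf ds
    none : ∀ d e → (digitValue d v + e ≤?ᵇ 0) ≡ false
    none true  e = refl
    none false e = refl
    go : ∀ b d flag → verdict (foldr compare-step (compare-step d (encodeℕᵇ b , flag)) (reverse′ ds)) ≡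
                      (digitValue d v + slack flag ≤?ᵇ ℕᵇ.toℕ b)
    go ℕᵇ.zero d flag = trans (compare-correct ds ℕᵇ.zero false)
      (trans (cong (λ m → m ≤?ᵇ 0) (+-comm v 1)) (sym (none d (slack flag))))
    go 2[1+ b ] true  flag = trans (compare-correct ds b flag) (sym (proj₁ (compare-digit true v b (slack flag) (slack≤1 flag))))
    go 2[1+ b ] false flag = trans (compare-correct ds b true) (sym (proj₁ (compare-digit false v b (slack flag) (slack≤1 flag))))
    go 1+[2 b ] true  flag = trans (compare-correct ds b false) (sym (proj₂ (compare-digit true v b (slack flag) (slack≤1 flag))))
    go 1+[2 b ] false flag = trans (compare-correct ds b flag) (sym (proj₂ (compare-digit false v b (slack flag) (slack≤1 flag))))

  within : List Bool → Tree → Bool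
  within ds t = if isNil (fstᵀ t) then atMost ds (sndᵀ t) else false

  within-correct : ∀ m t → within (digits (ℕᵇ.fromℕ m)) (encodeℤ t) ≡ ⌊ ℤ.+ m ℤ.≤? t ⌋
  within-correct m (ℤ.+ k) = trans (compare-correct (digits (ℕᵇ.fromℕ m)) (ℕᵇ.fromℕ k) true)
    (trans (cong₂ _≤?ᵇ_ (trans (+-identityʳ _) (valueOf-fromℕ m)) (ℕᵇ.toℕ-fromℕ k))
      (Bool-ext (λ p → ⌊⌋-yes (ℤ.+ m ℤ.≤? ℤ.+ k) (ℤ.+≤+ (≤?ᵇ-sound {m} {k} p)))
                (λ p → ≤?ᵇ-complete (ℤₚ.drop‿+≤+ (⌊⌋-sound (ℤ.+ m ℤ.≤? ℤ.+ k) p)))))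
  within-correct m ℤ.-[1+ k ] = sym (⌊⌋-no (ℤ.+ m ℤ.≤? ℤ.-[1+ k ]) λ ())

  abstract
    answerᵖ : PT Instanceᵗ Boolᵗ (λ i → within (digits (ℕᵇ.fromℕ (I.value i))) (Instance.limit i))
    answerᵖ = ifᵖ (isNilᵖ (fstᵀᵖ limitᵖ)) (atMostᵖ (digitsᵖ valueᵖ) (sndᵀᵖ limitᵖ)) (const′ false)

  encodeVec-toList : ∀ {A : Set} (e : A → Tree) {n} (xs : Vec A n) → encodeVec e xs ≡ encList e (toList xs)
  encodeVec-toList e []       = refl
  encodeVec-toList e (x ∷ xs) = cong (cons (e x)) (encodeVec-toList e xs)

  encodeGraph-rows : ∀ {n m} (xs : Vec (Subset n) m) → encodeVec encodeSubset xs ≡ enc Graphᵗ (toList (Vec.map toList xs))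
  encodeGraph-rows []       = refl
  encodeGraph-rows (x ∷ xs) = cong₂ cons (encodeVec-toList encodeBool x) (encodeGraph-rows xs)

  μ-toList : ∀ {n} (xs : Subset n) → μ Rowᵗ (toList xs) ≡ n
  μ-toList []       = refl
  μ-toList (x ∷ xs) = cong suc (μ-toList xs)

  μ-rows : ∀ {n m} (xs : Vec (Subset n) m) → μ Graphᵗ (toList (Vec.map toList xs)) ≡ m * suc n
  μ-rows []       = refl
  μ-rows (x ∷ xs) = cong₂ (λ a b → suc a + b) (μ-toList x) (μ-rows xs)

  algorithm : Program 3
  algorithm = let′ (cons (var 0F) (cons (var 1F) (var 2F))) (prog answerᵖ)

  -- Six steps assemble the three inputs.
  steps : Instance → ℕ
  steps i = 6 + time answerᵖ i

  steps-O : O Instanceᵗ steps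
  steps-O = O-+ (O-const 6) (time-O answerᵖ)

  degree : ℕ
  degree = exponent steps-O

  factor : ℕ → ℕ → ℕ
  factor k ℓ = (2 + budget k ℓ) ^ degree

  ^-distrib-* : ∀ a b c → (a * b) ^ c ≡ a ^ c * b ^ c
  ^-distrib-* a b zero    = refl
  ^-distrib-* a b (suc c) = trans (cong (a * b *_) (^-distrib-* a b c)) ([m*n]*[o*p]≡[m*o]*[n*p] a b (a ^ c) (b ^ c))

  decides : ∀ i {t} → Instance.limit i ≡ encodeℤ t →
    enc Graphᵗ (Instance.graph i) ∷ enc Rowᵗ (Instance.cover i) ∷ encodeℤ t ∷ [] ⊢ algorithm
    ⇓ encodeBool ⌊ ℤ.+ I.value i ℤ.≤? t ⌋ [ steps i ]
  decides i {t} limit≡ = subst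
    (λ u → enc Graphᵗ (Instance.graph i) ∷ enc Rowᵗ (Instance.cover i) ∷ u ∷ [] ⊢ algorithm
           ⇓ encodeBool ⌊ ℤ.+ I.value i ℤ.≤? t ⌋ [ steps i ]) limit≡
    (let′ (cons (var 0F) (cons (var 1F) (var 2F)))
      (subst (λ b → _ ⊢ prog answerᵖ ⇓ encodeBool b [ time answerᵖ i ])
        (trans (cong (within (digits (ℕᵇ.fromℕ (I.value i)))) limit≡) (within-correct (I.value i) t))
        (run answerᵖ _ i)))

  -- For N at least 1, 2 + B N is at most (2 + B) N, and the power of this product separates the
  -- factor in k and ℓ from the power of N.
  in-time : ∀ i → steps i ≤ factor (Instance.k i) (Instance.ℓ i) * suc (length (Instance.graph i)) ^ degree
  in-time i = begin
    steps i                           ≤⟨ bounds steps-O i ⟩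
    (2 + budget k ℓ * suc n) ^ degree ≤⟨ ^-monoˡ-≤ degree (+-monoˡ-≤ (budget k ℓ * suc n) (*-monoʳ-≤ 2 (s≤s z≤n))) ⟩
    (2 * suc n + budget k ℓ * suc n) ^ degree ≡⟨ cong (_^ degree) (*-distribʳ-+ (suc n) 2 (budget k ℓ)) ⟨
    ((2 + budget k ℓ) * suc n) ^ degree ≡⟨ ^-distrib-* (2 + budget k ℓ) (suc n) degree ⟩
    factor k ℓ * suc n ^ degree       ∎
    where
    open ≤-Reasoning
    open Instance i using (k; ℓ)
    n = length (Instance.graph i)

  module _ {n : ℕ} (G : Graph n) (S : Subset n) (k ℓ : ℕ) (t : ℤ) (bounded : IsBounded G S ℓ) (∣S∣≡k : ∣ S ∣ ≡ k) where
    open Bridge G S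

    abstract
     problem : ∃ λ i → (Instance.graph i ≡ rows × Instance.cover i ≡ marks) ×
                       (Instance.limit i ≡ encodeℤ t × Instance.k i ≡ k × Instance.ℓ i ≡ ℓ)
     problem = record
      { graph  = rows
      ; cover  = marks
      ; limit  = encodeℤ t
      ; k      = k
      ; ℓ      = ℓ
      ; graph≤ = ≤-trans (≤-reflexive (trans (μ-rows (tabulate (N G))) (cong (λ m → m * suc m) (sym length-rows)))) (*-monoˡ-≤ (suc (length rows)) (n≤1+n (length rows)))
      ; cover≤ = ≤-trans (≤-reflexive (trans (μ-toList S) (sym length-rows))) (n≤1+n _)
      ; k≤     = ≤-reflexive (trans (trans (cong (λ xs → length (select (Main.inCover rows marks) xs)) verts≡) (select-count n (Main.inCover rows marks)))
                   (trans (∑-cong λ v → cong bit (inCover≡ v)) (trans (sym (∣∣-count S)) ∣S∣≡k)))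
      ; ℓ≤     = Correct.comp≤ G S bounded
      } , (refl , refl) , (refl , refl , refl)

    answered : IsTwinCover G S → ∃ λ time →
      (encodeGraph G ∷ encodeSubset S ∷ encodeℤ t ∷ [] ⊢ algorithm ⇓ encodeBool ⌊ ℤ.+ imbalance G ℤ.≤? t ⌋ [ time ]) ×
      time ≤ factor k ℓ * suc n ^ degree
    answered twinCover = conclude problem
      where
      conclude : (∃ λ i → (Instance.graph i ≡ rows × Instance.cover i ≡ marks) ×
                          (Instance.limit i ≡ encodeℤ t × Instance.k i ≡ k × Instance.ℓ i ≡ ℓ)) →
        ∃ λ time →
        (encodeGraph G ∷ encodeSubset S ∷ encodeℤ t ∷ [] ⊢ algorithm ⇓ encodeBool ⌊ ℤ.+ imbalance G ℤ.≤? t ⌋ [ time ]) ×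
        time ≤ factor k ℓ * suc n ^ degree
      conclude (i , (g≡ , s≡) , t≡ , k≡ , ℓ≡) = steps i ,
        subst₂ (λ g s → g ∷ s ∷ encodeℤ t ∷ [] ⊢ algorithm ⇓ encodeBool ⌊ ℤ.+ imbalance G ℤ.≤? t ⌋ [ steps i ])
          (trans (cong (enc Graphᵗ) g≡) (sym (encodeGraph-rows (tabulate (N G)))))
          (trans (cong (enc Rowᵗ) s≡) (sym (encodeVec-toList encodeBool S)))
          (subst (λ v → enc Graphᵗ (Instance.graph i) ∷ enc Rowᵗ (Instance.cover i) ∷ encodeℤ t ∷ [] ⊢ algorithm
                          ⇓ encodeBool ⌊ ℤ.+ v ℤ.≤? t ⌋ [ steps i ])
            (trans (cong₂ Main.value g≡ s≡) (Correct.value≡imbalance G S twinCover)) (decides i t≡)) ,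
        subst₂ (λ f m → steps i ≤ f * suc m ^ degree) (cong₂ factor k≡ ℓ≡) (trans (cong length g≡) length-rows) (in-time i)

open import Data.Fin.Subset using (Subset; ∣_∣)
open import Data.Integer using (ℤ; +_; _≤?_)
open import Data.Nat using (ℕ; suc; _≤_; _*_; _^_)
open import Data.Product using (∃; _×_)
open import Data.Vec using ([]; _∷_)
open import Relation.Binary.PropositionalEquality using (_≡_)
open import Relation.Nullary.Decidable using (⌊_⌋)

theorem3 : ∃ λ (algorithm : Program 3) → ∃ λ (f : ℕ → ℕ → ℕ) → ∃ λ (c : ℕ) →
    Computable₂ f ×
    (∀ (n : ℕ) (G : Graph n) (S : Subset n) (k ℓ : ℕ) (t : ℤ) →
    IsTwinCover G S → IsBounded G S ℓ → ∣ S ∣ ≡ k →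
    ∃ λ (time : ℕ) →
    (encodeGraph G ∷ encodeSubset S ∷ encodeℤ t ∷ [] ⊢ algorithm
    ⇓ encodeBool ⌊ + imbalance G ≤? t ⌋ [ time ]) ×
    time ≤ f k ℓ * suc n ^ c)
theorem3 = algorithm , factor , degree , computable degree ,
    λ n G S k ℓ t twinCover bounded ∣S∣≡k → answered G S k ℓ t bounded ∣S∣≡k twinCover
  where
  open import Data.Product using (_,_)
  open Answer
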